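{- Let $p$ be a prime and $A\subseteq\mathbb{F}_p$ a set with $|A|>p^{2/5}$. Then for some absolute constant $C>0$, $$\Big|\mathsf{T}(A)-\frac{|A|^6}{p}\Big|\ll \big(\log(2p/|A|)\big)^{C}\,|A|^{40/9}p^{2/9},$$ with an absolute implied constant.
   Context: $\mathsf{T}(A)$ is the number of collinear triples in $A\times A$: the number of 6-tuples $(a,a',a_1,a_1',a_2,a_2')\in A^6$ such that the points $(a,a'),(a_1,a_1'),(a_2,a_2')$ of $\mathbb{F}_p^2$ lie on a common line, i.e. $(a_1-a)(a_2'-a')=(a_2-a)(a_1'-a')$. -}

module Defs where

open import Data.Nat using (ℕ; zero; suc; _+_; _*_; _∸_; _/_; ∣_-_∣)
open import Data.Nat.Divisibility using (_∣_; _∣?_)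
open import Data.Nat.Logarithm using (⌈log₂_⌉)
open import Data.Fin using (Fin; toℕ)
open import Data.Fin.Subset using (Subset; _∈_)
open import Data.Fin.Subset.Properties using (_∈?_)
open import Data.List using (List; length; allFin; concatMap; [_]; [])
open import Relation.Nullary using (Dec; yes; no)

-- Elements of F_p are represented by Fin p (residues 0..p-1);
-- a set A ⊆ F_p is a Subset p.

elems : ∀ {p} → Subset p → List ℕ
elems {p} A = concatMap keep (allFin p)
  where
  keep' : (x : Fin p) → Dec (x ∈ A) → List ℕ
  keep' x (yes _) = [ toℕ x ]
  keep' x (no _)  = []
  keep : Fin p → List ℕ
  keep x = keep' x (x ∈? A)

-- Collinearity of (a,a'),(b,b'),(c,c') in F_p^2 (coordinates given as residues < p):
-- (b - a)(c' - a') = (c - a)(b' - a')  in F_p, i.e. p divides the difference.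
-- (Adding p makes the subtractions exact in ℕ and does not change classes mod p.)
Collinear : ℕ → ℕ → ℕ → ℕ → ℕ → ℕ → ℕ → Set
Collinear p a a' b b' c c' =
  p ∣ ∣ ((b + p ∸ a) * (c' + p ∸ a')) - ((c + p ∸ a) * (b' + p ∸ a')) ∣

collinear? : ∀ p a a' b b' c c' → Dec (Collinear p a a' b b' c c')
collinear? p a a' b b' c c' = p ∣? _

T : (p : ℕ) → Subset p → ℕ
T p A = total
  where
  E = elems A
  sumL : List ℕ → (ℕ → ℕ) → ℕ
  sumL [] f = 0
  sumL (x Data.List.∷ xs) f = f x + sumL xs f
  ind : ∀ {P : Set} → Dec P → ℕ
  ind (yes _) = 1
  ind (no _)  = 0
  total : ℕ
  total = sumL E λ a → sumL E λ a' → sumL E λ b → sumL E λ b' →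
         sumL E λ c → sumL E λ c' → ind (collinear? p a a' b b' c c')

-- L(p,a) = ⌈log₂ (2p/a)⌉ (for a ≥ 1), computed as ⌈log₂ ⌈2p/a⌉⌉.
logTerm : ℕ → ℕ → ℕ
logTerm p zero    = 0
logTerm p (suc k) = ⌈log₂ ((2 * p + k) / suc k) ⌉

-- The bound holds without the logarithmic factor (C = 0).  Let n = |A|.
--
-- Apart from O(n⁴) degenerate ones, the collinear triples are counted by the lines b = s a + t and the number
-- of points of A × A on them.  For p⁷ ≤ n¹³ the second moment of this number suffices, as it gives
-- |p T - n⁶| ≤ 5 p² n³.  For n¹³ < p⁷ one shows m T ≤ 7 n⁵ for an m with m⁹ p² of order n⁵, by bounding the
-- number of lines with more than 4 m r points, where r is of order n / m².
--
-- Suppose there are at least m r n such lines (s, t).  Counting parameters gives a nonzero polynomial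
-- G(s, t, a) over 𝔽ₚ such that G and many of its derivatives under D = ∂ₛ - a ∂ₜ vanish at these (s, t), for
-- all a.  Then G(s, b - s a, a) is the zero polynomial in s whenever (a, b) lies on at least r of the lines,
-- and double counting produces many such (a, b) in A × A.  But with R = 𝔽ₚ[s] and G in R[t][a] of degree e in a
-- and k < p in t, at most (2 e + 1) k + 2 e n of the points (b - s a, a) are zeros of G: all of them are zeros of
-- D G too, so if there are more than (2 e + 1) k then Bezout's bound provides a syzygy of G and D G, and by
-- Gauss's lemma either G factors, and one proceeds by induction, or G divides D G up to a constant.  In the latter
-- case comparing coefficients shows that G has total degree at most e in (t, a), hence at most 2 e n zeros.
module Submission where

open import Algebra.Bundles using (CommutativeRing)
import Algebra.Solver.Ring.NaturalCoefficients.Default as SemiringSolver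
open import Data.Empty using (⊥-elim)
open import Data.List as List using (List; []; _∷_; map; length; upTo; cartesianProduct; filter; _++_)
open import Data.List.Membership.Propositional using (_∈_)
open import Data.List.Membership.Propositional.Properties using (∈-map⁺; ∈-++⁺ˡ; ∈-++⁺ʳ; ∈-upTo⁺; ∈-cartesianProduct⁺; ∈-filter⁻; ∈-map⁻; ∈-cartesianProduct⁻; ∈-upTo⁻)
open import Data.List.Properties using (length-map; length-++; length-upTo)
open import Data.List.Relation.Unary.All as All using (All; []; _∷_)
import Data.List.Relation.Unary.All.Properties as Allₚ
open import Data.List.Relation.Unary.AllPairs as AP using (AllPairs; []; _∷_)
import Data.List.Relation.Unary.AllPairs.Properties as APₚ
open import Data.List.Relation.Unary.Any using (here; there)
open import Data.List.Relation.Unary.Unique.Propositional using (Unique)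
import Data.List.Relation.Unary.Unique.Propositional.Properties as Uniqueₚ
open import Data.Nat as ℕ using (ℕ; zero; suc; _≤_; _<_; z≤n; s≤s; _⊔_)
import Data.Nat.Properties as ℕₚ
open import Data.Nat.Solver using (module +-*-Solver)
open import Data.Product using (_,_; ∃-syntax; _×_; proj₁; proj₂; uncurry)
open import Data.Product.Properties using (≡-dec)
open import Data.Sum using (_⊎_; inj₁; inj₂; map₁)
open import Data.Vec as Vec using (Vec; []; _∷_; take; drop)
import Data.Vec.Properties as Vecₚ
open import Data.Vec.Relation.Binary.Pointwise.Inductive using (Pointwise; []; _∷_)
import Data.Vec.Relation.Unary.All as VAll
open import Function using (_∘_)
open import Level using (0ℓ)
open import Relation.Binary.PropositionalEquality as ≡ using (_≡_; _≢_)
import Relation.Binary.Reasoning.Setoid as SetoidReasoning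
open import Relation.Binary.Structures using (IsEquivalence)
open import Relation.Nullary using (¬_; Dec; yes; no)
import Relation.Nullary.Decidable as Dec

-- A polynomial in s and t alone, of degree below r E in each and vanishing to order 2 E, would
-- handle only about r² lines, while the m r n supposed ones number about m³ r². Letting G depend on
-- the direction a as well multiplies the number of coefficients by E, but the derivatives under D
-- up to order 2 E still cost only O(E²) conditions per line; hence E of order m³. The zeros (b - s
-- a, a) are counted by treating s as a constant: the dual lines of A × A become points of a plane
-- over 𝔽ₚ[s], and D G supplies a second curve through all those that lie on G. The comparison works
-- as long as m⁷ is at most a small constant times n. The target n⁴⁰ p² = n⁴⁵ / m⁹ for T⁹ asks for
-- m⁹ p² of order n⁵, and at n¹³ = p⁷ the two sizes of m agree, which is where the second moment
-- takes over. All algebra is done over domains with denominators cleared, and nothing is ever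
-- decomposed into irreducibles: a factorization is used only when a division exhibits it.

module Unfolding where
  open import Defs
  open import Data.Nat
  open import Data.Nat.Properties
  open import Data.Bool using (Bool; true; false)
  open import Data.Fin.Subset using (Subset)
  open import Data.Unit using (⊤; tt)
  open import Relation.Binary.PropositionalEquality
  open import Tactic.Cong using (cong!; ⌞_⌟)
  open import Tactic.MonoidSolver using () renaming (solve to solveMonoid)

  ∑ : ∀ {A : Set} → List A → (A → ℕ) → ℕ
  ∑ []       f = 0
  ∑ (x ∷ xs) f = f x + ∑ xs f

  𝟙 : ∀ {P : Set} → Dec P → ℕ
  𝟙 (yes _) = 1
  𝟙 (no _)  = 0

  gate : Bool → ℕ → ℕ
  gate true  m = m
  gate false m = 0

  unify : ∀ {m n l : ℕ} {b : Bool} → m ≡ n → gate b l ≡ m → true ≡ b → l ≡ l → ⊤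
  unify _ _ _ _ = tt

  -- The summation in the definition of T is local to it and cannot be named.  The body functions below recover
  -- it by unification: `with` abstracts the set of elements, then a congruence in a marked inner occurrence of
  -- the list separates that occurrence from the outer one, and extract reads off the function of the two lists.
  -- The gate is there to bring the term into weak head normal form before the metavariable is solved.
  data IsCong {A B : Set} : {l r : B} → l ≡ r → Set where
    isCong : {x y : A} (f : A → B) (e : x ≡ y) → IsCong (cong f e)

  lhs : ∀ {l r : ℕ} → l ≡ r → ℕ
  lhs {l} _ = l

  mutual
    body0 : ∀ p (A : Subset p) (E : List ℕ) → _ ≡ _
    T≡body0 : ∀ p (A : Subset p) → T p A ≡ T p A
    T≡body0 p A with elems A
    ... | E = body0 p A E
    body0 p A E = refl

    congruence1 : ∀ p (A : Subset p) E (e : E ≡ E) → _ ≡ _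
    mark1 : ∀ p (A : Subset p) E (e : E ≡ E) → ⊤
    mark1 p A E e = unify (body0 p A ⌞ E ⌟) refl refl (congruence1 p A E e)
    congruence1 p A E e = cong! e
    body1 : ∀ p (A : Subset p) (E z : List ℕ) → _ ≡ _
    extract1 : ∀ p (A : Subset p) E (e : E ≡ E) → IsCong (congruence1 p A E e)
    extract1 p A E e = isCong (λ z → lhs (body1 p A E z)) _
    body1 p A E z = refl

    congruence2 : ∀ p (A : Subset p) a E (e : E ≡ E) → _ ≡ _
    mark2 : ∀ p (A : Subset p) a E (e : E ≡ E) → ⊤
    mark2 p A a E e = unify (body1 p A (a ∷ []) ⌞ E ⌟) refl refl (congruence2 p A a E e)
    congruence2 p A a E e = cong! e
    body2 : ∀ p (A : Subset p) a (E z : List ℕ) → _ ≡ _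
    extract2 : ∀ p (A : Subset p) a E (e : E ≡ E) → IsCong (congruence2 p A a E e)
    extract2 p A a E e = isCong (λ z → lhs (body2 p A a E z)) _
    body2 p A a E z = refl

    congruence3 : ∀ p (A : Subset p) a a' E (e : E ≡ E) → _ ≡ _
    mark3 : ∀ p (A : Subset p) a a' E (e : E ≡ E) → ⊤
    mark3 p A a a' E e = unify (body2 p A a (a' ∷ []) ⌞ E ⌟) refl refl (congruence3 p A a a' E e)
    congruence3 p A a a' E e = cong! e
    body3 : ∀ p (A : Subset p) a a' (E z : List ℕ) → _ ≡ _
    extract3 : ∀ p (A : Subset p) a a' E (e : E ≡ E) → IsCong (congruence3 p A a a' E e)
    extract3 p A a a' E e = isCong (λ z → lhs (body3 p A a a' E z)) _
    body3 p A a a' E z = refl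

    congruence4 : ∀ p (A : Subset p) a a' b E (e : E ≡ E) → _ ≡ _
    mark4 : ∀ p (A : Subset p) a a' b E (e : E ≡ E) → ⊤
    mark4 p A a a' b E e = unify (body3 p A a a' (b ∷ []) ⌞ E ⌟) refl refl (congruence4 p A a a' b E e)
    congruence4 p A a a' b E e = cong! e
    body4 : ∀ p (A : Subset p) a a' b (E z : List ℕ) → _ ≡ _
    extract4 : ∀ p (A : Subset p) a a' b E (e : E ≡ E) → IsCong (congruence4 p A a a' b E e)
    extract4 p A a a' b E e = isCong (λ z → lhs (body4 p A a a' b E z)) _
    body4 p A a a' b E z = refl

    congruence5 : ∀ p (A : Subset p) a a' b b' E (e : E ≡ E) → _ ≡ _
    mark5 : ∀ p (A : Subset p) a a' b b' E (e : E ≡ E) → ⊤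
    mark5 p A a a' b b' E e = unify (body4 p A a a' b (b' ∷ []) ⌞ E ⌟) refl refl (congruence5 p A a a' b b' E e)
    congruence5 p A a a' b b' E e = cong! e
    body5 : ∀ p (A : Subset p) a a' b b' (E z : List ℕ) → _ ≡ _
    extract5 : ∀ p (A : Subset p) a a' b b' E (e : E ≡ E) → IsCong (congruence5 p A a a' b b' E e)
    extract5 p A a a' b b' E e = isCong (λ z → lhs (body5 p A a a' b b' E z)) _
    body5 p A a a' b b' E z = refl

  step6 : ∀ p (A : Subset p) a a' b b' c E →
    lhs (body5 p A a a' b b' (c ∷ []) E) ≡ ∑ E λ c' → 𝟙 (collinear? p a a' b b' c c')
  step6 p A a a' b b' c [] = refl
  step6 p A a a' b b' c (c' ∷ E) with collinear? p a a' b b' c c'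
  ... | yes _ = cong suc (step6 p A a a' b b' c E)
  ... | no _  = step6 p A a a' b b' c E

  -- The outermost sum runs over `E` and all inner ones over `z`: an induction on a single list in
  -- both roles would change the summand along the way.
  step5 : ∀ p (A : Subset p) a a' b b' E z →
    lhs (body5 p A a a' b b' E z) ≡ (∑ E λ c → ∑ z λ c' → 𝟙 (collinear? p a a' b b' c c'))
  step5 p A a a' b b' [] z = refl
  step5 p A a a' b b' (c ∷ E) z = trans (split p A a a' b b' c E z) (cong₂ _+_ (step6 p A a a' b b' c z) (step5 p A a a' b b' E z))
    where
    split : ∀ p (A : Subset p) a a' b b' c E z →
      lhs (body5 p A a a' b b' (c ∷ E) z) ≡ lhs (body5 p A a a' b b' (c ∷ []) z) + lhs (body5 p A a a' b b' E z)
    split p A a a' b b' c E z = solveMonoid +-0-monoid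

  step4 : ∀ p (A : Subset p) a a' b E z →
    lhs (body4 p A a a' b E z) ≡ (∑ E λ b' → ∑ z λ c → ∑ z λ c' → 𝟙 (collinear? p a a' b b' c c'))
  step4 p A a a' b [] z = refl
  step4 p A a a' b (b' ∷ E) z = trans (split p A a a' b b' E z) (cong₂ _+_ (step5 p A a a' b b' z z) (step4 p A a a' b E z))
    where
    split : ∀ p (A : Subset p) a a' b b' E z →
      lhs (body4 p A a a' b (b' ∷ E) z) ≡ lhs (body5 p A a a' b b' z z) + lhs (body4 p A a a' b E z)
    split p A a a' b b' E z = solveMonoid +-0-monoid

  step3 : ∀ p (A : Subset p) a a' E z →
    lhs (body3 p A a a' E z) ≡ (∑ E λ b → ∑ z λ b' → ∑ z λ c → ∑ z λ c' → 𝟙 (collinear? p a a' b b' c c'))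
  step3 p A a a' [] z = refl
  step3 p A a a' (b ∷ E) z = trans (split p A a a' b E z) (cong₂ _+_ (step4 p A a a' b z z) (step3 p A a a' E z))
    where
    split : ∀ p (A : Subset p) a a' b E z →
      lhs (body3 p A a a' (b ∷ E) z) ≡ lhs (body4 p A a a' b z z) + lhs (body3 p A a a' E z)
    split p A a a' b E z = solveMonoid +-0-monoid

  step2 : ∀ p (A : Subset p) a E z →
    lhs (body2 p A a E z) ≡ (∑ E λ a' → ∑ z λ b → ∑ z λ b' → ∑ z λ c → ∑ z λ c' → 𝟙 (collinear? p a a' b b' c c'))
  step2 p A a [] z = refl
  step2 p A a (a' ∷ E) z = trans (split p A a a' E z) (cong₂ _+_ (step3 p A a a' z z) (step2 p A a E z))
    where
    split : ∀ p (A : Subset p) a a' E z →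
      lhs (body2 p A a (a' ∷ E) z) ≡ lhs (body3 p A a a' z z) + lhs (body2 p A a E z)
    split p A a a' E z = solveMonoid +-0-monoid

  step1 : ∀ p (A : Subset p) E z →
    lhs (body1 p A E z) ≡ (∑ E λ a → ∑ z λ a' → ∑ z λ b → ∑ z λ b' → ∑ z λ c → ∑ z λ c' → 𝟙 (collinear? p a a' b b' c c'))
  step1 p A [] z = refl
  step1 p A (a ∷ E) z = trans (split p A a E z) (cong₂ _+_ (step2 p A a z z) (step1 p A E z))
    where
    split : ∀ p (A : Subset p) a E z →
      lhs (body1 p A (a ∷ E) z) ≡ lhs (body2 p A a z z) + lhs (body1 p A E z)
    split p A a E z = solveMonoid +-0-monoid

  T≡∑ : ∀ p (A : Subset p) → let z = elems A in T p A ≡ (∑ z λ a → ∑ z λ a' → ∑ z λ b → ∑ z λ b' → ∑ z λ c → ∑ z λ c' → 𝟙 (collinear? p a a' b b' c c'))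
  T≡∑ p A = step1 p A (elems A) (elems A)

-- Finite sums of natural numbers and indicators

module FiniteSums where
  open Unfolding using (∑; 𝟙)
  open import Data.Nat
  open import Data.Nat.Properties
  open import Relation.Unary using (Pred; Decidable)
  open import Relation.Binary.PropositionalEquality
  import Algebra.Properties.CommutativeSemigroup +-commutativeSemigroup as +-CS

  module _ {A : Set} where
    ∑-mono-∈ : ∀ (xs : List A) {f g} → (∀ {x} → x ∈ xs → f x ≤ g x) → ∑ xs f ≤ ∑ xs g
    ∑-mono-∈ []       h = z≤n
    ∑-mono-∈ (x ∷ xs) h = +-mono-≤ (h (here refl)) (∑-mono-∈ xs (h ∘ there))

    ∑-mono : ∀ (xs : List A) {f g} → (∀ x → f x ≤ g x) → ∑ xs f ≤ ∑ xs g
    ∑-mono xs h = ∑-mono-∈ xs (λ {x} _ → h x)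

    ∑-cong-∈ : ∀ (xs : List A) {f g} → (∀ {x} → x ∈ xs → f x ≡ g x) → ∑ xs f ≡ ∑ xs g
    ∑-cong-∈ []       h = refl
    ∑-cong-∈ (x ∷ xs) h = cong₂ _+_ (h (here refl)) (∑-cong-∈ xs (h ∘ there))

    ∑-cong : ∀ (xs : List A) {f g} → (∀ x → f x ≡ g x) → ∑ xs f ≡ ∑ xs g
    ∑-cong xs h = ∑-cong-∈ xs (λ {x} _ → h x)

    ∑-+ : ∀ (xs : List A) f g → ∑ xs (λ x → f x + g x) ≡ ∑ xs f + ∑ xs g
    ∑-+ []       f g = refl
    ∑-+ (x ∷ xs) f g = trans (cong (f x + g x +_) (∑-+ xs f g)) (+-CS.interchange (f x) (g x) _ _)

    ∑-*ˡ : ∀ c (xs : List A) f → ∑ xs (λ x → c * f x) ≡ c * ∑ xs f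
    ∑-*ˡ c []       f = sym (*-zeroʳ c)
    ∑-*ˡ c (x ∷ xs) f = trans (cong (c * f x +_) (∑-*ˡ c xs f)) (sym (*-distribˡ-+ c _ _))

    ∑-*ʳ : ∀ c (xs : List A) f → ∑ xs (λ x → f x * c) ≡ ∑ xs f * c
    ∑-*ʳ c xs f = trans (∑-cong xs (λ x → *-comm (f x) c)) (trans (∑-*ˡ c xs f) (*-comm c _))

    ∑-const : ∀ (xs : List A) c → ∑ xs (λ _ → c) ≡ length xs * c
    ∑-const []       c = refl
    ∑-const (x ∷ xs) c = cong (c +_) (∑-const xs c)

    ∑-0 : ∀ (xs : List A) → ∑ xs (λ _ → 0) ≡ 0
    ∑-0 xs = trans (∑-const xs 0) (*-zeroʳ (length xs))

    ∑-≤-const : ∀ (xs : List A) {f} c → (∀ x → f x ≤ c) → ∑ xs f ≤ length xs * c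
    ∑-≤-const xs c h = ≤-trans (∑-mono xs h) (≤-reflexive (∑-const xs c))

    ∑-++ : ∀ (xs ys : List A) f → ∑ (xs ++ ys) f ≡ ∑ xs f + ∑ ys f
    ∑-++ []       ys f = refl
    ∑-++ (x ∷ xs) ys f = trans (cong (f x +_) (∑-++ xs ys f)) (sym (+-assoc (f x) _ _))

    ∑-filter : ∀ {P : Pred A _} (P? : Decidable P) xs f → ∑ (filter P? xs) f ≡ ∑ xs (λ x → 𝟙 (P? x) * f x)
    ∑-filter P? []       f = refl
    ∑-filter P? (x ∷ xs) f with P? x
    ... | yes _ = cong₂ _+_ (sym (+-identityʳ (f x))) (∑-filter P? xs f)
    ... | no  _ = ∑-filter P? xs f

    length≡∑ : ∀ (xs : List A) → length xs ≡ ∑ xs (λ _ → 1)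
    length≡∑ xs = sym (trans (∑-const xs 1) (*-identityʳ _))

    length-filter≡∑ : ∀ {P : Pred A _} (P? : Decidable P) xs → length (filter P? xs) ≡ ∑ xs (λ x → 𝟙 (P? x))
    length-filter≡∑ P? xs = trans (length≡∑ (filter P? xs)) (trans (∑-filter P? xs (λ _ → 1)) (∑-cong xs (λ x → *-identityʳ _)))

  ∑-map : ∀ {A B : Set} (h : A → B) xs f → ∑ (map h xs) f ≡ ∑ xs (f ∘ h)
  ∑-map h []       f = refl
  ∑-map h (x ∷ xs) f = cong (f (h x) +_) (∑-map h xs f)

  ∑-swap : ∀ {A B : Set} (xs : List A) (ys : List B) (f : A → B → ℕ) →
           ∑ xs (λ x → ∑ ys (λ y → f x y)) ≡ ∑ ys (λ y → ∑ xs (λ x → f x y))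
  ∑-swap []       ys f = sym (∑-0 ys)
  ∑-swap (x ∷ xs) ys f = trans (cong (∑ ys (f x) +_) (∑-swap xs ys f)) (sym (∑-+ ys (f x) (λ y → ∑ xs (λ z → f z y))))

  ∑-cartesianProduct : ∀ {A B : Set} (xs : List A) (ys : List B) f →
    ∑ (cartesianProduct xs ys) f ≡ ∑ xs (λ x → ∑ ys (λ y → f (x , y)))
  ∑-cartesianProduct []       ys f = refl
  ∑-cartesianProduct (x ∷ xs) ys f = trans (∑-++ (map (x ,_) ys) _ f)
    (cong₂ _+_ (∑-map (x ,_) ys f) (∑-cartesianProduct xs ys f))

  module _ {P Q : Set} where
    𝟙-mono : (p : Dec P) (q : Dec Q) → (P → Q) → 𝟙 p ≤ 𝟙 q
    𝟙-mono (yes p) (yes q) h = ≤-refl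
    𝟙-mono (yes p) (no ¬q) h = ⊥-elim (¬q (h p))
    𝟙-mono (no ¬p) q       h = z≤n

    𝟙-⇔ : (p : Dec P) (q : Dec Q) → (P → Q) → (Q → P) → 𝟙 p ≡ 𝟙 q
    𝟙-⇔ (yes p) (yes q) h k = refl
    𝟙-⇔ (yes p) (no ¬q) h k = ⊥-elim (¬q (h p))
    𝟙-⇔ (no ¬p) (yes q) h k = ⊥-elim (¬p (k q))
    𝟙-⇔ (no ¬p) (no ¬q) h k = refl

  𝟙≤1 : ∀ {P : Set} (p : Dec P) → 𝟙 p ≤ 1
  𝟙≤1 (yes _) = ≤-refl
  𝟙≤1 (no _)  = z≤n

  𝟙-yes : ∀ {P : Set} (p : Dec P) → P → 𝟙 p ≡ 1
  𝟙-yes (yes _)  _ = refl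
  𝟙-yes (no ¬p) p = ⊥-elim (¬p p)

  𝟙-no : ∀ {P : Set} (p : Dec P) → ¬ P → 𝟙 p ≡ 0
  𝟙-no (yes p) ¬p = ⊥-elim (¬p p)
  𝟙-no (no _)  _  = refl

  𝟙-⊎ : ∀ {P Q R : Set} (p : Dec P) (q : Dec Q) (r : Dec R) → (P → Q ⊎ R) → 𝟙 p ≤ 𝟙 q + 𝟙 r
  𝟙-⊎ (no _)  q       r       h = z≤n
  𝟙-⊎ (yes p) (yes q) r       h = s≤s z≤n
  𝟙-⊎ (yes p) (no ¬q) (yes r) h = ≤-refl
  𝟙-⊎ (yes p) (no ¬q) (no ¬r) h with h p
  ... | inj₁ q = ⊥-elim (¬q q)
  ... | inj₂ r = ⊥-elim (¬r r)

  length-cartesianProduct : ∀ {A B : Set} (xs : List A) (ys : List B) →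
                            length (cartesianProduct xs ys) ≡ length xs * length ys
  length-cartesianProduct xs ys = trans (length≡∑ (cartesianProduct xs ys))
    (trans (∑-cartesianProduct xs ys (λ _ → 1)) (trans (∑-cong xs (λ _ → sym (length≡∑ ys))) (∑-const xs (length ys))))

open Unfolding using (∑; 𝟙)
open FiniteSums

-- Polynomials over a domain, as coefficient lists

record Domain : Set₁ where
  field
    commutativeRing : CommutativeRing 0ℓ 0ℓ
  open CommutativeRing commutativeRing public hiding (zero)
  field
    zero?     : ∀ x → Dec (x ≈ 0#)
    nonzero-* : ∀ {x y} → ¬ x ≈ 0# → ¬ y ≈ 0# → ¬ x * y ≈ 0#
    1≉0       : ¬ 1# ≈ 0#

module Polynomial (D : Domain) where
  open Domain D renaming (Carrier to C)
  open SetoidReasoning setoid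
  open SemiringSolver commutativeSemiring using (solve) renaming (_:+_ to _⊕_; _:=_ to _⊜_)
  open import Algebra.Properties.Ring ring using (-0#≈0#)

  coeff : List C → ℕ → C
  coeff []      i       = 0#
  coeff (x ∷ f) zero    = x
  coeff (x ∷ f) (suc i) = coeff f i

  infix 4 _≈ₚ_
  -- Coefficient lists may end in zeros, so equality compares coefficients. It is a record because f
  -- and g can be recovered from a record type, but not from the function type it wraps.
  record _≈ₚ_ (f g : List C) : Set where
    constructor pointwise
    field at : ∀ i → coeff f i ≈ coeff g i
  open _≈ₚ_ public

  ≈ₚ-isEquivalence : IsEquivalence _≈ₚ_
  ≈ₚ-isEquivalence = record
    { refl  = pointwise λ i → refl
    ; sym   = λ p → pointwise λ i → sym (at p i)
    ; trans = λ p q → pointwise λ i → trans (at p i) (at q i)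
    }

  private
    module E = IsEquivalence ≈ₚ-isEquivalence

  private
    interchange : ∀ a b c d → (a + b) + (c + d) ≈ (a + c) + (b + d)
    interchange = solve 4 (λ a b c d → ((a ⊕ b) ⊕ (c ⊕ d)) ⊜ ((a ⊕ c) ⊕ (b ⊕ d))) refl

  opaque
    add : List C → List C → List C
    add []      g       = g
    add (x ∷ f) []      = x ∷ f
    add (x ∷ f) (y ∷ g) = x + y ∷ add f g

    scale : C → List C → List C
    scale c = map (c *_)

    neg : List C → List C
    neg = map (-_)

    mul : List C → List C → List C
    mul []      g = []
    mul (x ∷ f) g = add (scale x g) (0# ∷ mul f g)

    coeff-add : ∀ f g i → coeff (add f g) i ≈ coeff f i + coeff g i
    coeff-add []      g       i       = sym (+-identityˡ _)
    coeff-add (x ∷ f) []      i       = sym (+-identityʳ _)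
    coeff-add (x ∷ f) (y ∷ g) zero    = refl
    coeff-add (x ∷ f) (y ∷ g) (suc i) = coeff-add f g i

    coeff-scale : ∀ c f i → coeff (scale c f) i ≈ c * coeff f i
    coeff-scale c []      i       = sym (zeroʳ c)
    coeff-scale c (x ∷ f) zero    = refl
    coeff-scale c (x ∷ f) (suc i) = coeff-scale c f i

    coeff-neg : ∀ f i → coeff (neg f) i ≈ - coeff f i
    coeff-neg []      i       = sym -0#≈0#
    coeff-neg (x ∷ f) zero    = refl
    coeff-neg (x ∷ f) (suc i) = coeff-neg f i

    add-cong : ∀ {f f′ g g′} → f ≈ₚ f′ → g ≈ₚ g′ → add f g ≈ₚ add f′ g′
    add-cong {f} {f′} {g} {g′} p q = pointwise λ i →
      trans (coeff-add f g i) (trans (+-cong (at p i) (at q i)) (sym (coeff-add f′ g′ i)))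

    scale-cong : ∀ {c c′ f f′} → c ≈ c′ → f ≈ₚ f′ → scale c f ≈ₚ scale c′ f′
    scale-cong {c} {c′} {f} {f′} p q = pointwise λ i →
      trans (coeff-scale c f i) (trans (*-cong p (at q i)) (sym (coeff-scale c′ f′ i)))

    ∷-cong : ∀ {x x′ f f′} → x ≈ x′ → f ≈ₚ f′ → x ∷ f ≈ₚ x′ ∷ f′
    ∷-cong p q = pointwise λ { zero → p ; (suc i) → at q i }

    tail-cong : ∀ {x x′ f f′} → x ∷ f ≈ₚ x′ ∷ f′ → f ≈ₚ f′
    tail-cong p = pointwise λ i → at p (suc i)

    0∷[] : 0# ∷ [] ≈ₚ []
    0∷[] = pointwise λ { zero → refl ; (suc i) → refl }

    add-assoc : ∀ f g h → add (add f g) h ≈ₚ add f (add g h)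
    add-assoc f g h = pointwise λ i → begin
      coeff (add (add f g) h) i ≈⟨ coeff-add (add f g) h i ⟩
      coeff (add f g) i + coeff h i ≈⟨ +-congʳ (coeff-add f g i) ⟩
      (coeff f i + coeff g i) + coeff h i ≈⟨ +-assoc _ _ _ ⟩
      coeff f i + (coeff g i + coeff h i) ≈⟨ +-congˡ (coeff-add g h i) ⟨
      coeff f i + coeff (add g h) i ≈⟨ coeff-add f (add g h) i ⟨
      coeff (add f (add g h)) i ∎

    add-comm : ∀ f g → add f g ≈ₚ add g f
    add-comm f g = pointwise λ i →
      trans (coeff-add f g i) (trans (+-comm _ _) (sym (coeff-add g f i)))

    add-identityˡ : ∀ f → add [] f ≈ₚ f
    add-identityˡ f = E.refl

    add-identityʳ : ∀ f → add f [] ≈ₚ f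
    add-identityʳ f = pointwise λ i → trans (coeff-add f [] i) (+-identityʳ _)

    add-inverseʳ : ∀ f → add f (neg f) ≈ₚ []
    add-inverseʳ f = pointwise λ i →
      trans (coeff-add f (neg f) i) (trans (+-congˡ (coeff-neg f i)) (-‿inverseʳ _))

    add-interchange : ∀ f g h k → add (add f g) (add h k) ≈ₚ add (add f h) (add g k)
    add-interchange f g h k = pointwise λ i → begin
      coeff (add (add f g) (add h k)) i ≈⟨ coeff-add (add f g) (add h k) i ⟩
      coeff (add f g) i + coeff (add h k) i ≈⟨ +-cong (coeff-add f g i) (coeff-add h k i) ⟩
      (coeff f i + coeff g i) + (coeff h i + coeff k i) ≈⟨ interchange _ _ _ _ ⟩
      (coeff f i + coeff h i) + (coeff g i + coeff k i) ≈⟨ +-cong (coeff-add f h i) (coeff-add g k i) ⟨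
      coeff (add f h) i + coeff (add g k) i ≈⟨ coeff-add (add f h) (add g k) i ⟨
      coeff (add (add f h) (add g k)) i ∎

    add-swap : ∀ f g h → add f (add g h) ≈ₚ add g (add f h)
    add-swap f g h = E.trans (E.sym (add-assoc f g h))
      (E.trans (add-cong (add-comm f g) E.refl) (add-assoc g f h))

    scale-add : ∀ c f g → scale c (add f g) ≈ₚ add (scale c f) (scale c g)
    scale-add c f g = pointwise λ i → begin
      coeff (scale c (add f g)) i ≈⟨ coeff-scale c (add f g) i ⟩
      c * coeff (add f g) i ≈⟨ *-congˡ (coeff-add f g i) ⟩
      c * (coeff f i + coeff g i) ≈⟨ distribˡ _ _ _ ⟩
      c * coeff f i + c * coeff g i ≈⟨ +-cong (coeff-scale c f i) (coeff-scale c g i) ⟨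
      coeff (scale c f) i + coeff (scale c g) i ≈⟨ coeff-add (scale c f) (scale c g) i ⟨
      coeff (add (scale c f) (scale c g)) i ∎

    scale-+ : ∀ c d f → scale (c + d) f ≈ₚ add (scale c f) (scale d f)
    scale-+ c d f = pointwise λ i → begin
      coeff (scale (c + d) f) i ≈⟨ coeff-scale (c + d) f i ⟩
      (c + d) * coeff f i ≈⟨ distribʳ _ _ _ ⟩
      c * coeff f i + d * coeff f i ≈⟨ +-cong (coeff-scale c f i) (coeff-scale d f i) ⟨
      coeff (scale c f) i + coeff (scale d f) i ≈⟨ coeff-add (scale c f) (scale d f) i ⟨
      coeff (add (scale c f) (scale d f)) i ∎

    scale-scale : ∀ c d f → scale c (scale d f) ≈ₚ scale (c * d) f
    scale-scale c d f = pointwise λ i → begin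
      coeff (scale c (scale d f)) i ≈⟨ coeff-scale c (scale d f) i ⟩
      c * coeff (scale d f) i ≈⟨ *-congˡ (coeff-scale d f i) ⟩
      c * (d * coeff f i) ≈⟨ *-assoc _ _ _ ⟨
      (c * d) * coeff f i ≈⟨ coeff-scale (c * d) f i ⟨
      coeff (scale (c * d) f) i ∎

    scale-0 : ∀ {c} f → c ≈ 0# → scale c f ≈ₚ []
    scale-0 {c} f c≈0 = pointwise λ i →
      trans (coeff-scale c f i) (trans (*-congʳ c≈0) (zeroˡ _))

    scale-1 : ∀ f → scale 1# f ≈ₚ f
    scale-1 f = pointwise λ i → trans (coeff-scale 1# f i) (*-identityˡ _)

    mul-zeroˡ : ∀ f g → f ≈ₚ [] → mul f g ≈ₚ []
    mul-zeroˡ []      g p = E.refl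
    mul-zeroˡ (x ∷ f) g p =
      add-cong (scale-0 g (at p 0))
        (E.trans (∷-cong refl (mul-zeroˡ f g (pointwise λ i → at p (suc i)))) 0∷[])

    mul-congʳ : ∀ {f f′} g → f ≈ₚ f′ → mul f g ≈ₚ mul f′ g
    mul-congʳ {[]}    {f′}     g p = E.sym (mul-zeroˡ f′ g (E.sym p))
    mul-congʳ {x ∷ f} {[]}     g p = mul-zeroˡ (x ∷ f) g p
    mul-congʳ {x ∷ f} {y ∷ f′} g p =
      add-cong (scale-cong (at p 0) E.refl) (∷-cong refl (mul-congʳ g (tail-cong p)))

    mul-congˡ : ∀ f {g g′} → g ≈ₚ g′ → mul f g ≈ₚ mul f g′
    mul-congˡ []      p = E.refl
    mul-congˡ (x ∷ f) p = add-cong (scale-cong refl p) (∷-cong refl (mul-congˡ f p))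

    0∷-add : ∀ f g → 0# ∷ add f g ≈ₚ add (0# ∷ f) (0# ∷ g)
    0∷-add f g = ∷-cong (sym (+-identityˡ 0#)) E.refl

    mul-distribˡ : ∀ f g h → mul f (add g h) ≈ₚ add (mul f g) (mul f h)
    mul-distribˡ []      g h = E.refl
    mul-distribˡ (x ∷ f) g h = E.trans
      (add-cong (scale-add x g h) (E.trans (∷-cong refl (mul-distribˡ f g h)) (0∷-add (mul f g) (mul f h))))
      (add-interchange (scale x g) (scale x h) (0# ∷ mul f g) (0# ∷ mul f h))

    mul-distribʳ : ∀ h f g → mul (add f g) h ≈ₚ add (mul f h) (mul g h)
    mul-distribʳ h []      g       = E.refl
    mul-distribʳ h (x ∷ f) []      = E.sym (add-identityʳ _)
    mul-distribʳ h (x ∷ f) (y ∷ g) = E.trans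
      (add-cong (scale-+ x y h) (E.trans (∷-cong refl (mul-distribʳ h f g)) (0∷-add (mul f h) (mul g h))))
      (add-interchange (scale x h) (scale y h) (0# ∷ mul f h) (0# ∷ mul g h))

    mul-0∷ : ∀ f g → mul (0# ∷ f) g ≈ₚ 0# ∷ mul f g
    mul-0∷ f g = add-cong (scale-0 g refl) E.refl

    scale-0∷ : ∀ c f → scale c (0# ∷ f) ≈ₚ 0# ∷ scale c f
    scale-0∷ c f = ∷-cong (zeroʳ c) E.refl

    mul-scale : ∀ c f g → mul (scale c f) g ≈ₚ scale c (mul f g)
    mul-scale c []      g = E.refl
    mul-scale c (x ∷ f) g = E.trans
      (add-cong (E.sym (scale-scale c x g))
        (E.trans (∷-cong refl (mul-scale c f g)) (E.sym (scale-0∷ c (mul f g)))))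
      (E.sym (scale-add c (scale x g) (0# ∷ mul f g)))

    mul-assoc : ∀ f g h → mul (mul f g) h ≈ₚ mul f (mul g h)
    mul-assoc []      g h = E.refl
    mul-assoc (x ∷ f) g h = E.trans (mul-distribʳ h (scale x g) (0# ∷ mul f g))
      (add-cong (mul-scale x g h) (E.trans (mul-0∷ (mul f g) h) (∷-cong refl (mul-assoc f g h))))

    mul-zeroʳ : ∀ f → mul f [] ≈ₚ []
    mul-zeroʳ []      = E.refl
    mul-zeroʳ (x ∷ f) = E.trans (∷-cong refl (mul-zeroʳ f)) 0∷[]

    -- The mirror image of the defining recursion, in the second factor; commutativity follows by
    -- comparing the two.
    mul-∷ : ∀ f y g → mul f (y ∷ g) ≈ₚ add (scale y f) (0# ∷ mul f g)
    mul-∷ []      y g = E.sym 0∷[]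
    mul-∷ (x ∷ f) y g = ∷-cong (+-congʳ (*-comm x y))
      (E.trans (add-cong (E.refl {scale x g}) (mul-∷ f y g)) (add-swap (scale x g) (scale y f) (0# ∷ mul f g)))

    mul-comm : ∀ f g → mul f g ≈ₚ mul g f
    mul-comm []      g = E.sym (mul-zeroʳ g)
    mul-comm (x ∷ f) g = E.trans (add-cong E.refl (∷-cong refl (mul-comm f g))) (E.sym (mul-∷ g x f))

    mul-identityˡ : ∀ f → mul (1# ∷ []) f ≈ₚ f
    mul-identityˡ f = E.trans (add-cong (scale-1 f) 0∷[]) (add-identityʳ f)

  polynomialRing : CommutativeRing 0ℓ 0ℓ
  polynomialRing = record
    { Carrier = List C
    ; _≈_ = _≈ₚ_
    ; _+_ = add
    ; _*_ = mul
    ; -_  = neg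
    ; 0#  = []
    ; 1#  = 1# ∷ []
    ; isCommutativeRing = record
      { isRing = record
        { +-isAbelianGroup = record
          { isGroup = record
            { isMonoid = record
              { isSemigroup = record
                { isMagma = record { isEquivalence = ≈ₚ-isEquivalence ; ∙-cong = add-cong }
                ; assoc = add-assoc }
              ; identity = add-identityˡ , add-identityʳ }
            ; inverse = (λ f → E.trans (add-comm _ _) (add-inverseʳ f)) , add-inverseʳ
            ; ⁻¹-cong = λ {f} {g} p → pointwise λ i →
                trans (coeff-neg f i) (trans (-‿cong (at p i)) (sym (coeff-neg g i))) }
          ; comm = add-comm }
        ; *-cong = λ {f} {f′} {g} {g′} p q → E.trans (mul-congʳ g p) (mul-congˡ f′ q)
        ; *-assoc = mul-assoc
        ; *-identity = mul-identityˡ , λ f → E.trans (mul-comm f _) (mul-identityˡ f)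
        ; distrib = mul-distribˡ , mul-distribʳ }
      ; *-comm = mul-comm }
    }

  zeroₚ? : ∀ f → Dec (f ≈ₚ [])
  zeroₚ? []      = yes E.refl
  zeroₚ? (x ∷ f) with zero? x | zeroₚ? f
  ... | yes p | yes q = yes (E.trans (∷-cong p q) 0∷[])
  ... | no ¬p | _     = no λ q → ¬p (at q 0)
  ... | yes _ | no ¬q = no λ q → ¬q (pointwise λ i → at q (suc i))

  coeff₀-mul : ∀ x f y g → coeff (mul (x ∷ f) (y ∷ g)) 0 ≈ y * x
  coeff₀-mul x f y g = begin
    coeff (mul (x ∷ f) (y ∷ g)) 0 ≈⟨ at (mul-∷ (x ∷ f) y g) 0 ⟩
    coeff (add (scale y (x ∷ f)) (0# ∷ mul (x ∷ f) g)) 0 ≈⟨ coeff-add (scale y (x ∷ f)) _ 0 ⟩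
    coeff (scale y (x ∷ f)) 0 + 0# ≈⟨ +-identityʳ _ ⟩
    coeff (scale y (x ∷ f)) 0 ≈⟨ coeff-scale y (x ∷ f) 0 ⟩
    y * x ∎

  private
    -- Vanishing low-order coefficients are stripped from each factor in turn. What remains has
    -- nonzero constant terms, and so does its product.
    mul-nonzero₁ : ∀ x f g → ¬ x ≈ 0# → ¬ g ≈ₚ [] → ¬ mul (x ∷ f) g ≈ₚ []
    mul-nonzero₁ x f []      x≉0 g≉0 _ = g≉0 E.refl
    mul-nonzero₁ x f (y ∷ g) x≉0 g≉0 fg≈0 with zero? y
    ... | no  y≉0 = nonzero-* y≉0 x≉0 (trans (sym (coeff₀-mul x f y g)) (at fg≈0 0))
    ... | yes y≈0 = mul-nonzero₁ x f g x≉0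
      (λ g≈0 → g≉0 (E.trans (∷-cong y≈0 g≈0) 0∷[]))
      (tail-cong (E.trans (E.sym (E.trans (mul-∷ (x ∷ f) y g)
        (E.trans (add-cong (scale-0 (x ∷ f) y≈0) E.refl) (add-identityˡ _)))) (E.trans fg≈0 (E.sym 0∷[]))))

  mul-nonzero : ∀ f g → ¬ f ≈ₚ [] → ¬ g ≈ₚ [] → ¬ mul f g ≈ₚ []
  mul-nonzero []      g f≉0 g≉0 _ = f≉0 E.refl
  mul-nonzero (x ∷ f) g f≉0 g≉0 fg≈0 with zero? x
  ... | no  x≉0 = mul-nonzero₁ x f g x≉0 g≉0 fg≈0
  ... | yes x≈0 = mul-nonzero f g
    (λ f≈0 → f≉0 (E.trans (∷-cong x≈0 f≈0) 0∷[])) g≉0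
    (tail-cong (E.trans (E.sym (mul-0∷ f g))
      (E.trans (mul-congʳ g (∷-cong (sym x≈0) E.refl)) (E.trans fg≈0 (E.sym 0∷[])))))

Poly : Domain → Domain
Poly D = record
  { commutativeRing = polynomialRing
  ; zero? = zeroₚ?
  ; nonzero-* = λ {f} {g} → mul-nonzero f g
  ; 1≉0 = λ p → Domain.1≉0 D (at p 0)
  }
  where open Polynomial D

-- Ring homomorphisms and evaluation of polynomials

record Hom (R S : CommutativeRing 0ℓ 0ℓ) : Set where
  private
    module R = CommutativeRing R
    module S = CommutativeRing S
  field
    ⟦_⟧    : R.Carrier → S.Carrier
    cong   : ∀ {x y} → x R.≈ y → ⟦ x ⟧ S.≈ ⟦ y ⟧
    0-homo : ⟦ R.0# ⟧ S.≈ S.0#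
    1-homo : ⟦ R.1# ⟧ S.≈ S.1#
    +-homo : ∀ x y → ⟦ x R.+ y ⟧ S.≈ ⟦ x ⟧ S.+ ⟦ y ⟧
    *-homo : ∀ x y → ⟦ x R.* y ⟧ S.≈ ⟦ x ⟧ S.* ⟦ y ⟧

idHom : ∀ R → Hom R R
idHom R = record { ⟦_⟧ = λ x → x ; cong = λ p → p ; 0-homo = refl ; 1-homo = refl
                 ; +-homo = λ _ _ → refl ; *-homo = λ _ _ → refl }
  where open CommutativeRing R

-- Coefficients are mapped by φ while the variable goes to x, so evaluations can be stacked: `evHom`
-- for an inner variable serves as φ for the outer one.
module Evaluation (D : Domain) {S : CommutativeRing 0ℓ 0ℓ}
                  (φ : Hom (Domain.commutativeRing D) S) (x : CommutativeRing.Carrier S) where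
  open Polynomial D
  private
    module D = Domain D
    module φ = Hom φ
  open CommutativeRing S
  open SetoidReasoning setoid

  ev : List D.Carrier → Carrier
  ev []      = 0#
  ev (c ∷ f) = φ.⟦ c ⟧ + x * ev f

  private
    +0 : ∀ {a b} → a ≈ 0# → b ≈ 0# → a + x * b ≈ 0#
    +0 p q = trans (+-cong p (trans (*-congˡ q) (zeroʳ x))) (+-identityˡ 0#)

  ev-0 : ∀ f → f ≈ₚ [] → ev f ≈ 0#
  ev-0 []      p = refl
  ev-0 (c ∷ f) p = +0 (trans (φ.cong (at p 0)) φ.0-homo) (ev-0 f (pointwise λ i → at p (suc i)))

  ev-cong : ∀ {f g} → f ≈ₚ g → ev f ≈ ev g
  ev-cong {[]}    {g}     p = sym (ev-0 g (Domain.sym (Poly D) p))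
  ev-cong {c ∷ f} {[]}    p = ev-0 (c ∷ f) p
  ev-cong {c ∷ f} {d ∷ g} p = +-cong (φ.cong (at p 0)) (*-congˡ (ev-cong (tail-cong p)))

  private
    interchange : ∀ a b c d → (a + b) + x * (c + d) ≈ (a + x * c) + (b + x * d)
    interchange a b c d = trans (+-congˡ (distribˡ x c d))
      (trans (+-assoc a b _) (trans (+-congˡ (trans (sym (+-assoc b _ _))
      (trans (+-congʳ (+-comm b _)) (+-assoc _ b _)))) (sym (+-assoc a _ _))))

  opaque
    unfolding mul
    ev-+ : ∀ f g → ev (add f g) ≈ ev f + ev g
    ev-+ []      g       = sym (+-identityˡ _)
    ev-+ (c ∷ f) []      = sym (+-identityʳ _)
    ev-+ (c ∷ f) (d ∷ g) = trans (+-cong (φ.+-homo c d) (*-congˡ (ev-+ f g))) (interchange _ _ _ _)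

    ev-scale : ∀ c f → ev (scale c f) ≈ φ.⟦ c ⟧ * ev f
    ev-scale c []      = sym (zeroʳ _)
    ev-scale c (d ∷ f) = begin
      φ.⟦ c D.* d ⟧ + x * ev (scale c f) ≈⟨ +-cong (φ.*-homo c d) (*-congˡ (ev-scale c f)) ⟩
      φ.⟦ c ⟧ * φ.⟦ d ⟧ + x * (φ.⟦ c ⟧ * ev f) ≈⟨ +-congˡ (trans (sym (*-assoc _ _ _)) (trans (*-congʳ (*-comm _ _)) (*-assoc _ _ _))) ⟩
      φ.⟦ c ⟧ * φ.⟦ d ⟧ + φ.⟦ c ⟧ * (x * ev f) ≈⟨ distribˡ _ _ _ ⟨
      φ.⟦ c ⟧ * (φ.⟦ d ⟧ + x * ev f) ∎

    ev-* : ∀ f g → ev (mul f g) ≈ ev f * ev g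
    ev-* []      g = sym (zeroˡ _)
    ev-* (c ∷ f) g = begin
      ev (add (scale c g) (D.0# ∷ mul f g)) ≈⟨ ev-+ (scale c g) (D.0# ∷ mul f g) ⟩
      ev (scale c g) + (φ.⟦ D.0# ⟧ + x * ev (mul f g))  ≈⟨ +-cong (ev-scale c g) (trans (+-congʳ φ.0-homo) (trans (+-identityˡ _) (*-congˡ (ev-* f g)))) ⟩
      φ.⟦ c ⟧ * ev g + x * (ev f * ev g) ≈⟨ +-congˡ (*-assoc _ _ _) ⟨
      φ.⟦ c ⟧ * ev g + (x * ev f) * ev g ≈⟨ distribʳ _ _ _ ⟨
      (φ.⟦ c ⟧ + x * ev f) * ev g ∎

  ev-const : ∀ c → ev (c ∷ []) ≈ φ.⟦ c ⟧
  ev-const c = trans (+-congˡ (zeroʳ x)) (+-identityʳ _)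

  evHom : Hom (Domain.commutativeRing (Poly D)) S
  evHom = record
    { ⟦_⟧ = ev ; cong = ev-cong ; 0-homo = refl ; 1-homo = trans (ev-const D.1#) φ.1-homo
    ; +-homo = ev-+ ; *-homo = ev-* }

-- Degree bounds, pseudo-division and roots

module Degrees (D : Domain) where
  open Polynomial D
  open Domain D renaming (Carrier to C)
  open import Algebra.Properties.Ring ring using (-0#≈0#)
  module P = Domain (Poly D)
  module PS = SemiringSolver P.commutativeSemiring

  const : C → List C
  const c = c ∷ []

  infix 4 _≺_
  -- The strict form includes the zero polynomial, which has no `Degree`, as the case N = 0, and it
  -- is insensitive to zeros at the end of the list.
  record _≺_ (f : List C) (N : ℕ) : Set where
    constructor below
    field vanish : ∀ i → N ≤ i → coeff f i ≈ 0#
  open _≺_ public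

  ≺-cong : ∀ {f g N} → f P.≈ g → f ≺ N → g ≺ N
  ≺-cong p b = below λ i N≤i → trans (sym (at p i)) (vanish b i N≤i)

  ≺-mono : ∀ {f M N} → M ≤ N → f ≺ M → f ≺ N
  ≺-mono M≤N b = below λ i N≤i → vanish b i (ℕₚ.≤-trans M≤N N≤i)

  ≺-0 : ∀ {f} → f ≺ 0 → f P.≈ P.0#
  ≺-0 b = pointwise λ i → vanish b i z≤n

  0≺ : ∀ {f} N → f P.≈ P.0# → f ≺ N
  0≺ N p = below λ i _ → at p i

  ≺-length : ∀ f → f ≺ length f
  ≺-length f = below (go f)
    where
    go : ∀ f i → length f ≤ i → coeff f i ≈ 0#
    go []      i       _         = refl
    go (x ∷ f) (suc i) (s≤s l≤i) = go f i l≤i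

  ≺-tail : ∀ {x f N} → x ∷ f ≺ suc N → f ≺ N
  ≺-tail b = below λ i N≤i → vanish b (suc i) (s≤s N≤i)

  ≺-∷ : ∀ {x f N} → f ≺ N → x ∷ f ≺ suc N
  ≺-∷ b = below λ { (suc i) (s≤s N≤i) → vanish b i N≤i }

  ≺-+ : ∀ {f g N} → f ≺ N → g ≺ N → f P.+ g ≺ N
  ≺-+ {f} {g} p q = below λ i N≤i →
    trans (coeff-add f g i) (trans (+-cong (vanish p i N≤i) (vanish q i N≤i)) (+-identityˡ 0#))

  ≺-neg : ∀ {f N} → f ≺ N → P.- f ≺ N
  ≺-neg {f} p = below λ i N≤i → trans (coeff-neg f i) (trans (-‿cong (vanish p i N≤i)) -0#≈0#)

  scale≈const* : ∀ c f → scale c f P.≈ const c P.* f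
  scale≈const* c f = P.sym (P.trans (mul-comm (const c) f) (P.trans (mul-∷ f c [])
    (P.trans (add-cong P.refl (P.trans (∷-cong refl (mul-zeroʳ f)) 0∷[])) (add-identityʳ _))))

  coeff-const* : ∀ c f i → coeff (const c P.* f) i ≈ c * coeff f i
  coeff-const* c f i = trans (sym (at (scale≈const* c f) i)) (coeff-scale c f i)

  const-* : ∀ c d → const (c * d) P.≈ const c P.* const d
  const-* c d = pointwise λ
    { zero    → sym (coeff-const* c (const d) 0)
    ; (suc i) → sym (trans (coeff-const* c (const d) (suc i)) (zeroʳ c)) }

  const-0 : ∀ {c} → c ≈ 0# → const c P.≈ P.0#
  const-0 c≈0 = P.trans (∷-cong c≈0 P.refl) 0∷[]

  ≺-const* : ∀ c {f N} → f ≺ N → const c P.* f ≺ N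
  ≺-const* c {f} p = below λ i N≤i →
    trans (coeff-const* c f i) (trans (*-congˡ (vanish p i N≤i)) (zeroʳ c))

  ∷-split : ∀ x f → x ∷ f P.≈ const x P.+ (0# ∷ P.1# P.* f)
  ∷-split x f = pointwise λ i → trans (go i) (sym (coeff-add (const x) _ i))
    where
    go : ∀ i → coeff (x ∷ f) i ≈ coeff (const x) i + coeff (0# ∷ P.1# P.* f) i
    go zero    = sym (+-identityʳ x)
    go (suc i) = trans (sym (at (P.*-identityˡ f) i)) (sym (+-identityˡ _))

  private
    mul-x∷ : ∀ x f g → (x ∷ f) P.* g P.≈ scale x g P.+ (0# ∷ f P.* g)
    mul-x∷ x f g = P.trans (mul-comm (x ∷ f) g)
      (P.trans (mul-∷ g x f) (add-cong P.refl (∷-cong refl (mul-comm g f))))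

  coeff-x∷* : ∀ x f g i → coeff ((x ∷ f) P.* g) i ≈ x * coeff g i + coeff (0# ∷ f P.* g) i
  coeff-x∷* x f g i = trans (at (mul-x∷ x f g) i) (trans (coeff-add (scale x g) _ i) (+-congʳ (coeff-scale x g i)))

  ≺-* : ∀ {f g m n} → f ≺ suc m → g ≺ suc n → f P.* g ≺ suc (m ℕ.+ n)
  ≺-* {[]}    {g}             p q = 0≺ _ (P.zeroˡ g)
  ≺-* {x ∷ f} {g} {zero}  {n} p q = below λ i n≤i → trans (coeff-x∷* x f g i)
    (trans (+-cong (trans (*-congˡ (vanish q i n≤i)) (zeroʳ x)) (at z i)) (+-identityˡ 0#))
    where
    z : 0# ∷ f P.* g P.≈ P.0#
    z = P.trans (∷-cong refl (P.trans (P.*-congʳ (≺-0 (≺-tail p))) (P.zeroˡ g))) 0∷[]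
  ≺-* {x ∷ f} {g} {suc m} {n} p q = below go
    where
    go : ∀ i → suc (suc m ℕ.+ n) ≤ i → coeff ((x ∷ f) P.* g) i ≈ 0#
    go (suc i) (s≤s h) = trans (coeff-x∷* x f g (suc i))
      (trans (+-cong (trans (*-congˡ (vanish q (suc i) (s≤s (ℕₚ.≤-trans (ℕₚ.≤-trans (ℕₚ.m≤n+m n m) (ℕₚ.n≤1+n _)) h)))) (zeroʳ x))
        (vanish (≺-* (≺-tail p) q) i h)) (+-identityˡ 0#))

  coeff-top : ∀ {f g} m n → f ≺ suc m → g ≺ suc n →
              coeff (f P.* g) (m ℕ.+ n) ≈ coeff f m * coeff g n
  coeff-top {[]}    {g} m       n p q = trans (at (P.zeroˡ g) _) (sym (zeroˡ _))
  coeff-top {x ∷ f} {g} zero    n p q = trans (coeff-x∷* x f g n) (trans (+-congˡ (at z n)) (+-identityʳ _))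
    where
    z : 0# ∷ f P.* g P.≈ P.0#
    z = P.trans (∷-cong refl (P.trans (P.*-congʳ (≺-0 (≺-tail p))) (P.zeroˡ g))) 0∷[]
  coeff-top {x ∷ f} {g} (suc m) n p q = trans (coeff-x∷* x f g _)
    (trans (+-cong (trans (*-congˡ (vanish q _ (s≤s (ℕₚ.m≤n+m n m)))) (zeroʳ x)) (coeff-top m n (≺-tail p) q)) (+-identityˡ _))

  record Degree (f : List C) (d : ℕ) : Set where
    constructor degree
    field
      lead≉0 : ¬ coeff f d ≈ 0#
      bound  : f ≺ suc d
  open Degree public

  degree? : ∀ f → f P.≈ P.0# ⊎ (∃[ d ] Degree f d)
  degree? [] = inj₁ P.refl
  degree? (x ∷ f) with degree? f | zero? x
  ... | inj₂ (d , e) | _       = inj₂ (suc d , degree (lead≉0 e) (≺-∷ (bound e)))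
  ... | inj₁ f≈0     | yes x≈0 = inj₁ (P.trans (∷-cong x≈0 f≈0) 0∷[])
  ... | inj₁ f≈0     | no  x≉0 = inj₂ (0 , degree x≉0 (≺-∷ (0≺ 0 f≈0)))

  hasDegree : ∀ {f} → ¬ f P.≈ P.0# → ∃[ d ] Degree f d
  hasDegree {f} f≉0 with degree? f
  ... | inj₁ f≈0 = ⊥-elim (f≉0 f≈0)
  ... | inj₂ d   = d

  degree-≉0 : ∀ {f d} → Degree f d → ¬ f P.≈ P.0#
  degree-≉0 e p = lead≉0 e (at p _)

  degree-< : ∀ {f d N} → Degree f d → f ≺ N → d < N
  degree-< {d = d} {N} e b with d ℕₚ.<? N
  ... | yes d<N = d<N
  ... | no  d≮N = ⊥-elim (lead≉0 e (vanish b d (ℕₚ.≮⇒≥ d≮N)))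

  degree-unique : ∀ {f d e} → Degree f d → Degree f e → d ≡ e
  degree-unique p q = ℕₚ.≤-antisym (ℕ.s≤s⁻¹ (degree-< p (bound q))) (ℕ.s≤s⁻¹ (degree-< q (bound p)))

  degree-cong : ∀ {f g d} → f P.≈ g → Degree f d → Degree g d
  degree-cong p e = degree (λ q → lead≉0 e (trans (at p _) q)) (≺-cong p (bound e))

  degree-* : ∀ {f g m n} → Degree f m → Degree g n → Degree (f P.* g) (m ℕ.+ n)
  degree-* p q = degree (λ z → nonzero-* (lead≉0 p) (lead≉0 q) (trans (sym (coeff-top _ _ (bound p) (bound q))) z))
                        (≺-* (bound p) (bound q))

  degree-const : ∀ {c} → ¬ c ≈ 0# → Degree (const c) 0
  degree-const c≉0 = degree c≉0 (≺-length _)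

  degree-const* : ∀ {c f d} → ¬ c ≈ 0# → Degree f d → Degree (const c P.* f) d
  degree-const* c≉0 = degree-* (degree-const c≉0)

  monomial : C → ℕ → List C
  monomial c zero    = const c
  monomial c (suc k) = 0# ∷ monomial c k

  monomial-≺ : ∀ c k → monomial c k ≺ suc k
  monomial-≺ c zero    = ≺-length _
  monomial-≺ c (suc k) = ≺-∷ (monomial-≺ c k)

  coeff-monomial : ∀ c k → coeff (monomial c k) k ≈ c
  coeff-monomial c zero    = refl
  coeff-monomial c (suc k) = coeff-monomial c k

  -- Division of f by w in which f is first multiplied by a nonzero constant, so that no inverses are needed.
  pseudoDivide : ∀ {w v} → Degree w v → ∀ N f → f ≺ N →
    ∃[ c ] ∃[ q ] ∃[ r ] (¬ c ≈ 0#) × (const c P.* f P.≈ q P.* w P.+ r) × (r ≺ v)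
  pseudoDivide {w} {v} W zero f b =
    1# , P.0# , f , 1≉0 , P.trans (P.*-identityˡ f) (P.sym (P.trans (P.+-congʳ (P.zeroˡ w)) (P.+-identityˡ f))) , ≺-mono z≤n b
  pseudoDivide {w} {v} W (suc N) f b with v ℕ.≤? N
  ... | no v≰N =
    1# , P.0# , f , 1≉0 , P.trans (P.*-identityˡ f) (P.sym (P.trans (P.+-congʳ (P.zeroˡ w)) (P.+-identityˡ f))) , ≺-mono (ℕₚ.≰⇒> v≰N) b
  ... | yes v≤N = let (c , q , r , c≉0 , eq , r≺v) = pseudoDivide W N f′ f′≺N in
    c * u , q P.+ const c P.* m , r , nonzero-* c≉0 (lead≉0 W) , main c q r eq , r≺v
    where
    u = coeff w v
    m = monomial (coeff f N) (N ℕ.∸ v)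
    -- After multiplication of f by the leading coefficient u of w, a multiple of w cancels its top
    -- coefficient without any division.
    f′ = const u P.* f P.+ P.- (m P.* w)
    k+v : (N ℕ.∸ v) ℕ.+ v ≡ N
    k+v = ℕₚ.m∸n+n≡m v≤N
    mw≺ : m P.* w ≺ suc N
    mw≺ = ≡.subst (λ n → m P.* w ≺ suc n) k+v (≺-* (monomial-≺ _ (N ℕ.∸ v)) (bound W))
    top : coeff (m P.* w) N ≈ coeff f N * u
    top = ≡.subst (λ n → coeff (m P.* w) n ≈ coeff f N * u) k+v
      (trans (coeff-top (N ℕ.∸ v) v (monomial-≺ _ (N ℕ.∸ v)) (bound W)) (*-congʳ (coeff-monomial _ (N ℕ.∸ v))))
    f′≺N : f′ ≺ N
    f′≺N = below go
      where
      go : ∀ i → N ≤ i → coeff f′ i ≈ 0#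
      go i N≤i with ℕₚ.m≤n⇒m<n∨m≡n N≤i
      ... | inj₁ N<i = vanish (≺-+ (≺-const* u b) (≺-neg mw≺)) i N<i
      ... | inj₂ ≡.refl = trans (coeff-add (const u P.* f) _ N) (trans
        (+-cong (trans (coeff-const* u f N) (*-comm u _)) (trans (coeff-neg (m P.* w) N) (-‿cong top))) (-‿inverseʳ _))
    split : const u P.* f P.≈ f′ P.+ m P.* w
    split = P.sym (P.trans (P.+-assoc _ _ _) (P.trans (P.+-congˡ (P.-‿inverseˡ _)) (P.+-identityʳ _)))
    main : ∀ c q r → const c P.* f′ P.≈ q P.* w P.+ r →
           const (c * u) P.* f P.≈ (q P.+ const c P.* m) P.* w P.+ r
    main c q r eq = begin
      const (c * u) P.* f ≈⟨ P.*-congʳ (const-* c u) ⟩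
      (const c P.* const u) P.* f ≈⟨ P.*-assoc _ _ _ ⟩
      const c P.* (const u P.* f) ≈⟨ P.*-congˡ split ⟩
      const c P.* (f′ P.+ m P.* w) ≈⟨ P.distribˡ _ _ _ ⟩
      const c P.* f′ P.+ const c P.* (m P.* w) ≈⟨ P.+-congʳ eq ⟩
      (q P.* w P.+ r) P.+ const c P.* (m P.* w) ≈⟨ rearrange q w r (const c) m ⟩
      (q P.+ const c P.* m) P.* w P.+ r ∎
      where
      open SetoidReasoning P.setoid
      open PS using (solve) renaming (_:+_ to _⊕_; _:*_ to _⊗_; _:=_ to _⊜_)
      rearrange : ∀ q w r c m → (q P.* w P.+ r) P.+ c P.* (m P.* w) P.≈ (q P.+ c P.* m) P.* w P.+ r
      rearrange = solve 5 (λ q w r c m → ((q ⊗ w ⊕ r) ⊕ c ⊗ (m ⊗ w)) ⊜ ((q ⊕ c ⊗ m) ⊗ w ⊕ r)) P.refl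

  -- An element of least degree in a set closed under remainders divides every member, up to a constant.
  module _ (I : List C → Set)
           (closed : ∀ {c f q w r} → I f → I w → const c P.* f P.≈ q P.* w P.+ r → I r) where

    Divisor : List C → ℕ → Set
    Divisor g e = ∃[ w ] ∃[ v ] Degree w v × v < e × I w ×
      (∃[ c ] ∃[ q ] (¬ c ≈ 0#) × (const c P.* g P.≈ q P.* w))

    descend : ∀ {g e} → Degree g e → I g → ∀ n w v → v < n → Degree w v → v < e → I w → Divisor g e
    descend {g} {e} G g∈I (suc n) w v v<1+n W v<e w∈I =
      let (c , q , r , c≉0 , eq , r≺v) = pseudoDivide W (suc e) g (bound G) in
      step c q r c≉0 eq r≺v (degree? r)
      where
      step : ∀ c q r → ¬ c ≈ 0# → const c P.* g P.≈ q P.* w P.+ r → r ≺ v →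
             r P.≈ P.0# ⊎ (∃[ d ] Degree r d) → Divisor g e
      step c q r c≉0 eq r≺v (inj₁ r≈0) = w , v , W , v<e , w∈I , c , q , c≉0 ,
        P.trans eq (P.trans (P.+-congˡ r≈0) (P.+-identityʳ _))
      step c q r c≉0 eq r≺v (inj₂ (v′ , R)) =
        descend G g∈I n r v′ (ℕₚ.≤-trans v′<v (ℕ.s≤s⁻¹ v<1+n)) R (ℕₚ.<-trans v′<v v<e)
          (closed {c} {g} {q} {w} {r} g∈I w∈I eq)
        where v′<v = degree-< R r≺v

  eval : List C → C → C
  eval f x = Evaluation.ev D (idHom commutativeRing) x f

  linear : C → List C
  linear x = - x ∷ 1# ∷ []

  eval-linear : ∀ x y → eval (linear x) y ≈ y + - x
  eval-linear x y = trans (+-comm _ _) (+-congʳ (trans (*-congˡ (trans (+-congˡ (zeroʳ y)) (+-identityʳ 1#))) (*-identityʳ y)))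

  -- Synthetic division by the linear polynomial with root x: the values at x of the successive
  -- tails of f, as in Horner's scheme, are the coefficients of the quotient.
  quotient : List C → C → List C
  quotient []      x = []
  quotient (c ∷ f) x = eval f x ∷ quotient f x

  quotient-≺ : ∀ f x {N} → f ≺ suc N → quotient f x ≺ N
  quotient-≺ []      x b = 0≺ _ P.refl
  quotient-≺ (c ∷ f) x {suc N} b = ≺-∷ (quotient-≺ f x (≺-tail b))
  quotient-≺ (c ∷ f) x {zero}  b = 0≺ 0 (P.trans (∷-cong (Evaluation.ev-0 D (idHom commutativeRing) x f f≈0)
      (≺-0 (quotient-≺ f x (≺-mono z≤n (≺-tail b))))) 0∷[])
    where f≈0 = ≺-0 (≺-tail b)

  linear-* : ∀ x g → linear x P.* g P.≈ scale (- x) g P.+ (0# ∷ g)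
  linear-* x g = P.trans (mul-x∷ (- x) P.1# g) (add-cong P.refl (∷-cong refl (P.*-identityˡ g)))

  factor : ∀ f x → f P.≈ const (eval f x) P.+ linear x P.* quotient f x
  factor []      x = P.sym (P.trans (P.+-cong 0∷[] (P.zeroʳ (linear x))) (P.+-identityˡ _))
  factor (c ∷ f) x = pointwise λ i → trans (go i) (sym (trans (coeff-add (const (eval (c ∷ f) x)) _ i) (+-congˡ (rhs i))))
    where
    q = quotient f x
    rhs : ∀ i → coeff (linear x P.* (eval f x ∷ q)) i ≈ - x * coeff (eval f x ∷ q) i + coeff (0# ∷ eval f x ∷ q) i
    rhs i = trans (at (linear-* x (eval f x ∷ q)) i) (trans (coeff-add (scale (- x) (eval f x ∷ q)) _ i) (+-congʳ (coeff-scale (- x) (eval f x ∷ q) i)))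
    go : ∀ i → coeff (c ∷ f) i ≈ coeff (const (c + x * eval f x)) i + (- x * coeff (eval f x ∷ q) i + coeff (0# ∷ eval f x ∷ q) i)
    go zero = sym (trans (+-assoc _ _ _) (trans (+-congˡ (trans (+-congˡ (+-identityʳ _))
      (trans (sym (distribʳ _ _ _)) (trans (*-congʳ (-‿inverseʳ x)) (zeroˡ _))))) (+-identityʳ c)))
    go (suc i) = trans (at (factor f x) i) (trans (coeff-add (const (eval f x)) _ i)
      (trans (+-congˡ (trans (at (linear-* x q) i) (trans (coeff-add (scale (- x) q) _ i) (+-congʳ (coeff-scale (- x) q i)))))
        (trans (trans (sym (+-assoc _ _ _)) (trans (+-congʳ (+-comm _ _)) (+-assoc _ _ _)))
          (trans (+-congˡ (shuffle i)) (sym (+-identityˡ _))))))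
      where
      shuffle : ∀ i → coeff (const (eval f x)) i + coeff (0# ∷ q) i ≈ coeff (eval f x ∷ q) i
      shuffle zero    = +-identityʳ _
      shuffle (suc i) = +-identityˡ _

  factor-root : ∀ f x → eval f x ≈ 0# → f P.≈ linear x P.* quotient f x
  factor-root f x z = P.trans (factor f x) (P.trans (P.+-congʳ (P.trans (∷-cong z P.refl) 0∷[])) (P.+-identityˡ _))

  x-y≉0 : ∀ {x y} → ¬ x ≈ y → ¬ y + - x ≈ 0#
  x-y≉0 {x} {y} x≉y p = x≉y (sym (trans (sym (+-identityʳ y)) (trans (+-congˡ (sym (-‿inverseˡ x)))
    (trans (sym (+-assoc _ _ _)) (trans (+-congʳ p) (+-identityˡ x))))))

  cancelˡ : ∀ {x y} → ¬ x ≈ 0# → x * y ≈ 0# → y ≈ 0#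
  cancelˡ {x} {y} x≉0 p with zero? y
  ... | yes y≈0 = y≈0
  ... | no  y≉0 = ⊥-elim (nonzero-* x≉0 y≉0 p)

  roots-bound : ∀ xs {f} → AllPairs (λ x y → ¬ x ≈ y) xs → All (λ x → eval f x ≈ 0#) xs →
                f ≺ length xs → f P.≈ P.0#
  roots-bound []       _          _        b = ≺-0 b
  roots-bound (x ∷ xs) {f} (d ∷ ds) (z ∷ zs) b = P.trans (factor-root f x z)
    (P.trans (P.*-congˡ (roots-bound xs ds (go d zs) (quotient-≺ f x b))) (P.zeroʳ (linear x)))
    where
    g = quotient f x
    root : ∀ {y} → ¬ x ≈ y → eval f y ≈ 0# → eval g y ≈ 0#
    root {y} x≉y q = cancelˡ (x-y≉0 x≉y) (trans (*-congʳ (sym (eval-linear x y)))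
      (trans (sym (Evaluation.ev-* D (idHom commutativeRing) y (linear x) g))
        (trans (Evaluation.ev-cong D (idHom commutativeRing) y (P.sym (factor-root f x z))) q)))
    go : ∀ {ys} → All (λ y → ¬ x ≈ y) ys → All (λ y → eval f y ≈ 0#) ys → All (λ y → eval g y ≈ 0#) ys
    go []       []       = []
    go (d ∷ ds) (z ∷ zs) = root d z ∷ go ds zs

-- Gauss's lemma

module GaussLemma (R : Domain) where
  S = Poly R
  B = Poly S
  module S = Domain S
  module B = Domain B
  module R = Domain R
  open Degrees R
  module DB = Degrees S
  open Polynomial S using (coeff; scale; at; pointwise; mul-∷; coeff-add; coeff-scale; ∷-cong)
  open import Algebra.Properties.Ring S.ring using (-‿distribʳ-*)
  private
    module SS = SemiringSolver S.commutativeSemiring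
    module BS = SemiringSolver B.commutativeSemiring

  ι : S.Carrier → B.Carrier
  ι = DB.const

  degree-1 : Degree S.1# 0
  degree-1 = degree-const R.1≉0

  infix 4 _∣_
  -- Divisibility in the polynomial ring over the fraction field of R: u has degree 0, so it is a
  -- nonzero element of R that clears denominators.
  _∣_ : S.Carrier → S.Carrier → Set
  c ∣ y = ∃[ u ] ∃[ z ] Degree u 0 × u S.* y S.≈ c S.* z

  ∣-resp : ∀ {c x y} → x S.≈ y → c ∣ x → c ∣ y
  ∣-resp p (u , z , U , eq) = u , z , U , S.trans (S.*-congˡ (S.sym p)) eq

  ∣-0 : ∀ {c} → c ∣ S.0#
  ∣-0 {c} = S.1# , S.0# , degree-1 , S.trans (S.zeroʳ S.1#) (S.sym (S.zeroʳ c))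

  ∣-refl* : ∀ c q → c ∣ c S.* q
  ∣-refl* c q = S.1# , q , degree-1 , S.*-identityˡ _

  ∣-*ˡ : ∀ {c y} q → c ∣ y → c ∣ q S.* y
  ∣-*ˡ {c} {y} q (u , z , U , eq) = u , q S.* z , U , (begin
    u S.* (q S.* y) ≈⟨ solve 3 (λ u q y → (u ⊗ (q ⊗ y)) ⊜ (q ⊗ (u ⊗ y))) S.refl u q y ⟩
    q S.* (u S.* y) ≈⟨ S.*-congˡ eq ⟩
    q S.* (c S.* z) ≈⟨ solve 3 (λ c q z → (q ⊗ (c ⊗ z)) ⊜ (c ⊗ (q ⊗ z))) S.refl c q z ⟩
    c S.* (q S.* z) ∎)
    where
    open SetoidReasoning S.setoid
    open SS using (solve) renaming (_:+_ to _⊕_; _:*_ to _⊗_; _:=_ to _⊜_)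

  ∣-unit : ∀ {c y u} → Degree u 0 → c ∣ u S.* y → c ∣ y
  ∣-unit {c} {y} {u} U (v , z , V , eq) = v S.* u , z , degree-* V U , S.trans (S.*-assoc v u y) eq

  ∣-cancel : ∀ {c x y} → c ∣ x → c ∣ x S.+ y → c ∣ y
  ∣-cancel {c} {x} {y} (u , z , U , p) (v , w , V , q) =
    u S.* v , u S.* w S.+ S.- (v S.* z) , degree-* U V , (begin
    (u S.* v) S.* y ≈⟨ S.+-identityʳ _ ⟨
    (u S.* v) S.* y S.+ S.0# ≈⟨ S.+-congˡ (S.-‿inverseʳ (v S.* (u S.* x))) ⟨
    (u S.* v) S.* y S.+ (v S.* (u S.* x) S.+ S.- (v S.* (u S.* x))) ≈⟨ S.+-assoc _ _ _ ⟨
    ((u S.* v) S.* y S.+ v S.* (u S.* x)) S.+ S.- (v S.* (u S.* x)) ≈⟨ S.+-congʳ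
      (solve 4 (λ u v x y → ((u ⊗ v) ⊗ y ⊕ v ⊗ (u ⊗ x)) ⊜ (u ⊗ (v ⊗ (x ⊕ y)))) S.refl u v x y) ⟩
    u S.* (v S.* (x S.+ y)) S.+ S.- (v S.* (u S.* x)) ≈⟨ S.+-cong (S.*-congˡ q) (S.-‿cong (S.*-congˡ p)) ⟩
    u S.* (c S.* w) S.+ S.- (v S.* (c S.* z)) ≈⟨ S.+-cong (comm u c w) (S.-‿cong (comm v c z)) ⟩
    c S.* (u S.* w) S.+ S.- (c S.* (v S.* z)) ≈⟨ S.+-congˡ (-‿distribʳ-* c (v S.* z)) ⟩
    c S.* (u S.* w) S.+ c S.* (S.- (v S.* z)) ≈⟨ S.distribˡ _ _ _ ⟨
    c S.* (u S.* w S.+ S.- (v S.* z)) ∎)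
    where
    open SetoidReasoning S.setoid
    open SS using (solve) renaming (_:+_ to _⊕_; _:*_ to _⊗_; _:=_ to _⊜_)
    comm : ∀ a b c → a S.* (b S.* c) S.≈ b S.* (a S.* c)
    comm = solve 3 (λ a b c → (a ⊗ (b ⊗ c)) ⊜ (b ⊗ (a ⊗ c))) S.refl

  -- The alternative to c behaving like a prime. Irreducibility is never tested; a factor of c shows
  -- up only as the obstruction met in the Euclidean argument.
  record ProperFactors (c : S.Carrier) (δ : ℕ) : Set where
    constructor properFactors
    field
      {u g h} : S.Carrier
      {m n}   : ℕ
      unit    : Degree u 0
      product : u S.* c S.≈ g S.* h
      deg-g   : Degree g m
      deg-h   : Degree h n
      m<δ     : m < δ
      n<δ     : n < δ

  data DivisionOutcome (c : S.Carrier) (δ : ℕ) (y : S.Carrier) : Set where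
    divides   : c ∣ y → DivisionOutcome c δ y
    remainder : ∀ {u q r d} → ¬ u R.≈ R.0# → const u S.* y S.≈ q S.* c S.+ r → Degree r d → d < δ →
                DivisionOutcome c δ y

  divide : ∀ {c δ} → Degree c δ → ∀ y → DivisionOutcome c δ y
  divide {c} C y with pseudoDivide C (length y) y (≺-length y)
  ... | u , q , r , u≉0 , eq , r≺δ with degree? r
  ... | inj₁ r≈0      = divides (const u , q , degree-const u≉0 ,
          S.trans eq (S.trans (S.+-congˡ r≈0) (S.trans (S.+-identityʳ _) (S.*-comm q c))))
  ... | inj₂ (d , rd) = remainder u≉0 eq rd (degree-< rd r≺δ)

  private
    Annihilates : S.Carrier → S.Carrier → S.Carrier → Set
    Annihilates c z w = c ∣ w S.* z

    annihilates-closed : ∀ c z {u f q w r} → Annihilates c z f → Annihilates c z w →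
      const u S.* f S.≈ q S.* w S.+ r → Annihilates c z r
    annihilates-closed c z {u} {f} {q} {w} {r} f∈ w∈ eq = ∣-cancel (∣-*ˡ q w∈) (∣-resp eq′ (∣-*ˡ (const u) f∈))
      where
      eq′ : const u S.* (f S.* z) S.≈ q S.* (w S.* z) S.+ r S.* z
      eq′ = S.trans (S.sym (S.*-assoc _ _ _)) (S.trans (S.*-congʳ eq)
        (S.trans (S.distribʳ _ _ _) (S.+-congʳ (S.*-assoc _ _ _))))

  -- The elements w with c ∣ w z contain c and a nonzero remainder of smaller degree; one of least degree
  -- divides c, and it is a constant only if c ∣ z.
  euclid : ∀ {c δ y z u q r d} → Degree c δ → ¬ u R.≈ R.0# → const u S.* y S.≈ q S.* c S.+ r →
           Degree r d → d < δ → c ∣ y S.* z → c ∣ z ⊎ ProperFactors c δ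
  euclid {c} {δ} {y} {z} {u} {q} {r} {d} C u≉0 eq rd d<δ c∣yz =
    conclude (descend (Annihilates c z) (λ {u} {f} {q} {w} {r} → annihilates-closed c z {u} {f} {q} {w} {r})
               C (∣-refl* c z) (suc d) r d ℕₚ.≤-refl rd d<δ
               (annihilates-closed c z {u} {y} {q} {c} {r} c∣yz (∣-refl* c z) eq))
    where
    conclude : Divisor (Annihilates c z) (λ {u} {f} {q} {w} {r} → annihilates-closed c z {u} {f} {q} {w} {r}) c δ →
               c ∣ z ⊎ ProperFactors c δ
    conclude (w , zero  , W , w<δ , w∈ , _) = inj₁ (∣-unit W w∈)
    conclude (w , suc v , W , w<δ , w∈ , u , q , u≉0 , eq) with degree? q
    ... | inj₁ q≈0 = ⊥-elim (degree-≉0 (degree-const* u≉0 C) (S.trans eq (S.trans (S.*-congʳ q≈0) (S.zeroˡ w))))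
    ... | inj₂ (n , Q) = inj₂ (properFactors (degree-const u≉0) eq Q W n<δ w<δ)
      where
      δ≡ : δ ≡ n ℕ.+ suc v
      δ≡ = degree-unique (degree-const* u≉0 C) (degree-cong (S.sym eq) (degree-* Q W))
      n<δ : n < δ
      n<δ = ≡.subst (suc n ≤_) (≡.trans (≡.sym (ℕₚ.+-suc n v)) (≡.sym δ≡)) (s≤s (ℕₚ.m≤m+n n v))

  _∣ᵇ_ : S.Carrier → B.Carrier → Set
  c ∣ᵇ Y = ∀ i → c ∣ coeff Y i

  ∣ᵇ-∷ : ∀ {c y Y} → c ∣ y → c ∣ᵇ Y → c ∣ᵇ (y ∷ Y)
  ∣ᵇ-∷ p q zero    = p
  ∣ᵇ-∷ p q (suc i) = q i

  ∣ᵇ-tailˡ : ∀ {c} y Y Z → c ∣ y → c ∣ᵇ ((y ∷ Y) B.* Z) → c ∣ᵇ (Y B.* Z)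
  ∣ᵇ-tailˡ y Y Z c∣y h i = ∣-cancel
    (∣-resp (S.*-comm (coeff Z (suc i)) y) (∣-*ˡ (coeff Z (suc i)) c∣y))
    (∣-resp (DB.coeff-x∷* y Y Z (suc i)) (h (suc i)))

  ∣ᵇ-tailʳ : ∀ {c} y Y z Z → c ∣ z → c ∣ᵇ ((y ∷ Y) B.* (z ∷ Z)) → c ∣ᵇ ((y ∷ Y) B.* Z)
  ∣ᵇ-tailʳ y Y z Z c∣z h i = ∣-cancel
    (∣-resp (S.*-comm (coeff Y i) z) (∣-*ˡ (coeff Y i) c∣z))
    (∣-resp (S.trans (at (mul-∷ (y ∷ Y) z Z) (suc i))
      (S.trans (coeff-add (scale z (y ∷ Y)) _ (suc i)) (S.+-congʳ (coeff-scale z (y ∷ Y) (suc i))))) (h (suc i)))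

  module _ {c δ} (C : Degree c δ) where

    -- The lowest coefficient y leaves a nonzero remainder modulo c. As the lowest coefficient of
    -- the product is y z, the coefficients z of Z turn out divisible by c one after another,
    -- starting from the bottom.
    splitFactor₁ : ∀ {y u q r d} → ¬ u R.≈ R.0# → const u S.* y S.≈ q S.* c S.+ r → Degree r d → d < δ →
      ∀ Y Z → c ∣ᵇ ((y ∷ Y) B.* Z) → c ∣ᵇ Z ⊎ ProperFactors c δ
    splitFactor₁ u≉0 eq rd d<δ Y []      h = inj₁ λ _ → ∣-0
    splitFactor₁ {y} {u} {q} {r} {d} u≉0 eq rd d<δ Y (z ∷ Z) h =
      step (euclid {c} {δ} {y} {z} {u} {q} {r} {d} C u≉0 eq rd d<δ
        (∣-resp (S.trans (Polynomial.coeff₀-mul S y Y z Z) (S.*-comm z y)) (h 0)))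
      where
      step : c ∣ z ⊎ ProperFactors c δ → c ∣ᵇ (z ∷ Z) ⊎ ProperFactors c δ
      step (inj₂ pf)  = inj₂ pf
      step (inj₁ c∣z) = map₁ (∣ᵇ-∷ c∣z)
        (splitFactor₁ {y} {u} {q} {r} {d} u≉0 eq rd d<δ Y Z (∣ᵇ-tailʳ y Y z Z c∣z h))

    splitFactor : ∀ Y Z → c ∣ᵇ (Y B.* Z) → (c ∣ᵇ Y ⊎ c ∣ᵇ Z) ⊎ ProperFactors c δ
    splitFactor []      Z h = inj₁ (inj₁ λ _ → ∣-0)
    splitFactor (y ∷ Y) Z h = step (divide C y)
      where
      step : DivisionOutcome c δ y → (c ∣ᵇ (y ∷ Y) ⊎ c ∣ᵇ Z) ⊎ ProperFactors c δ
      step (remainder {u} {q} {r} {d} u≉0 eq rd d<δ) =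
        map₁ inj₂ (splitFactor₁ {y} {u} {q} {r} {d} u≉0 eq rd d<δ Y Z h)
      step (divides c∣y) =
        map₁ (map₁ (∣ᵇ-∷ c∣y)) (splitFactor Y Z (∣ᵇ-tailˡ y Y Z c∣y h))

  -- Each coefficient comes with its own denominator u; their product is a common one.
  ∣ᵇ⇒multiple : ∀ {c} Y → c ∣ᵇ Y → ∃[ u ] ∃[ Y′ ] Degree u 0 × ι u B.* Y B.≈ ι c B.* Y′
  ∣ᵇ⇒multiple {c} [] h = S.1# , B.0# , degree-1 , B.trans (B.zeroʳ (ι S.1#)) (B.sym (B.zeroʳ (ι c)))
  ∣ᵇ⇒multiple {c} (y ∷ Y) h with h 0 | ∣ᵇ⇒multiple Y (λ i → h (suc i))
  ... | u , z , U , p | v , Y′ , V , q = u S.* v , v S.* z ∷ ι u B.* Y′ , degree-* U V , pointwise go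
    where
    open SetoidReasoning S.setoid
    open SS using (solve) renaming (_:+_ to _⊕_; _:*_ to _⊗_; _:=_ to _⊜_)
    go : ∀ i → coeff (ι (u S.* v) B.* (y ∷ Y)) i S.≈ coeff (ι c B.* (v S.* z ∷ ι u B.* Y′)) i
    go zero = begin
      coeff (ι (u S.* v) B.* (y ∷ Y)) 0 ≈⟨ DB.coeff-const* (u S.* v) (y ∷ Y) 0 ⟩
      (u S.* v) S.* y ≈⟨ solve 3 (λ u v y → ((u ⊗ v) ⊗ y) ⊜ (v ⊗ (u ⊗ y))) S.refl u v y ⟩
      v S.* (u S.* y) ≈⟨ S.*-congˡ p ⟩
      v S.* (c S.* z) ≈⟨ solve 3 (λ c v z → (v ⊗ (c ⊗ z)) ⊜ (c ⊗ (v ⊗ z))) S.refl c v z ⟩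
      c S.* (v S.* z) ≈⟨ DB.coeff-const* c (v S.* z ∷ ι u B.* Y′) 0 ⟨
      coeff (ι c B.* (v S.* z ∷ ι u B.* Y′)) 0 ∎
    go (suc i) = begin
      coeff (ι (u S.* v) B.* (y ∷ Y)) (suc i) ≈⟨ DB.coeff-const* (u S.* v) (y ∷ Y) (suc i) ⟩
      (u S.* v) S.* coeff Y i ≈⟨ S.*-assoc _ _ _ ⟩
      u S.* (v S.* coeff Y i) ≈⟨ S.*-congˡ (DB.coeff-const* v Y i) ⟨
      u S.* coeff (ι v B.* Y) i ≈⟨ S.*-congˡ (at q i) ⟩
      u S.* coeff (ι c B.* Y′) i ≈⟨ S.*-congˡ (DB.coeff-const* c Y′ i) ⟩
      u S.* (c S.* coeff Y′ i) ≈⟨ solve 3 (λ u c y → (u ⊗ (c ⊗ y)) ⊜ (c ⊗ (u ⊗ y))) S.refl u c (coeff Y′ i) ⟩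
      c S.* (u S.* coeff Y′ i) ≈⟨ S.*-congˡ (DB.coeff-const* u Y′ i) ⟨
      c S.* coeff (ι u B.* Y′) i ≈⟨ DB.coeff-const* c (v S.* z ∷ ι u B.* Y′) (suc i) ⟨
      coeff (ι c B.* (v S.* z ∷ ι u B.* Y′)) (suc i) ∎

  -- Meant for X = Y Z / c₀ with a denominator c₀: Y′ and Z′ are Y and Z with the factors c and d
  -- taken out, and their product is X up to a nonzero element of R.
  record Refactored (X Y Z : B.Carrier) : Set where
    field
      {u v w c d} : S.Carrier
      {Y′ Z′}     : B.Carrier
      unit-u      : Degree u 0
      unit-v      : Degree v 0
      unit-w      : Degree w 0
      product     : ι u B.* X B.≈ Y′ B.* Z′
      left        : ι v B.* Y B.≈ ι c B.* Y′
      right       : ι w B.* Z B.≈ ι d B.* Z′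

  private
    swap : ∀ {X Y Z} → Refactored X Z Y → Refactored X Y Z
    swap r = record { unit-u = unit-u ; unit-v = unit-w ; unit-w = unit-v
                    ; product = B.trans product (B.*-comm _ _) ; left = right ; right = left }
      where open Refactored r

    refactor-left : ∀ {c δ X Y Z} → Degree c δ → c ∣ᵇ Y → ι c B.* X B.≈ Y B.* Z → Refactored X Y Z
    refactor-left {c} {X = X} {Y} {Z} C c∣Y eq with ∣ᵇ⇒multiple Y c∣Y
    ... | u , Y′ , U , p = record { unit-u = U ; unit-v = U ; unit-w = degree-1
        ; product = B.trans (B.sym (B.+-identityʳ _)) (B.trans (B.+-congˡ (B.sym (B.-‿inverseˡ (Y′ B.* Z))))
            (B.trans (B.sym (B.+-assoc _ _ _)) (B.trans (B.+-congʳ diff≈0) (B.+-identityˡ _))))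
        ; left = p ; right = B.refl {ι S.1# B.* Z} }
      where
      open SetoidReasoning B.setoid
      open BS using (solve) renaming (_:+_ to _⊕_; _:*_ to _⊗_; _:=_ to _⊜_)
      open import Algebra.Properties.Ring B.ring renaming (-‿distribʳ-* to -distribʳ)
      -- The equation u X = Y′ Z holds after multiplication by c, and c cancels in a domain.
      diff = ι u B.* X B.+ B.- (Y′ B.* Z)
      c-diff : ι c B.* diff B.≈ B.0#
      c-diff = begin
        ι c B.* diff ≈⟨ B.distribˡ _ _ _ ⟩
        ι c B.* (ι u B.* X) B.+ ι c B.* (B.- (Y′ B.* Z)) ≈⟨ B.+-cong
          (solve 3 (λ c u x → (c ⊗ (u ⊗ x)) ⊜ (u ⊗ (c ⊗ x))) B.refl (ι c) (ι u) X)
          (B.sym (-distribʳ (ι c) (Y′ B.* Z))) ⟩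
        ι u B.* (ι c B.* X) B.+ B.- (ι c B.* (Y′ B.* Z)) ≈⟨ B.+-cong (B.*-congˡ eq) (B.-‿cong (B.sym (B.*-assoc _ _ _))) ⟩
        ι u B.* (Y B.* Z) B.+ B.- ((ι c B.* Y′) B.* Z) ≈⟨ B.+-cong (B.sym (B.*-assoc _ _ _)) (B.-‿cong (B.*-congʳ (B.sym p))) ⟩
        (ι u B.* Y) B.* Z B.+ B.- ((ι u B.* Y) B.* Z) ≈⟨ B.-‿inverseʳ _ ⟩
        B.0# ∎
      ιc≉0 : ¬ ι c B.≈ B.0#
      ιc≉0 z = degree-≉0 C (at z 0)
      diff≈0 : diff B.≈ B.0#
      diff≈0 = Degrees.cancelˡ B ιc≉0 c-diff

  -- Gauss's lemma with denominators cleared.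
  gauss : ∀ n {c δ X Y Z} → δ < n → Degree c δ → ι c B.* X B.≈ Y B.* Z → Refactored X Y Z
  gauss (suc n) {c} {zero} {X} {Y} {Z} δ<n C eq =
    record { unit-u = C ; unit-v = degree-1 ; unit-w = degree-1 ; product = eq ; left = B.refl {ι S.1# B.* Y} ; right = B.refl {ι S.1# B.* Z} }
  gauss (suc n) {c} {δ@(suc _)} {X} {Y} {Z} (s≤s δ≤n) C eq
    with splitFactor C Y Z (λ i → ∣-resp (S.trans (S.sym (DB.coeff-const* c X i)) (at eq i)) (∣-refl* c (coeff X i)))
  ... | inj₁ (inj₁ c∣Y) = refactor-left {c} {δ} {X} {Y} {Z} C c∣Y eq
  ... | inj₁ (inj₂ c∣Z) = swap (refactor-left {c} {δ} {X} {Z} {Y} C c∣Z (B.trans eq (B.*-comm Y Z)))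
  -- Up to a unit c = g h. First g is removed, from the equation g (h X) = (u Y) Z, and then h from
  -- what this leaves; both have smaller degree than c.
  ... | inj₂ pf = record
    { unit-u = degree-* r₂.unit-u r₁.unit-u
    ; unit-v = degree-* (degree-* r₂.unit-v r₁.unit-v) pf.unit
    ; unit-w = degree-* r₂.unit-w r₁.unit-w
    ; product = B.trans (B.*-congʳ (DB.const-* r₂.u r₁.u)) (B.trans (B.*-assoc (ι r₂.u) (ι r₁.u) X) r₂.product)
    ; left = begin
        ι ((r₂.v S.* r₁.v) S.* pf.u) B.* Y ≈⟨ B.*-congʳ (B.trans (DB.const-* _ _) (B.*-congʳ (DB.const-* _ _))) ⟩
        ((ι r₂.v B.* ι r₁.v) B.* ι pf.u) B.* Y ≈⟨ solve 4 (λ a b c y → (((a ⊗ b) ⊗ c) ⊗ y) ⊜ (a ⊗ (b ⊗ (c ⊗ y)))) B.refl (ι r₂.v) (ι r₁.v) (ι pf.u) Y ⟩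
        ι r₂.v B.* (ι r₁.v B.* (ι pf.u B.* Y)) ≈⟨ B.*-congˡ r₁.left ⟩
        ι r₂.v B.* (ι r₁.c B.* r₁.Y′) ≈⟨ chain (ι r₂.v) (ι r₁.c) r₁.Y′ ⟩
        ι r₁.c B.* (ι r₂.v B.* r₁.Y′) ≈⟨ B.*-congˡ r₂.left ⟩
        ι r₁.c B.* (ι r₂.c B.* r₂.Y′) ≈⟨ B.*-assoc _ _ _ ⟨
        (ι r₁.c B.* ι r₂.c) B.* r₂.Y′ ≈⟨ B.*-congʳ (DB.const-* _ _) ⟨
        ι (r₁.c S.* r₂.c) B.* r₂.Y′ ∎
    ; right = begin
        ι (r₂.w S.* r₁.w) B.* Z ≈⟨ B.*-congʳ (DB.const-* _ _) ⟩
        (ι r₂.w B.* ι r₁.w) B.* Z ≈⟨ B.*-assoc _ _ _ ⟩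
        ι r₂.w B.* (ι r₁.w B.* Z) ≈⟨ B.*-congˡ r₁.right ⟩
        ι r₂.w B.* (ι r₁.d B.* r₁.Z′) ≈⟨ chain (ι r₂.w) (ι r₁.d) r₁.Z′ ⟩
        ι r₁.d B.* (ι r₂.w B.* r₁.Z′) ≈⟨ B.*-congˡ r₂.right ⟩
        ι r₁.d B.* (ι r₂.d B.* r₂.Z′) ≈⟨ B.*-assoc _ _ _ ⟨
        (ι r₁.d B.* ι r₂.d) B.* r₂.Z′ ≈⟨ B.*-congʳ (DB.const-* _ _) ⟨
        ι (r₁.d S.* r₂.d) B.* r₂.Z′ ∎
    }
    where
    open SetoidReasoning B.setoid
    open BS using (solve) renaming (_:+_ to _⊕_; _:*_ to _⊗_; _:=_ to _⊜_)
    module pf = ProperFactors pf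
    chain : ∀ a b c → a B.* (b B.* c) B.≈ b B.* (a B.* c)
    chain = solve 3 (λ a b c → (a ⊗ (b ⊗ c)) ⊜ (b ⊗ (a ⊗ c))) B.refl
    first : ι pf.g B.* (ι pf.h B.* X) B.≈ (ι pf.u B.* Y) B.* Z
    first = begin
      ι pf.g B.* (ι pf.h B.* X) ≈⟨ B.*-assoc _ _ _ ⟨
      (ι pf.g B.* ι pf.h) B.* X ≈⟨ B.*-congʳ (DB.const-* _ _) ⟨
      ι (pf.g S.* pf.h) B.* X ≈⟨ B.*-congʳ (∷-cong (S.sym pf.product) B.refl) ⟩
      ι (pf.u S.* c) B.* X ≈⟨ B.*-congʳ (DB.const-* _ _) ⟩
      (ι pf.u B.* ι c) B.* X ≈⟨ B.*-assoc _ _ _ ⟩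
      ι pf.u B.* (ι c B.* X) ≈⟨ B.*-congˡ eq ⟩
      ι pf.u B.* (Y B.* Z) ≈⟨ B.*-assoc _ _ _ ⟨
      (ι pf.u B.* Y) B.* Z ∎
    module r₁ = Refactored (gauss n {pf.g} {pf.m} {ι pf.h B.* X} {ι pf.u B.* Y} {Z} (ℕₚ.≤-trans pf.m<δ δ≤n) pf.deg-g first)
    module r₂ = Refactored (gauss n {pf.h} {pf.n} {ι r₁.u B.* X} {r₁.Y′} {r₁.Z′} (ℕₚ.≤-trans pf.n<δ δ≤n) pf.deg-h
      (B.trans (chain (ι pf.h) (ι r₁.u) X) r₁.product))

-- Linear systems

module LinearAlgebra (D : Domain) where
  open Domain D renaming (Carrier to C)
  open SemiringSolver commutativeSemiring using (solve) renaming (_:+_ to _⊕_; _:*_ to _⊗_; _:=_ to _⊜_)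
  open SetoidReasoning setoid
  open import Algebra.Properties.Ring ring using (-‿distribˡ-*)

  Zero : ∀ {N} → Vec C N → Set
  Zero = VAll.All (_≈ 0#)

  infix 4 _≋_
  _≋_ : ∀ {N} → Vec C N → Vec C N → Set
  _≋_ = Pointwise _≈_

  infixl 6 _⊞_
  _⊞_ : ∀ {N} → Vec C N → Vec C N → Vec C N
  _⊞_ = Vec.zipWith _+_

  infixr 7 _⊡_
  _⊡_ : ∀ {N} → C → Vec C N → Vec C N
  c ⊡ u = Vec.map (c *_) u

  dot : ∀ {N} → Vec C N → Vec C N → C
  dot []      []      = 0#
  dot (r ∷ R) (x ∷ u) = r * x + dot R u

  dot-scaleʳ : ∀ {N} c (R u : Vec C N) → dot R (c ⊡ u) ≈ c * dot R u
  dot-scaleʳ c []      []      = sym (zeroʳ c)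
  dot-scaleʳ c (r ∷ R) (x ∷ u) = trans (+-congˡ (dot-scaleʳ c R u))
    (solve 4 (λ c r x d → (r ⊗ (c ⊗ x) ⊕ c ⊗ d) ⊜ (c ⊗ (r ⊗ x ⊕ d))) refl c r x (dot R u))

  dot-combine : ∀ {N} c (R : Vec C N) d R′ u → dot (c ⊡ R ⊞ d ⊡ R′) u ≈ c * dot R u + d * dot R′ u
  dot-combine c []      d []        []      = sym (trans (+-cong (zeroʳ c) (zeroʳ d)) (+-identityˡ 0#))
  dot-combine c (r ∷ R) d (r′ ∷ R′) (x ∷ u) = trans (+-congˡ (dot-combine c R d R′ u))
    (solve 7 (λ c r d r′ x s t → ((c ⊗ r ⊕ d ⊗ r′) ⊗ x ⊕ (c ⊗ s ⊕ d ⊗ t)) ⊜ (c ⊗ (r ⊗ x ⊕ s) ⊕ d ⊗ (r′ ⊗ x ⊕ t)))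
      refl c r d r′ x (dot R u) (dot R′ u))

  dot-zeroʳ : ∀ {N} (R : Vec C N) → dot R (Vec.replicate N 0#) ≈ 0#
  dot-zeroʳ []      = refl
  dot-zeroʳ (r ∷ R) = trans (+-cong (zeroʳ r) (dot-zeroʳ R)) (+-identityˡ 0#)

  Solution : ∀ {N} → List (Vec C N) → Set
  Solution {N} rows = ∃[ u ] (¬ Zero {N} u) × All (λ R → dot R u ≈ 0#) rows

  -- The pivot row is taken out of the list; the last component restores a property proved for it
  -- and the other rows to the original list.
  findPivot : ∀ {N} (rows : List (Vec C (suc N))) →
    All (λ R → Vec.head R ≈ 0#) rows ⊎
    (∃[ R ] ∃[ others ] (¬ Vec.head R ≈ 0#) × length rows ≡ suc (length others) ×
      (∀ {P : Vec C (suc N) → Set} → P R → All P others → All P rows))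
  findPivot [] = inj₁ []
  findPivot (R ∷ rows) = step (zero? (Vec.head R)) (findPivot rows)
    where
    step : Dec (Vec.head R ≈ 0#) → _ ⊎ _ → _ ⊎ _
    step (no r≉0)  _          = inj₂ (R , rows , r≉0 , ≡.refl , _∷_)
    step (yes r≈0) (inj₁ all) = inj₁ (r≈0 ∷ all)
    step (yes r≈0) (inj₂ (R′ , others , r≉0 , len , back)) =
      inj₂ (R′ , R ∷ others , r≉0 , ≡.cong suc len , λ { p (q ∷ qs) → q ∷ back p qs })

  -- Gaussian elimination without division: every other row is multiplied by the pivot entry before
  -- a multiple of the pivot row is subtracted, which leaves one equation and one unknown fewer.
  kernel : ∀ N (rows : List (Vec C N)) → length rows < N → Solution rows
  kernel (suc N) rows len = step (findPivot rows)
    where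
    step : _ ⊎ _ → Solution rows
    step (inj₁ zeros) = 1# ∷ Vec.replicate N 0# , (λ { (z VAll.∷ _) → 1≉0 z }) , All.map (λ {R} → unit {R}) zeros
      where
      unit : ∀ {R} → Vec.head R ≈ 0# → dot R (1# ∷ Vec.replicate N 0#) ≈ 0#
      unit {r ∷ R} r≈0 = trans (+-cong (trans (*-identityʳ r) r≈0) (dot-zeroʳ R)) (+-identityˡ 0#)
    step (inj₂ (c ∷ pivot , others , c≉0 , eq , back)) =
      let (u , u≉0 , sol) = kernel N (List.map eliminate others)
            (≡.subst (_< N) (≡.sym (length-map eliminate others)) (ℕ.s≤s⁻¹ (≡.subst (_< suc N) eq len)))
      -- Scaling the solution u of the reduced system by the pivot entry c solves the pivot equation
      -- for the first unknown without dividing by c.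
      in - dot pivot u ∷ c ⊡ u , nonzero u u≉0 , back (pivotEq u) (All.map (λ {R} → otherEq u {R}) (Allₚ.map⁻ sol))
      where
      eliminate : Vec C (suc N) → Vec C N
      eliminate (r ∷ R) = c ⊡ R ⊞ (- r) ⊡ pivot
      nonzero : ∀ u → ¬ Zero u → ¬ Zero (- dot pivot u ∷ c ⊡ u)
      nonzero u u≉0 (_ VAll.∷ zs) = u≉0 (go u zs)
        where
        go : ∀ {M} (u : Vec C M) → Zero (c ⊡ u) → Zero u
        go []      VAll.[]        = VAll.[]
        go (x ∷ u) (z VAll.∷ zs) = Degrees.cancelˡ D c≉0 z VAll.∷ go u zs
      pivotEq : ∀ u → dot (c ∷ pivot) (- dot pivot u ∷ c ⊡ u) ≈ 0#
      pivotEq u = begin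
        c * - dot pivot u + dot pivot (c ⊡ u) ≈⟨ +-congˡ (dot-scaleʳ c pivot u) ⟩
        c * - dot pivot u + c * dot pivot u ≈⟨ distribˡ _ _ _ ⟨
        c * (- dot pivot u + dot pivot u) ≈⟨ *-congˡ (-‿inverseˡ _) ⟩
        c * 0# ≈⟨ zeroʳ c ⟩
        0# ∎
      otherEq : ∀ u {R} → dot (eliminate R) u ≈ 0# → dot R (- dot pivot u ∷ c ⊡ u) ≈ 0#
      otherEq u {r ∷ R} z = begin
        r * - dot pivot u + dot R (c ⊡ u) ≈⟨ +-congˡ (dot-scaleʳ c R u) ⟩
        r * - dot pivot u + c * dot R u ≈⟨ +-congʳ (trans (sym (-‿distribʳ-* r _)) (-‿distribˡ-* r _)) ⟩
        - r * dot pivot u + c * dot R u ≈⟨ +-comm _ _ ⟩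
        c * dot R u + - r * dot pivot u ≈⟨ dot-combine c R (- r) pivot u ⟨
        dot (eliminate (r ∷ R)) u ≈⟨ z ⟩
        0# ∎
        where open import Algebra.Properties.Ring ring using (-‿distribʳ-*)

  -- An algebra over the scalars: a ring with a map from the scalars, of which only compatibility with
  -- the operations involved is ever needed.
  record Algebra : Set₁ where
    constructor algebra
    field
      ring′ : CommutativeRing 0ℓ 0ℓ
      ι     : C → CommutativeRing.Carrier ring′
    open CommutativeRing ring′ public renaming (Carrier to M; _≈_ to _≈ᴹ_; _+_ to _+ᴹ_; _*_ to _*ᴹ_; 0# to 0ᴹ)

  scalars : Algebra
  scalars = algebra commutativeRing (λ c → c)

  record Linear {N} (A : Algebra) (f : Vec C N → Algebra.M A) : Set where
    open Algebra A using (ι; _≈ᴹ_; _+ᴹ_; _*ᴹ_)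
    field
      cong′       : ∀ {u v} → u ≋ v → f u ≈ᴹ f v
      additive    : ∀ u v → f (u ⊞ v) ≈ᴹ f u +ᴹ f v
      homogeneous : ∀ c u → f (c ⊡ u) ≈ᴹ ι c *ᴹ f u

  record LinearMap (A B : Algebra) (g : Algebra.M A → Algebra.M B) : Set where
    private
      module A = Algebra A
      module B = Algebra B
    field
      cong′       : ∀ {x y} → x A.≈ᴹ y → g x B.≈ᴹ g y
      additive    : ∀ x y → g (x A.+ᴹ y) B.≈ᴹ g x B.+ᴹ g y
      homogeneous : ∀ c x → g (A.ι c A.*ᴹ x) B.≈ᴹ B.ι c B.*ᴹ g x

  infixr 9 _∘ˡ_ _∘ᵐ_
  _∘ˡ_ : ∀ {N A B f g} → LinearMap A B g → Linear {N} A f → Linear B (λ u → g (f u))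
  _∘ˡ_ {B = B} G F = record
    { cong′ = λ p → G.cong′ (F.cong′ p)
    ; additive = λ u v → B.trans (G.cong′ (F.additive u v)) (G.additive _ _)
    ; homogeneous = λ c u → B.trans (G.cong′ (F.homogeneous c u)) (G.homogeneous c _) }
    where
    module B = Algebra B
    module F = Linear F
    module G = LinearMap G

  _∘ᵐ_ : ∀ {A B B′ f g} → LinearMap B B′ g → LinearMap A B f → LinearMap A B′ (λ x → g (f x))
  _∘ᵐ_ {B′ = B′} G F = record
    { cong′ = λ p → G.cong′ (F.cong′ p)
    ; additive = λ u v → B′.trans (G.cong′ (F.additive u v)) (G.additive _ _)
    ; homogeneous = λ c u → B′.trans (G.cong′ (F.homogeneous c u)) (G.homogeneous c _) }
    where
    module B′ = Algebra B′
    module F = LinearMap F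
    module G = LinearMap G

  _+ˡ_ : ∀ {N A f g} → Linear {N} A f → Linear A g → Linear A (λ u → Algebra._+ᴹ_ A (f u) (g u))
  _+ˡ_ {A = A} {f} {g} F G = record
    { cong′ = λ p → A.+-cong (F.cong′ p) (G.cong′ p)
    ; additive = λ u v → A.trans (A.+-cong (F.additive u v) (G.additive u v))
        (S.solve 4 (λ a b c d → ((a S.:+ b) S.:+ (c S.:+ d)) S.:= ((a S.:+ c) S.:+ (b S.:+ d))) A.refl _ _ _ _)
    ; homogeneous = λ c u → A.trans (A.+-cong (F.homogeneous c u) (G.homogeneous c u)) (A.sym (A.distribˡ _ _ _)) }
    where
    module A = Algebra A
    module F = Linear F
    module G = Linear G
    module S = SemiringSolver A.commutativeSemiring

  mulBy : ∀ A y → LinearMap A A (λ x → Algebra._*ᴹ_ A x y)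
  mulBy A y = record
    { cong′ = λ p → A.*-congʳ p
    ; additive = λ x z → A.distribʳ y x z
    ; homogeneous = λ c x → A.*-assoc _ x y }
    where module A = Algebra A

  polyAlgebra : (M : Domain) (ι : C → Domain.Carrier M) → Algebra
  polyAlgebra M ι = algebra (Domain.commutativeRing (Poly M)) (λ c → Degrees.const M (ι c))

  coeffMap : ∀ M ι i → LinearMap (polyAlgebra M ι) (algebra (Domain.commutativeRing M) ι) (λ f → Polynomial.coeff M f i)
  coeffMap M ι i = record
    { cong′ = λ p → Polynomial.at p i
    ; additive = λ f g → Polynomial.coeff-add M f g i
    ; homogeneous = λ c f → Degrees.coeff-const* M (ι c) f i }

  take-≋ : ∀ m {n} {u v : Vec C (m ℕ.+ n)} → u ≋ v → take m u ≋ take m v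
  take-≋ zero    p       = []
  take-≋ (suc m) (p ∷ q) = p ∷ take-≋ m q

  drop-≋ : ∀ m {n} {u v : Vec C (m ℕ.+ n)} → u ≋ v → drop m u ≋ drop m v
  drop-≋ zero    p       = p
  drop-≋ (suc m) (p ∷ q) = drop-≋ m q

  Zero-++ : ∀ m {n} (u : Vec C (m ℕ.+ n)) → Zero (take m u) → Zero (drop m u) → Zero u
  Zero-++ zero    u       _               q = q
  Zero-++ (suc m) (x ∷ u) (p VAll.∷ ps) q = p VAll.∷ Zero-++ m u ps q

  takeˡ : ∀ m {n A f} → Linear A f → Linear {m ℕ.+ n} A (λ u → f (take m u))
  takeˡ m {A = A} {f} F = record
    { cong′ = λ p → F.cong′ (take-≋ m p)
    ; additive = λ u v → A.trans (A.reflexive (≡.cong f (Vecₚ.take-zipWith _+_ u v))) (F.additive _ _)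
    ; homogeneous = λ c u → A.trans (A.reflexive (≡.cong f (Vecₚ.take-map (c *_) m u))) (F.homogeneous c _) }
    where
    module A = Algebra A
    module F = Linear F

  dropˡ : ∀ m {n A f} → Linear A f → Linear {m ℕ.+ n} A (λ u → f (drop m u))
  dropˡ m {A = A} {f} F = record
    { cong′ = λ p → F.cong′ (drop-≋ m p)
    ; additive = λ u v → A.trans (A.reflexive (≡.cong f (Vecₚ.drop-zipWith _+_ u v))) (F.additive _ _)
    ; homogeneous = λ c u → A.trans (A.reflexive (≡.cong f (Vecₚ.drop-map (c *_) m u))) (F.homogeneous c _) }
    where
    module A = Algebra A
    module F = Linear F

  record Parametrization (A : Algebra) (N : ℕ) : Set where
    open Algebra A using (M; _≈ᴹ_; 0ᴹ)
    field
      param     : Vec C N → M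
      linear    : Linear A param
      injective : ∀ u → param u ≈ᴹ 0ᴹ → Zero u

  scalarParam : Parametrization scalars 1
  scalarParam = record
    { param = Vec.head
    ; linear = record
      { cong′ = λ { (p ∷ _) → p }
      ; additive = λ { (_ ∷ _) (_ ∷ _) → refl }
      ; homogeneous = λ { c (_ ∷ _) → refl } }
    ; injective = λ { (x ∷ []) z → z VAll.∷ VAll.[] } }

  module _ (M : Domain) {ι : C → Domain.Carrier M} {n}
           (B : Parametrization (algebra (Domain.commutativeRing M) ι) n) where
    private
      module M = Domain M
      module B = Parametrization B
      module L = Linear B.linear
      module MP = Polynomial M
      module MD = Degrees M

    -- The coordinates of the d coefficients are concatenated, so nested uses describe polynomials
    -- in several variables with bounded degrees by plain vectors of scalars.
    polyParam : ∀ d → Vec C (d ℕ.* n) → List M.Carrier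
    polyParam zero    u = []
    polyParam (suc d) u = B.param (take n u) ∷ polyParam d (drop n u)

    private
      add-∷ : ∀ {x y z f g h} → x M.≈ y M.+ z → f MP.≈ₚ MP.add g h → x ∷ f MP.≈ₚ MP.add (y ∷ g) (z ∷ h)
      add-∷ {f = f} {g} {h} p q = MP.pointwise λ
        { zero    → M.trans p (M.sym (MP.coeff-add (_ ∷ g) (_ ∷ h) 0))
        ; (suc i) → M.trans (MP.at q i) (M.trans (MP.coeff-add g h i) (M.sym (MP.coeff-add (_ ∷ g) (_ ∷ h) (suc i)))) }

      const*-∷ : ∀ {c x y f g} → x M.≈ c M.* y → f MP.≈ₚ MP.mul (MD.const c) g → x ∷ f MP.≈ₚ MP.mul (MD.const c) (y ∷ g)
      const*-∷ {c} {f = f} {g} p q = MP.pointwise λ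
        { zero    → M.trans p (M.sym (MD.coeff-const* c (_ ∷ g) 0))
        ; (suc i) → M.trans (MP.at q i) (M.trans (MD.coeff-const* c g i) (M.sym (MD.coeff-const* c (_ ∷ g) (suc i)))) }

      module PM = Domain (Poly M)

    polyLinear : ∀ d → Linear (polyAlgebra M ι) (polyParam d)
    polyLinear zero = record
      { cong′ = λ _ → PM.refl
      ; additive = λ _ _ → PM.sym (PM.+-identityˡ _)
      ; homogeneous = λ c _ → PM.sym (PM.zeroʳ (MD.const (ι c))) }
    polyLinear (suc d) = record
      { cong′ = λ p → MP.∷-cong (L.cong′ (take-≋ n p)) (R.cong′ (drop-≋ n p))
      ; additive = λ u v → add-∷ (T.additive u v) (S.additive u v)
      ; homogeneous = λ c u → const*-∷ (T.homogeneous c u) (S.homogeneous c u) }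
      where
      module R = Linear (polyLinear d)
      module T = Linear (takeˡ n {d ℕ.* n} B.linear)
      module S = Linear (dropˡ n {d ℕ.* n} (polyLinear d))

    polyInjective : ∀ d u → polyParam d u MP.≈ₚ [] → Zero u
    polyInjective zero    []  _ = VAll.[]
    polyInjective (suc d) u p = Zero-++ n u (B.injective _ (MP.at p 0))
      (polyInjective d (drop n u) (MP.pointwise λ i → MP.at p (suc i)))

    polyParametrization : ∀ d → Parametrization (polyAlgebra M ι) (d ℕ.* n)
    polyParametrization d = record { param = polyParam d ; linear = polyLinear d ; injective = polyInjective d }

    polyParam-≺ : ∀ d u → MD._≺_ (polyParam d u) d
    polyParam-≺ zero    u = MD.0≺ 0 PM.refl
    polyParam-≺ (suc d) u = MD.≺-∷ (polyParam-≺ d (drop n u))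

    polyParam-coeff : ∀ {P : M.Carrier → Set} → P M.0# → (∀ u → P (B.param u)) → ∀ d u i → P (MP.coeff (polyParam d u) i)
    polyParam-coeff p0 pb zero    u i       = p0
    polyParam-coeff p0 pb (suc d) u zero    = pb (take n u)
    polyParam-coeff {P} p0 pb (suc d) u (suc i) = polyParam-coeff {P} p0 pb d (drop n u) i

  -- Evaluating a linear functional at the unit vectors exhibits it as a row.
  row : ∀ {N} (f : Vec C N → C) → Linear scalars f → ∃[ R ] ∀ u → f u ≈ dot R u
  row {zero}  f F = [] , λ { [] → trans (cong′ []) (trans (homogeneous 0# []) (zeroˡ _)) }
    where open Linear F
  row {suc N} f F = f e₀ ∷ proj₁ rest , λ { (x ∷ u) → begin
      f (x ∷ u) ≈⟨ cong′ (trans (sym (*-identityʳ x)) (sym (+-identityʳ _)) ∷ split x u) ⟩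
      f (x ⊡ e₀ ⊞ (0# ∷ u)) ≈⟨ additive _ _ ⟩
      f (x ⊡ e₀) + f (0# ∷ u) ≈⟨ +-cong (trans (homogeneous x e₀) (*-comm x _)) (proj₂ rest u) ⟩
      f e₀ * x + dot (proj₁ rest) u ∎ }
    where
    open Linear F
    e₀ : Vec C (suc N)
    e₀ = 1# ∷ Vec.replicate N 0#
    split : ∀ {N} x (u : Vec C N) → u ≋ x ⊡ Vec.replicate N 0# ⊞ u
    split x []      = []
    split x (y ∷ u) = sym (trans (+-congʳ (zeroʳ x)) (+-identityˡ y)) ∷ split x u
    ≋-refl : ∀ {N} (u : Vec C N) → u ≋ u
    ≋-refl []      = []
    ≋-refl (x ∷ u) = refl ∷ ≋-refl u
    rest = row (λ u → f (0# ∷ u)) (record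
      { cong′ = λ p → cong′ (refl ∷ p)
      ; additive = λ u v → trans (cong′ (sym (+-identityˡ 0#) ∷ ≋-refl (u ⊞ v))) (additive (0# ∷ u) (0# ∷ v))
      ; homogeneous = λ c u → trans (cong′ (sym (zeroʳ c) ∷ ≋-refl (c ⊡ u))) (homogeneous c (0# ∷ u)) })

  solveSystem : ∀ {N} (K : Set) (fs : K → Vec C N → C) → (∀ k → Linear scalars (fs k)) →
    ∀ (ks : List K) → length ks < N → ∃[ u ] (¬ Zero {N} u) × All (λ k → fs k u ≈ 0#) ks
  solveSystem {N} K fs F ks len =
    let (u , u≉0 , sol) = kernel N (List.map R ks) (≡.subst (_< N) (≡.sym (length-map R ks)) len)
    in u , u≉0 , All.map (λ {k} z → trans (proj₂ (row (fs k) (F k)) u) z) (Allₚ.map⁻ sol)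
    where
    R : K → Vec C N
    R k = proj₁ (row (fs k) (F k))

-- Derivations

neg-homo : ∀ {R S} (φ : Hom R S) x →
  CommutativeRing._≈_ S (Hom.⟦ φ ⟧ (CommutativeRing.-_ R x)) (CommutativeRing.-_ S (Hom.⟦ φ ⟧ x))
neg-homo {R} {S} φ x = inverseˡ-unique _ _ (trans (sym (φ.+-homo _ _)) (trans (φ.cong (CommutativeRing.-‿inverseˡ R x)) φ.0-homo))
  where
  open CommutativeRing S
  open import Algebra.Properties.Group +-group using (inverseˡ-unique)
  module φ = Hom φ

record Derivation (R : Domain) : Set where
  open Domain R
  field
    ∂      : Carrier → Carrier
    ∂-cong : ∀ {x y} → x ≈ y → ∂ x ≈ ∂ y
    ∂-+    : ∀ x y → ∂ (x + y) ≈ ∂ x + ∂ y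
    ∂-*    : ∀ x y → ∂ (x * y) ≈ ∂ x * y + x * ∂ y

  ∂-0 : ∂ 0# ≈ 0#
  ∂-0 = identityˡ-unique _ _ (trans (sym (∂-+ 0# 0#)) (∂-cong (+-identityˡ 0#)))
    where open import Algebra.Properties.Group +-group using (identityˡ-unique)

module FormalDerivative (R : Domain) where
  open Domain R renaming (Carrier to C)
  open Polynomial R
  open Degrees R
  open import Algebra.Properties.Monoid.Mult +-monoid public using () renaming (_×_ to _⋆_; ×-congʳ to ⋆-cong)

  der : List C → List C
  der []      = []
  der (x ∷ f) = f P.+ (0# ∷ der f)

  ⋆-zero : ∀ n → n ⋆ 0# ≈ 0#
  ⋆-zero zero    = refl
  ⋆-zero (suc n) = trans (+-identityˡ _) (⋆-zero n)

  ⋆-+ : ∀ n x y → n ⋆ (x + y) ≈ n ⋆ x + n ⋆ y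
  ⋆-+ zero    x y = sym (+-identityˡ 0#)
  ⋆-+ (suc n) x y = trans (+-congˡ (⋆-+ n x y))
    (solve 4 (λ x y a b → ((x ⊕ y) ⊕ (a ⊕ b)) ⊜ ((x ⊕ a) ⊕ (y ⊕ b))) refl x y (n ⋆ x) (n ⋆ y))
    where open SemiringSolver commutativeSemiring using (solve) renaming (_:+_ to _⊕_; _:=_ to _⊜_)

  ⋆-* : ∀ n c x → n ⋆ (c * x) ≈ c * (n ⋆ x)
  ⋆-* zero    c x = sym (zeroʳ c)
  ⋆-* (suc n) c x = trans (+-congˡ (⋆-* n c x)) (sym (distribˡ c x (n ⋆ x)))

  coeff-der : ∀ f j → coeff (der f) j ≈ suc j ⋆ coeff f (suc j)
  coeff-der []      j       = sym (⋆-zero (suc j))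
  coeff-der (x ∷ f) zero    = coeff-add f (0# ∷ der f) 0
  coeff-der (x ∷ f) (suc j) = trans (coeff-add f (0# ∷ der f) (suc j)) (+-congˡ (coeff-der f j))

  der-cong : ∀ {f g} → f P.≈ g → der f P.≈ der g
  der-cong {f} {g} p = pointwise λ j →
    trans (coeff-der f j) (trans (⋆-cong (suc j) (at p (suc j))) (sym (coeff-der g j)))

  der-+ : ∀ f g → der (f P.+ g) P.≈ der f P.+ der g
  der-+ f g = pointwise λ j → trans (coeff-der (f P.+ g) j) (trans (⋆-cong (suc j) (coeff-add f g (suc j)))
    (trans (⋆-+ (suc j) _ _) (trans (+-cong (sym (coeff-der f j)) (sym (coeff-der g j))) (sym (coeff-add (der f) (der g) j)))))

  der-const* : ∀ c f → der (const c P.* f) P.≈ const c P.* der f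
  der-const* c f = pointwise λ j → trans (coeff-der (const c P.* f) j) (trans (⋆-cong (suc j) (coeff-const* c f (suc j)))
    (trans (⋆-* (suc j) c _) (trans (*-congˡ (sym (coeff-der f j))) (sym (coeff-const* c (der f) j)))))

  der-const : ∀ c → der (const c) P.≈ P.0#
  der-const c = P.trans (P.+-identityˡ _) 0∷[]

  ≺-der : ∀ {f N} → f ≺ suc N → der f ≺ N
  ≺-der {f} b = below λ i N≤i → trans (coeff-der f i) (trans (⋆-cong (suc i) (vanish b (suc i) (s≤s N≤i))) (⋆-zero (suc i)))

  private
    X* : ∀ f g → (0# ∷ f) P.* g P.≈ 0# ∷ f P.* g
    X* = mul-0∷

    X+ : ∀ f g → 0# ∷ f P.+ g P.≈ (0# ∷ f) P.+ (0# ∷ g)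
    X+ = 0∷-add

    split : ∀ x f → x ∷ f P.≈ const x P.+ (0# ∷ f)
    split x f = P.trans (∷-split x f) (P.+-congˡ (∷-cong refl (P.*-identityˡ f)))

  der-* : ∀ f g → der (f P.* g) P.≈ der f P.* g P.+ f P.* der g
  der-* []      g = P.trans (der-cong (P.zeroˡ g)) (P.sym (P.trans (P.+-cong (P.zeroˡ g) (P.zeroˡ (der g))) (P.+-identityˡ _)))
  der-* (x ∷ f) g = begin
    der ((x ∷ f) P.* g) ≈⟨ der-cong (P.trans (P.*-congʳ (split x f)) (P.trans (P.distribʳ _ _ _) (P.+-congˡ (X* f g)))) ⟩
    der (const x P.* g P.+ (0# ∷ f P.* g)) ≈⟨ der-+ (const x P.* g) _ ⟩
    der (const x P.* g) P.+ (f P.* g P.+ (0# ∷ der (f P.* g))) ≈⟨ P.+-cong (der-const* x g) (P.+-congˡ (P.trans (∷-cong refl (der-* f g)) (X+ (der f P.* g) (f P.* der g)))) ⟩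
    const x P.* der g P.+ (f P.* g P.+ ((0# ∷ der f P.* g) P.+ (0# ∷ f P.* der g)))
      ≈⟨ P.+-congˡ (P.+-congˡ (P.+-cong (P.sym (X* (der f) g)) (P.sym (X* f (der g))))) ⟩
    const x P.* der g P.+ (f P.* g P.+ ((0# ∷ der f) P.* g P.+ (0# ∷ f) P.* der g))
      ≈⟨ solve 6 (λ x h f g d c → (x ⊗ h ⊕ (f ⊗ g ⊕ (d ⊗ g ⊕ c ⊗ h))) ⊜ ((f ⊕ d) ⊗ g ⊕ (x ⊕ c) ⊗ h)) P.refl (const x) (der g) f g (0# ∷ der f) (0# ∷ f) ⟩
    (f P.+ (0# ∷ der f)) P.* g P.+ (const x P.+ (0# ∷ f)) P.* der g ≈⟨ P.+-congˡ (P.*-congʳ (P.sym (split x f))) ⟩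
    der (x ∷ f) P.* g P.+ (x ∷ f) P.* der g ∎
    where
    open SetoidReasoning P.setoid
    open SemiringSolver P.commutativeSemiring using (solve) renaming (_:+_ to _⊕_; _:*_ to _⊗_; _:=_ to _⊜_)

  derivation : Derivation (Poly R)
  derivation = record { ∂ = der ; ∂-cong = der-cong ; ∂-+ = der-+ ; ∂-* = der-* }

-- Stated as cancellation of the multiples below p, which passes coefficientwise from 𝔽ₚ to 𝔽ₚ[s]
-- and is the form in which it is used.
CharacteristicAtLeast : ℕ → Domain → Set
CharacteristicAtLeast p R = ∀ j x → suc j < p → suc j ⋆ x ≈ 0# → x ≈ 0#
  where
  open Domain R
  open FormalDerivative R using (_⋆_)

-- The derivation D = ∂ₛ − a ∂ₜ of R[t][a], where ∂ₛ acts on coefficients: differentiation along a line t = b − s a.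
module Flow (R : Domain) (d : Derivation R) where
  open Derivation d
  module R = Domain R
  S = Poly R
  B = Poly S
  module S = Domain S
  module B = Domain B
  module PR = Polynomial R
  module PS = Polynomial S
  open FormalDerivative R

  ∂ₛ : S.Carrier → S.Carrier
  ∂ₛ = List.map ∂

  coeff-∂ₛ : ∀ w j → PR.coeff (∂ₛ w) j R.≈ ∂ (PR.coeff w j)
  coeff-∂ₛ []      j       = R.sym ∂-0
  coeff-∂ₛ (x ∷ w) zero    = R.refl
  coeff-∂ₛ (x ∷ w) (suc j) = coeff-∂ₛ w j

  ∂ₛ-cong : ∀ {w z} → w S.≈ z → ∂ₛ w S.≈ ∂ₛ z
  ∂ₛ-cong {w} {z} p = PR.pointwise λ j →
    R.trans (coeff-∂ₛ w j) (R.trans (∂-cong (PR.at p j)) (R.sym (coeff-∂ₛ z j)))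

  ∂ₛ-+ : ∀ w z → ∂ₛ (w S.+ z) S.≈ ∂ₛ w S.+ ∂ₛ z
  ∂ₛ-+ w z = PR.pointwise λ j → R.trans (coeff-∂ₛ (w S.+ z) j) (R.trans (∂-cong (PR.coeff-add w z j))
    (R.trans (∂-+ _ _) (R.trans (R.+-cong (R.sym (coeff-∂ₛ w j)) (R.sym (coeff-∂ₛ z j))) (R.sym (PR.coeff-add (∂ₛ w) (∂ₛ z) j)))))

  D : B.Carrier → B.Carrier
  D G = List.map ∂ₛ G B.+ (S.0# ∷ List.map (λ w → S.- der w) G)

  coeff-map-∂ₛ : ∀ G i → PS.coeff (List.map ∂ₛ G) i S.≈ ∂ₛ (PS.coeff G i)
  coeff-map-∂ₛ []      i       = S.refl
  coeff-map-∂ₛ (w ∷ G) zero    = S.refl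
  coeff-map-∂ₛ (w ∷ G) (suc i) = coeff-map-∂ₛ G i

  coeff-map-der : ∀ G i → PS.coeff (List.map (λ w → S.- der w) G) i S.≈ S.- der (PS.coeff G i)
  coeff-map-der []      i       = S.sym -0#≈0#
    where open import Algebra.Properties.Ring S.ring using (-0#≈0#)
  coeff-map-der (w ∷ G) zero    = S.refl
  coeff-map-der (w ∷ G) (suc i) = coeff-map-der G i

  coeff-D₀ : ∀ G → PS.coeff (D G) 0 S.≈ ∂ₛ (PS.coeff G 0)
  coeff-D₀ G = S.trans (PS.coeff-add (List.map ∂ₛ G) _ 0) (S.trans (S.+-identityʳ _) (coeff-map-∂ₛ G 0))

  coeff-D : ∀ G i → PS.coeff (D G) (suc i) S.≈ ∂ₛ (PS.coeff G (suc i)) S.+ S.- der (PS.coeff G i)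
  coeff-D G i = S.trans (PS.coeff-add (List.map ∂ₛ G) _ (suc i)) (S.+-cong (coeff-map-∂ₛ G (suc i)) (coeff-map-der G i))

  D-cong : ∀ {G H} → G B.≈ H → D G B.≈ D H
  D-cong {G} {H} p = PS.pointwise λ
    { zero    → S.trans (coeff-D₀ G) (S.trans (∂ₛ-cong (PS.at p 0)) (S.sym (coeff-D₀ H)))
    ; (suc i) → S.trans (coeff-D G i) (S.trans (S.+-cong (∂ₛ-cong (PS.at p (suc i))) (S.-‿cong (der-cong (PS.at p i)))) (S.sym (coeff-D H i))) }

  private
    neg-+ : ∀ x y → S.- (x S.+ y) S.≈ S.- x S.+ S.- y
    neg-+ x y = S.sym (-‿+-comm x y)
      where open import Algebra.Properties.Ring S.ring using (-‿+-comm)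

    interchange : ∀ a b c d → (a S.+ b) S.+ (c S.+ d) S.≈ (a S.+ c) S.+ (b S.+ d)
    interchange = solve 4 (λ a b c d → ((a ⊕ b) ⊕ (c ⊕ d)) ⊜ ((a ⊕ c) ⊕ (b ⊕ d))) S.refl
      where open SemiringSolver S.commutativeSemiring using (solve) renaming (_:+_ to _⊕_; _:=_ to _⊜_)

  D-+ : ∀ G H → D (G B.+ H) B.≈ D G B.+ D H
  D-+ G H = PS.pointwise λ
    { zero → S.trans (coeff-D₀ (G B.+ H)) (S.trans (∂ₛ-cong (PS.coeff-add G H 0)) (S.trans (∂ₛ-+ _ _)
        (S.trans (S.+-cong (S.sym (coeff-D₀ G)) (S.sym (coeff-D₀ H))) (S.sym (PS.coeff-add (D G) (D H) 0)))))
    ; (suc i) → S.trans (coeff-D (G B.+ H) i) (S.trans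
        (S.+-cong (S.trans (∂ₛ-cong (PS.coeff-add G H (suc i))) (∂ₛ-+ _ _))
                  (S.trans (S.-‿cong (S.trans (der-cong (PS.coeff-add G H i)) (der-+ _ _))) (neg-+ _ _)))
        (S.trans (interchange _ _ _ _) (S.trans (S.+-cong (S.sym (coeff-D G i)) (S.sym (coeff-D H i)))
          (S.sym (PS.coeff-add (D G) (D H) (suc i)))))) }

  module _ {c} (∂c≈0 : ∂ c R.≈ R.0#) where
    private
      κ  = Degrees.const R c
      κᴮ = Degrees.const S κ

    ∂ₛ-const* : ∀ w → ∂ₛ (κ S.* w) S.≈ κ S.* ∂ₛ w
    ∂ₛ-const* w = PR.pointwise λ j → R.trans (coeff-∂ₛ (κ S.* w) j) (R.trans (∂-cong (Degrees.coeff-const* R c w j))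
      (R.trans (∂-* c _) (R.trans (R.+-congʳ (R.trans (R.*-congʳ ∂c≈0) (R.zeroˡ _))) (R.trans (R.+-identityˡ _)
        (R.trans (R.*-congˡ (R.sym (coeff-∂ₛ w j))) (R.sym (Degrees.coeff-const* R c (∂ₛ w) j)))))))

    -- Elements of 𝔽ₚ are constants of the derivation of 𝔽ₚ[s], so vanishing of iterated derivatives
    -- under D is a linear condition over 𝔽ₚ.
    D-const* : ∀ G → D (κᴮ B.* G) B.≈ κᴮ B.* D G
    D-const* G = PS.pointwise λ
      { zero → S.trans (coeff-D₀ (κᴮ B.* G)) (S.trans (∂ₛ-cong (Degrees.coeff-const* S κ G 0)) (S.trans (∂ₛ-const* _)
          (S.trans (S.*-congˡ (S.sym (coeff-D₀ G))) (S.sym (Degrees.coeff-const* S κ (D G) 0)))))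
      ; (suc i) → S.trans (coeff-D (κᴮ B.* G) i) (S.trans
          (S.+-cong (S.trans (∂ₛ-cong (Degrees.coeff-const* S κ G (suc i))) (∂ₛ-const* _))
            (S.trans (S.-‿cong (S.trans (der-cong (Degrees.coeff-const* S κ G i)) (der-const* c _))) (-‿distribʳ-* κ _)))
          (S.trans (S.sym (S.distribˡ κ _ _)) (S.trans (S.*-congˡ (S.sym (coeff-D G i))) (S.sym (Degrees.coeff-const* S κ (D G) (suc i)))))) }
      where open import Algebra.Properties.Ring S.ring using (-‿distribʳ-*)

  module AlongLine {α τ : R.Carrier} (∂α : ∂ α R.≈ R.0#) (∂τ : ∂ τ R.≈ R.- α) where
    module ET = Evaluation R (idHom R.commutativeRing) τ
    module EB = Evaluation S ET.evHom α

    private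
      open SetoidReasoning R.setoid
      open SemiringSolver R.commutativeSemiring using (solve) renaming (_:+_ to _⊕_; _:*_ to _⊗_; _:=_ to _⊜_)

      evT : ∀ w → ∂ (ET.ev w) R.≈ ET.ev (∂ₛ w) R.+ R.- α R.* ET.ev (der w)
      evT [] = R.trans ∂-0 (R.sym (R.trans (R.+-identityˡ _) (R.zeroʳ _)))
      evT (c ∷ w) = begin
        ∂ (c R.+ τ R.* ET.ev w) ≈⟨ R.trans (∂-+ _ _) (R.+-congˡ (∂-* _ _)) ⟩
        ∂ c R.+ (∂ τ R.* ET.ev w R.+ τ R.* ∂ (ET.ev w)) ≈⟨ R.+-congˡ (R.+-cong (R.*-congʳ ∂τ) (R.*-congˡ (evT w))) ⟩
        ∂ c R.+ (R.- α R.* ET.ev w R.+ τ R.* (ET.ev (∂ₛ w) R.+ R.- α R.* ET.ev (der w)))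
          ≈⟨ solve 6 (λ c n e t f g → (c ⊕ (n ⊗ e ⊕ t ⊗ (f ⊕ n ⊗ g))) ⊜ ((c ⊕ t ⊗ f) ⊕ n ⊗ (e ⊕ t ⊗ g)))
               R.refl (∂ c) (R.- α) (ET.ev w) τ (ET.ev (∂ₛ w)) (ET.ev (der w)) ⟩
        (∂ c R.+ τ R.* ET.ev (∂ₛ w)) R.+ R.- α R.* (ET.ev w R.+ τ R.* ET.ev (der w))
          ≈⟨ R.+-congˡ (R.*-congˡ (R.sym (R.trans (ET.ev-+ w (R.0# ∷ der w)) (R.+-congˡ (R.+-identityˡ _))))) ⟩
        ET.ev (∂ₛ (c ∷ w)) R.+ R.- α R.* ET.ev (der (c ∷ w)) ∎

      evT′ : ∀ w → ∂ (ET.ev w) R.≈ ET.ev (∂ₛ w) R.+ α R.* ET.ev (S.- der w)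
      evT′ w = R.trans (evT w) (R.+-congˡ (R.trans (R.sym (-‿distribˡ-* α _)) (R.trans (-‿distribʳ-* α _)
        (R.*-congˡ (R.sym (neg-homo ET.evHom (der w)))))))
        where open import Algebra.Properties.Ring R.ring using (-‿distribˡ-*; -‿distribʳ-*)

      evB : ∀ G → ∂ (EB.ev G) R.≈ EB.ev (List.map ∂ₛ G) R.+ α R.* EB.ev (List.map (λ w → S.- der w) G)
      evB [] = R.trans ∂-0 (R.sym (R.trans (R.+-identityˡ _) (R.zeroʳ _)))
      evB (w ∷ G) = begin
        ∂ (ET.ev w R.+ α R.* EB.ev G) ≈⟨ R.trans (∂-+ _ _) (R.+-congˡ (R.trans (∂-* _ _) (R.trans (R.+-congʳ (R.trans (R.*-congʳ ∂α) (R.zeroˡ _))) (R.+-identityˡ _)))) ⟩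
        ∂ (ET.ev w) R.+ α R.* ∂ (EB.ev G) ≈⟨ R.+-cong (evT′ w) (R.*-congˡ (evB G)) ⟩
        (ET.ev (∂ₛ w) R.+ α R.* ET.ev (S.- der w)) R.+ α R.* (EB.ev (List.map ∂ₛ G) R.+ α R.* EB.ev (List.map (λ w → S.- der w) G))
          ≈⟨ solve 5 (λ a e f g h → ((e ⊕ a ⊗ f) ⊕ a ⊗ (g ⊕ a ⊗ h)) ⊜ ((e ⊕ a ⊗ g) ⊕ a ⊗ (f ⊕ a ⊗ h))) R.refl α _ _ _ _ ⟩
        EB.ev (List.map ∂ₛ (w ∷ G)) R.+ α R.* EB.ev (List.map (λ w → S.- der w) (w ∷ G)) ∎

    -- The chain rule: along the line a is fixed and t has derivative -a. Hence a zero of G on the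
    -- line is a zero of D G too, which makes D G usable as the second curve in Bezout's bound.
    ev-D : ∀ G → EB.ev (D G) R.≈ ∂ (EB.ev G)
    ev-D G = R.trans (EB.ev-+ (List.map ∂ₛ G) _) (R.trans (R.+-congˡ (R.+-identityˡ _)) (R.sym (evB G)))

-- Polynomials in R[t][a]: the degree in the inner variable t.
module InnerDegree (R : Domain) where
  S = Poly R
  B = Poly S
  module R = Domain R
  module S = Domain S
  module B = Domain B
  module PR = Polynomial R
  module PS = Polynomial S
  open Degrees R
  module DB = Degrees S

  infix 4 _≺ₜ_
  record _≺ₜ_ (G : B.Carrier) (K : ℕ) : Set where
    constructor belowₜ
    field vanishₜ : ∀ i → PS.coeff G i ≺ K
  open _≺ₜ_ public

  ≺ₜ-cong : ∀ {G H K} → G B.≈ H → G ≺ₜ K → H ≺ₜ K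
  ≺ₜ-cong p b = belowₜ λ i → ≺-cong (PS.at p i) (vanishₜ b i)

  ≺ₜ-mono : ∀ {G K L} → K ≤ L → G ≺ₜ K → G ≺ₜ L
  ≺ₜ-mono K≤L b = belowₜ λ i → ≺-mono K≤L (vanishₜ b i)

  ≺ₜ-0 : ∀ {G} → G ≺ₜ 0 → G B.≈ B.0#
  ≺ₜ-0 b = PS.pointwise λ i → ≺-0 (vanishₜ b i)

  ≺ₜ-+ : ∀ {G H K} → G ≺ₜ K → H ≺ₜ K → G B.+ H ≺ₜ K
  ≺ₜ-+ {G} {H} p q = belowₜ λ i → ≺-cong (S.sym (PS.coeff-add G H i)) (≺-+ (vanishₜ p i) (vanishₜ q i))

  ≺ₜ-neg : ∀ {G K} → G ≺ₜ K → B.- G ≺ₜ K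
  ≺ₜ-neg {G} p = belowₜ λ i → ≺-cong (S.sym (PS.coeff-neg G i)) (≺-neg (vanishₜ p i))

  ≺ₜ-exists : ∀ G → ∃[ K ] G ≺ₜ K
  ≺ₜ-exists []      = 0 , belowₜ λ _ → 0≺ 0 S.refl
  ≺ₜ-exists (w ∷ G) = let (K , b) = ≺ₜ-exists G in
    length w ⊔ K , belowₜ λ
      { zero    → ≺-mono (ℕₚ.m≤m⊔n _ K) (≺-length w)
      ; (suc i) → ≺-mono (ℕₚ.m≤n⊔m (length w) K) (vanishₜ b i) }

  private
    0∷-≺ₜ : ∀ {G K} → G ≺ₜ K → S.0# ∷ G ≺ₜ K
    0∷-≺ₜ b = belowₜ λ { zero → 0≺ _ S.refl ; (suc i) → vanishₜ b i }

    tail-≺ₜ : ∀ {w G K} → w ∷ G ≺ₜ K → G ≺ₜ K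
    tail-≺ₜ b = belowₜ λ i → vanishₜ b (suc i)

  ≺ₜ-* : ∀ {G H m n} → G ≺ₜ suc m → H ≺ₜ suc n → G B.* H ≺ₜ suc (m ℕ.+ n)
  ≺ₜ-* {[]}    {H} p q = ≺ₜ-cong (B.sym (B.zeroˡ H)) (belowₜ λ _ → 0≺ _ S.refl)
  ≺ₜ-* {w ∷ G} {H} p q = belowₜ λ i → ≺-cong (S.sym (DB.coeff-x∷* w G H i))
    (≺-+ (≺-* (vanishₜ p 0) (vanishₜ q i)) (vanishₜ (0∷-≺ₜ (≺ₜ-* (tail-≺ₜ p) q)) i))

  -- The coefficient of t^K as a polynomial in a; its type is that of R[t], but the variable is now
  -- a. Degrees in t are additive because these leading coefficients multiply in the domain R[a].
  top : ℕ → B.Carrier → S.Carrier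
  top K = List.map (λ w → PR.coeff w K)

  coeff-top-inner : ∀ K G i → PR.coeff (top K G) i ≡ PR.coeff (PS.coeff G i) K
  coeff-top-inner K []      i       = ≡.refl
  coeff-top-inner K (w ∷ G) zero    = ≡.refl
  coeff-top-inner K (w ∷ G) (suc i) = coeff-top-inner K G i

  top-* : ∀ {G H m n} → G ≺ₜ suc m → H ≺ₜ suc n → ∀ i →
          PR.coeff (PS.coeff (G B.* H) i) (m ℕ.+ n) R.≈ PR.coeff (top m G S.* top n H) i
  top-* {[]}    {H} {m} {n} p q i =
    R.trans (PR.at (PS.at (B.zeroˡ H) i) (m ℕ.+ n)) (R.sym (PR.at (S.zeroˡ (top n H)) i))
  top-* {w ∷ G} {H} {m} {n} p q i = R.trans (PR.at (DB.coeff-x∷* w G H i) (m ℕ.+ n))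
    (R.trans (PR.coeff-add (w S.* PS.coeff H i) (PS.coeff (S.0# ∷ G B.* H) i) (m ℕ.+ n))
    (R.trans (R.+-cong
      (R.trans (coeff-top m n (vanishₜ p 0) (vanishₜ q i)) (R.*-congˡ (R.reflexive (≡.sym (coeff-top-inner n H i)))))
      (shifted i))
    (R.sym (coeff-x∷* (PR.coeff w m) (top m G) (top n H) i))))
    where
    shifted : ∀ i → PR.coeff (PS.coeff (S.0# ∷ G B.* H) i) (m ℕ.+ n) R.≈ PR.coeff (R.0# ∷ top m G S.* top n H) i
    shifted zero    = R.refl
    shifted (suc i) = top-* (tail-≺ₜ p) q i

  record TDegree (G : B.Carrier) (k : ℕ) : Set where
    constructor tdegree
    field
      top≉0  : ¬ top k G S.≈ S.0#
      boundₜ : G ≺ₜ suc k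
  open TDegree public

  tdegree? : ∀ K {G} → G ≺ₜ K → ¬ G B.≈ B.0# → ∃[ k ] TDegree G k
  tdegree? zero    b G≉0 = ⊥-elim (G≉0 (≺ₜ-0 b))
  tdegree? (suc K) {G} b G≉0 = step (PR.zeroₚ? (top K G))
    where
    step : Dec (top K G S.≈ S.0#) → ∃[ k ] TDegree G k
    step (no  t≉0) = K , tdegree t≉0 b
    step (yes t≈0) = tdegree? K (belowₜ λ i → below (go i)) G≉0
      where
      go : ∀ i j → K ≤ j → PR.coeff (PS.coeff G i) j R.≈ R.0#
      go i j K≤j with ℕₚ.m≤n⇒m<n∨m≡n K≤j
      ... | inj₁ K<j = vanish (vanishₜ b i) j K<j
      ... | inj₂ ≡.refl = R.trans (R.reflexive (≡.sym (coeff-top-inner K G i))) (PR.at t≈0 i)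

  hasTDegree : ∀ {G} → ¬ G B.≈ B.0# → ∃[ k ] TDegree G k
  hasTDegree {G} = tdegree? (proj₁ (≺ₜ-exists G)) (proj₂ (≺ₜ-exists G))

  tdegree-cong : ∀ {G H k} → G B.≈ H → TDegree G k → TDegree H k
  tdegree-cong {G} {H} {k} p t = tdegree
    (λ z → top≉0 t (PR.pointwise λ i → R.trans (R.reflexive (coeff-top-inner k G i)) (R.trans (PR.at (PS.at p i) k)
      (R.trans (R.reflexive (≡.sym (coeff-top-inner k H i))) (PR.at z i)))))
    (≺ₜ-cong p (boundₜ t))

  tdegree-< : ∀ {G k K} → TDegree G k → G ≺ₜ K → k < K
  tdegree-< {G} {k} {K} t b with k ℕₚ.<? K
  ... | yes k<K = k<K
  ... | no  k≮K = ⊥-elim (top≉0 t (PR.pointwise λ i →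
        R.trans (R.reflexive (coeff-top-inner k G i)) (vanish (vanishₜ b i) k (ℕₚ.≮⇒≥ k≮K))))

  tdegree-unique : ∀ {G k l} → TDegree G k → TDegree G l → k ≡ l
  tdegree-unique p q = ℕₚ.≤-antisym (ℕ.s≤s⁻¹ (tdegree-< p (boundₜ q))) (ℕ.s≤s⁻¹ (tdegree-< q (boundₜ p)))

  tdegree-* : ∀ {G H m n} → TDegree G m → TDegree H n → TDegree (G B.* H) (m ℕ.+ n)
  tdegree-* {G} {H} {m} {n} p q = tdegree
    (λ z → S.nonzero-* {top m G} {top n H} (top≉0 p) (top≉0 q) (PR.pointwise λ i →
      R.trans (R.sym (top-* (boundₜ p) (boundₜ q) i))
        (R.trans (R.reflexive (≡.sym (coeff-top-inner (m ℕ.+ n) (G B.* H) i))) (PR.at z i))))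
    (≺ₜ-* (boundₜ p) (boundₜ q))

  tdegree-const : ∀ {c δ} → Degree c δ → TDegree (DB.const c) δ
  tdegree-const C = tdegree (λ z → lead≉0 C (PR.at z 0))
    (belowₜ λ { zero → bound C ; (suc i) → 0≺ _ S.refl })

-- Bezout's bound

module BezoutBound (R : Domain) where
  open InnerDegree R
  open LinearAlgebra R
  private
    module DR = Degrees R
  open import Algebra.Properties.Ring B.ring using (-‿distribʳ-*)

  module _ (points : List (R.Carrier × R.Carrier))
           (distinct : AllPairs (λ P Q → ¬ proj₁ P R.≈ proj₁ Q) points) where

    evT : R.Carrier → S.Carrier → R.Carrier
    evT τ = Evaluation.ev R (idHom R.commutativeRing) τ

    module At (P : R.Carrier × R.Carrier) =
      Evaluation S (Evaluation.evHom R (idHom R.commutativeRing) (proj₁ P)) (proj₂ P)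

    zeros : B.Carrier → List (R.Carrier × R.Carrier)
    zeros G = filter (λ P → R.zero? (At.ev P G)) points

    -- Two polynomials with more common zeros than their bidegrees allow have a nontrivial syzygy.  The unknown
    -- U, V have inner degree below q = length (zeros G), and the equations kill every coefficient of U G - V H but
    -- the lowest q ones, which then vanish because they form a polynomial in t with q roots.
    syzygy : ∀ {G H e k} → DB.Degree G e → G ≺ₜ suc k → H DB.≺ suc (suc e) → H ≺ₜ suc k →
      (∀ {P} → P ∈ points → At.ev P G R.≈ R.0# → At.ev P H R.≈ R.0#) → suc (2 ℕ.* e) ℕ.* k < length (zeros G) →
      ∃[ U ] ∃[ V ] (¬ V B.≈ B.0#) × (V DB.≺ e) × (U B.* G B.≈ V B.* H)
    syzygy {G} {H} {e} {k} degG G≺ H≺e H≺ common many = U , V , V≉0 , V≺e , UG≈VH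
      where
      q = length (zeros G)

      q-pos : 0 < q
      q-pos = ℕₚ.≤-trans (s≤s z≤n) many

      scalarP = scalarParam
      innerP = polyParametrization R scalarP q
      algS = polyAlgebra R (λ c → c)
      ιS = Algebra.ι algS
      algB = polyAlgebra S ιS
      UP = polyParametrization S {ιS} innerP (suc e)
      VP = polyParametrization S {ιS} innerP e
      module UP = Parametrization UP
      module VP = Parametrization VP
      N₁ = suc e ℕ.* (q ℕ.* 1)
      N₂ = e ℕ.* (q ℕ.* 1)

      W′ : Vec R.Carrier (N₁ ℕ.+ N₂) → B.Carrier
      W′ u = UP.param (take N₁ u) B.* G B.+ VP.param (drop N₁ u) B.* (B.- H)

      W-linear : Linear algB W′
      W-linear = _+ˡ_ {A = algB} (mulBy algB G ∘ˡ takeˡ N₁ UP.linear) (mulBy algB (B.- H) ∘ˡ dropˡ N₁ VP.linear)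

      -- A pair (i, j) stands for the coefficient of aⁱ tʲ: for i = 0 only the k exponents j from q
      -- on, for i = 1, ..., 2 e all q + k of them.
      conditions : List (ℕ × ℕ)
      conditions = List.map (λ j → 0 , q ℕ.+ j) (upTo k) ++
                   cartesianProduct (List.map suc (upTo (2 ℕ.* e))) (upTo (q ℕ.+ k))

      functional : ℕ × ℕ → Vec R.Carrier (N₁ ℕ.+ N₂) → R.Carrier
      functional (i , j) u = PR.coeff (PS.coeff (W′ u) i) j

      functional-linear : ∀ c → Linear scalars (functional c)
      functional-linear (i , j) = coeffMap R (λ c → c) j ∘ˡ (coeffMap S ιS i ∘ˡ W-linear)

      -- There are k + 2 e (q + k) equations in (2 e + 1) q unknowns, so a nontrivial solution is
      -- guaranteed precisely when (2 e + 1) k < q.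
      few : length conditions < N₁ ℕ.+ N₂
      few = ℕₚ.≤-trans (s≤s (ℕₚ.≤-reflexive len)) (ℕₚ.≤-trans arith (ℕₚ.≤-reflexive total))
        where
        len : length conditions ≡ k ℕ.+ 2 ℕ.* e ℕ.* (q ℕ.+ k)
        len = ≡.trans (length-++ (List.map (λ j → 0 , q ℕ.+ j) (upTo k))) (≡.cong₂ ℕ._+_
          (≡.trans (length-map _ (upTo k)) (length-upTo k))
          (≡.trans (length-cartesianProduct (List.map suc (upTo (2 ℕ.* e))) (upTo (q ℕ.+ k)))
            (≡.cong₂ ℕ._*_ (≡.trans (length-map suc (upTo (2 ℕ.* e))) (length-upTo (2 ℕ.* e))) (length-upTo (q ℕ.+ k)))))
        open +-*-Solver
        arith : suc (k ℕ.+ 2 ℕ.* e ℕ.* (q ℕ.+ k)) ≤ q ℕ.+ 2 ℕ.* e ℕ.* q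
        arith = ≡.subst (_≤ q ℕ.+ 2 ℕ.* e ℕ.* q)
          (solve 3 (λ e k q → (con 1 :+ (con 1 :+ con 2 :* e) :* k) :+ con 2 :* e :* q :=
                              con 1 :+ (k :+ con 2 :* e :* (q :+ k))) ≡.refl e k q)
          (ℕₚ.+-monoˡ-≤ (2 ℕ.* e ℕ.* q) many)
        total : q ℕ.+ 2 ℕ.* e ℕ.* q ≡ N₁ ℕ.+ N₂
        total = solve 2 (λ e q → q :+ con 2 :* e :* q := (con 1 :+ e) :* (q :* con 1) :+ e :* (q :* con 1)) ≡.refl e q

      solution = solveSystem (ℕ × ℕ) functional functional-linear conditions few
      u = proj₁ solution
      U = UP.param (take N₁ u)
      V = VP.param (drop N₁ u)
      W = W′ u

      vanishing : All (λ c → functional c u R.≈ R.0#) conditions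
      vanishing = proj₂ (proj₂ solution)

      V≺e : V DB.≺ e
      V≺e = polyParam-≺ S innerP e (drop N₁ u)

      inner≺ : ∀ d w → polyParam S {ιS} innerP d w ≺ₜ q
      inner≺ d w = belowₜ (polyParam-coeff S innerP {λ x → x DR.≺ q} (DR.0≺ q S.refl) (polyParam-≺ R scalarP q) d w)

      ≺-pred : ∀ {X} → X ≺ₜ q → X ≺ₜ suc (ℕ.pred q)
      ≺-pred {X} = ≡.subst (X ≺ₜ_) (≡.sym (ℕₚ.suc-pred q {{ℕ.>-nonZero q-pos}}))

      q+k : suc (ℕ.pred q ℕ.+ k) ≡ q ℕ.+ k
      q+k = ≡.cong (ℕ._+ k) (ℕₚ.suc-pred q {{ℕ.>-nonZero q-pos}})

      W≺ₜ : W ≺ₜ q ℕ.+ k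
      W≺ₜ = ≡.subst (W ≺ₜ_) q+k (≺ₜ-+ (≺ₜ-* (≺-pred (inner≺ (suc e) (take N₁ u))) G≺)
                                      (≺ₜ-* (≺-pred (inner≺ e (drop N₁ u))) (≺ₜ-neg H≺)))

      VH≺ : ∀ e {V} → V DB.≺ e → ∀ {H} → H DB.≺ suc (suc e) → V B.* H DB.≺ suc (e ℕ.+ e)
      VH≺ zero    V≺ H≺ = DB.0≺ _ (B.trans (B.*-congʳ (DB.≺-0 V≺)) (B.zeroˡ _))
      VH≺ (suc e) {V} V≺ {H} H≺ = ≡.subst (λ n → V B.* H DB.≺ n) (≡.cong suc (ℕₚ.+-suc e (suc e))) (DB.≺-* V≺ H≺)

      W≺ : W DB.≺ suc (e ℕ.+ e)
      W≺ = DB.≺-+ (DB.≺-* (polyParam-≺ S innerP (suc e) (take N₁ u)) (DB.bound degG)) (VH≺ e V≺e (DB.≺-neg H≺e))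

      e+e : 2 ℕ.* e ≡ e ℕ.+ e
      e+e = ≡.cong (e ℕ.+_) (ℕₚ.+-identityʳ e)

      condition : ∀ {i j} → (i , j) ∈ conditions → PR.coeff (PS.coeff W i) j R.≈ R.0#
      condition {i} {j} c = All.lookup {P = λ c → functional c u R.≈ R.0#} vanishing {i , j} c

      higher : ∀ i → PS.coeff W (suc i) S.≈ S.0#
      higher i = PR.pointwise λ j → go j (i ℕₚ.<? 2 ℕ.* e) (j ℕₚ.<? q ℕ.+ k)
        where
        go : ∀ j → Dec (i < 2 ℕ.* e) → Dec (j < q ℕ.+ k) → PR.coeff (PS.coeff W (suc i)) j R.≈ R.0#
        go j _        (no j≮)  = DR.vanish (vanishₜ W≺ₜ (suc i)) j (ℕₚ.≮⇒≥ j≮)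
        go j (no i≮)  (yes _)  = PR.at (DB.vanish W≺ (suc i) (s≤s (ℕₚ.≤-trans (ℕₚ.≤-reflexive (≡.sym e+e)) (ℕₚ.≮⇒≥ i≮)))) j
        go j (yes i<) (yes j<) = condition (∈-++⁺ʳ (List.map (λ j → 0 , q ℕ.+ j) (upTo k))
              (∈-cartesianProduct⁺ (∈-map⁺ suc (∈-upTo⁺ i<)) (∈-upTo⁺ j<)))

      w₀ = PS.coeff W 0

      w₀≺ : w₀ DR.≺ q
      w₀≺ = DR.below λ j q≤j → go j q≤j (j ℕₚ.<? q ℕ.+ k)
        where
        go : ∀ j → q ≤ j → Dec (j < q ℕ.+ k) → PR.coeff w₀ j R.≈ R.0#
        go j q≤j (no j≮)  = DR.vanish (vanishₜ W≺ₜ 0) j (ℕₚ.≮⇒≥ j≮)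
        go j q≤j (yes j<) = ≡.subst (λ n → PR.coeff w₀ n R.≈ R.0#) (ℕₚ.m+[n∸m]≡n q≤j)
              (condition (∈-++⁺ˡ (∈-map⁺ (λ j → 0 , q ℕ.+ j) (∈-upTo⁺ j∸q<k))))
          where
          j∸q<k : j ℕ.∸ q < k
          j∸q<k = ℕₚ.+-cancelˡ-< q _ _ (≡.subst (_< q ℕ.+ k) (≡.sym (ℕₚ.m+[n∸m]≡n q≤j)) j<)

      W≈w₀ : W B.≈ DB.const w₀
      W≈w₀ = PS.pointwise λ { zero → S.refl ; (suc i) → higher i }

      w₀-root : ∀ {P} → P ∈ points → At.ev P G R.≈ R.0# → DR.eval w₀ (proj₁ P) R.≈ R.0#
      w₀-root {P} P∈ z = R.trans (R.sym (At.ev-const P w₀)) (R.trans (R.sym (At.ev-cong P W≈w₀))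
        (R.trans (At.ev-+ P (U B.* G) (V B.* (B.- H))) (R.trans (R.+-cong
          (R.trans (At.ev-* P U G) (R.trans (R.*-congˡ z) (R.zeroʳ _)))
          (R.trans (At.ev-* P V (B.- H)) (R.trans (R.*-congˡ negH) (R.zeroʳ _)))) (R.+-identityˡ _))))
        where
        negH : At.ev P (B.- H) R.≈ R.0#
        negH = R.trans (R.sym (R.+-identityˡ _)) (R.trans (R.+-congʳ (R.sym (common P∈ z)))
          (R.trans (R.sym (At.ev-+ P H (B.- H))) (At.ev-cong P (B.-‿inverseʳ H))))

      w₀≈0 : w₀ S.≈ S.0#
      w₀≈0 = DR.roots-bound (List.map proj₁ (zeros G)) (APₚ.map⁺ (APₚ.filter⁺ _ distinct))
        (Allₚ.map⁺ (All.tabulate λ P∈ → let (P∈points , z) = ∈-filter⁻ (λ P → R.zero? (At.ev P G)) {xs = points} P∈ in w₀-root P∈points z))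
        (≡.subst (w₀ DR.≺_) (≡.sym (length-map proj₁ (zeros G))) w₀≺)

      W≈0 : W B.≈ B.0#
      W≈0 = B.trans W≈w₀ (DB.const-0 w₀≈0)

      UG≈VH : U B.* G B.≈ V B.* H
      UG≈VH = B.trans (B.sym (B.+-identityʳ _)) (B.trans (B.+-congˡ (B.sym (B.-‿inverseˡ (V B.* H))))
        (B.trans (B.sym (B.+-assoc _ _ _)) (B.trans (B.+-congʳ (B.trans (B.+-congˡ (-‿distribʳ-* V H)) W≈0)) (B.+-identityˡ _))))

      -- If V were 0, then U G = 0 and so U = 0, and the solution of the system would be trivial.
      V≉0 : ¬ V B.≈ B.0#
      V≉0 V≈0 = proj₁ (proj₂ solution) (Zero-++ N₁ u (UP.injective (take N₁ u) U≈0) (VP.injective (drop N₁ u) V≈0))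
        where
        U≈0 : U B.≈ B.0#
        U≈0 = DB′.cancelˡ (DB.degree-≉0 degG) (B.trans (B.*-comm G U) (B.trans UG≈VH (B.trans (B.*-congʳ V≈0) (B.zeroˡ H))))
          where module DB′ = Degrees B

-- Zeros on the dual points of a grid

-- The first term e k + (e + 1) k is Bezout's number for the bidegrees (e, k) of G and (e + 1, k) of
-- D G; the second bounds the zeros on an N × N grid when G divides D G.
zeroBound : ℕ → ℕ → ℕ → ℕ
zeroBound N e k = suc (2 ℕ.* e) ℕ.* k ℕ.+ 2 ℕ.* e ℕ.* N

-- This makes the bound for a product follow from those for its factors. The slack consists of the
-- cross terms 2 (e k′ + e′ k).
zeroBound-superadditive : ∀ N e e′ k k′ → zeroBound N e k ℕ.+ zeroBound N e′ k′ ≤ zeroBound N (e ℕ.+ e′) (k ℕ.+ k′)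
zeroBound-superadditive N e e′ k k′ = ℕₚ.≤-trans (ℕₚ.m≤m+n _ (2 ℕ.* (e ℕ.* k′ ℕ.+ e′ ℕ.* k))) (ℕₚ.≤-reflexive
  (solve 5 (λ N e e′ k k′ →
      (((con 1 :+ con 2 :* e) :* k :+ con 2 :* e :* N) :+ ((con 1 :+ con 2 :* e′) :* k′ :+ con 2 :* e′ :* N))
        :+ con 2 :* (e :* k′ :+ e′ :* k)
      := (con 1 :+ con 2 :* (e :+ e′)) :* (k :+ k′) :+ con 2 :* (e :+ e′) :* N) ≡.refl N e e′ k k′))
  where open +-*-Solver

module GridZeros (R : Domain) (d : Derivation R) {I : Set} (xs : List I)
  (α : I → Domain.Carrier R) (τ : I → I → Domain.Carrier R)
  (α-constant : ∀ a → Domain._≈_ R (Derivation.∂ d (α a)) (Domain.0# R))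
  (τ-line : ∀ a b → Domain._≈_ R (Derivation.∂ d (τ a b)) (Domain.-_ R (α a)))
  (α-distinct : AllPairs (λ a a′ → ¬ Domain._≈_ R (α a) (α a′)) xs)
  (τ-distinct : AllPairs (λ P Q → ¬ Domain._≈_ R (uncurry τ P) (uncurry τ Q)) (cartesianProduct xs xs))
  (τ-distinct₂ : ∀ a → AllPairs (λ b b′ → ¬ Domain._≈_ R (τ a b) (τ a b′)) xs)
  (p : ℕ)
  (char : CharacteristicAtLeast p R)
  where
  open InnerDegree R
  open GaussLemma R using (ι; Refactored; gauss)
  open Flow R d using (D; coeff-D; coeff-D₀; ∂ₛ; coeff-∂ₛ; module AlongLine)
  open FormalDerivative R using (_⋆_; der; coeff-der; ⋆-cong; ⋆-zero)
  open Derivation d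
  open BezoutBound R hiding (module At)
  module DR = Degrees R
  open DR using (_≺_; Degree; vanish)
  private
    N = length xs

  -- The dual line t = b - s a of (a, b) as a point (t, a) of a plane over R. With s transcendental
  -- the coordinates b - s a of all grid points are distinct, so projecting to t is injective on
  -- them, as Bezout's bound requires.
  toPoint : I × I → R.Carrier × R.Carrier
  toPoint (a , b) = τ a b , α a

  points : List (R.Carrier × R.Carrier)
  points = List.map toPoint (cartesianProduct xs xs)

  points-distinct : AllPairs (λ P Q → ¬ proj₁ P R.≈ proj₁ Q) points
  points-distinct = APₚ.map⁺ τ-distinct

  open BezoutBound R using () renaming (module At to At′)
  module At (P : R.Carrier × R.Carrier) = At′ points points-distinct P

  zero-at? : ∀ G P → Dec (At.ev P G R.≈ R.0#)
  zero-at? G P = R.zero? (At.ev P G)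

  Z : B.Carrier → ℕ
  Z G = length (zeros points points-distinct G)

  Z≡∑ : ∀ G → Z G ≡ ∑ points (λ P → 𝟙 (zero-at? G P))
  Z≡∑ G = length-filter≡∑ (zero-at? G) points

  Z-⊎ : ∀ F G H → (∀ P → At.ev P F R.≈ R.0# → At.ev P G R.≈ R.0# ⊎ At.ev P H R.≈ R.0#) → Z F ≤ Z G ℕ.+ Z H
  Z-⊎ F G H h = ℕₚ.≤-trans (ℕₚ.≤-reflexive (Z≡∑ F)) (ℕₚ.≤-trans
    (∑-mono points (λ P → 𝟙-⊎ (zero-at? F P) (zero-at? G P) (zero-at? H P) (h P)))
    (ℕₚ.≤-reflexive (≡.trans (∑-+ points _ _) (≡.cong₂ ℕ._+_ (≡.sym (Z≡∑ G)) (≡.sym (Z≡∑ H))))))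

  product-zero : ∀ X F G H → X B.* F B.≈ G B.* H → ∀ P → At.ev P F R.≈ R.0# →
                 At.ev P G R.≈ R.0# ⊎ At.ev P H R.≈ R.0#
  product-zero X F G H eq P z = split (zero-at? G P) (zero-at? H P)
    where
    gh : At.ev P G R.* At.ev P H R.≈ R.0#
    gh = R.trans (R.sym (At.ev-* P G H)) (R.trans (R.sym (At.ev-cong P eq))
      (R.trans (At.ev-* P X F) (R.trans (R.*-congˡ z) (R.zeroʳ _))))
    split : Dec _ → Dec _ → _ ⊎ _
    split (yes g) _       = inj₁ g
    split (no _)  (yes h) = inj₂ h
    split (no g)  (no h)  = ⊥-elim (R.nonzero-* g h gh)

  roots-count : ∀ (E : Domain) {f e} ys → ¬ Domain._≈_ (Poly E) f [] → Degrees._≺_ E f (suc e) →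
    AllPairs (λ x y → ¬ Domain._≈_ E x y) ys → All (λ x → Domain._≈_ E (Degrees.eval E f x) (Domain.0# E)) ys → length ys ≤ e
  roots-count E {f} {e} ys f≉0 b ds zs with length ys ℕₚ.≤? e
  ... | yes h = h
  ... | no  h = ⊥-elim (f≉0 (Degrees.roots-bound E ys ds zs (Degrees.≺-mono E (ℕₚ.≰⇒> h) b)))

  D-≺ : ∀ {G e} → DB.Degree G e → D G DB.≺ suc (suc e)
  D-≺ {G} {e} degG = DB.below λ { (suc i) (s≤s h) → S.trans (coeff-D G i) (S.trans
      (S.+-cong (PR.pointwise λ j → R.trans (coeff-∂ₛ (PS.coeff G (suc i)) j) (R.trans (∂-cong (PR.at (DB.vanish (DB.bound degG) (suc i) (ℕₚ.m≤n⇒m≤1+n h)) j)) ∂-0))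
        (S.-‿cong (PR.pointwise λ j → R.trans (coeff-der (PS.coeff G i) j) (R.trans (⋆-cong (suc j) (PR.at (DB.vanish (DB.bound degG) i h) (suc j))) (⋆-zero (suc j))))))
      (S.-‿inverseʳ S.0#)) }

  D-≺ₜ : ∀ {G k} → TDegree G k → D G ≺ₜ suc k
  D-≺ₜ {G} {k} tdegG = belowₜ λ
      { zero    → DR.≺-cong (S.sym (coeff-D₀ G)) (∂≺ (vanishₜ (boundₜ tdegG) 0))
      ; (suc i) → DR.≺-cong (S.sym (coeff-D G i)) (DR.≺-+ (∂≺ (vanishₜ (boundₜ tdegG) (suc i)))
          (DR.≺-neg (DR.≺-mono (ℕₚ.n≤1+n k) (FormalDerivative.≺-der R (vanishₜ (boundₜ tdegG) i))))) }
      where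
      ∂≺ : ∀ {w n} → w ≺ n → ∂ₛ w ≺ n
      ∂≺ {w} b = DR.below λ j h → R.trans (coeff-∂ₛ w j) (R.trans (∂-cong (vanish b j h)) ∂-0)

  -- A polynomial dividing its own derivative D G has total degree at most e, hence few zeros on the grid.
  module Invariant {G e k} (degG : DB.Degree G e) (tdegG : TDegree G k) (k<p : k < p)
                   {μ W} (unit : Degree μ 0) (eq : ι μ B.* D G B.≈ W B.* G) where

    c : ℕ → ℕ → R.Carrier
    c i j = PR.coeff (PS.coeff G i) j

    μ₀ = PR.coeff μ 0

    μD≺ : ι μ B.* D G DB.≺ suc (suc e)
    μD≺ = DB.≺-const* μ (D-≺ degG)

    μD≺ₜ : ι μ B.* D G ≺ₜ suc k
    μD≺ₜ = ≺ₜ-* (boundₜ (tdegree-const unit)) (D-≺ₜ tdegG)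

    -- Degrees add up in W G = μ D G, and D raises the degree in a by at most one and the degree in
    -- t not at all. So W = w₀ + w₁ a with w₀ and w₁ in R.
    W≺ : W DB.≺ 2
    W≺ = go (DB.degree? W)
      where
      go : W B.≈ B.0# ⊎ (∃[ w ] DB.Degree W w) → W DB.≺ 2
      go (inj₁ W≈0) = DB.0≺ 2 W≈0
      go (inj₂ (w , degW)) = DB.≺-mono w<2 (DB.bound degW)
       where
       w<2 : w < 2
       w<2 = ℕₚ.+-cancelʳ-< e w 2 (DB.degree-< (DB.degree-cong (B.sym eq) (DB.degree-* degW degG)) μD≺)

    W≺ₜ : W ≺ₜ 1
    W≺ₜ = go (DB.degree? W)
      where
      go : W B.≈ B.0# ⊎ (∃[ w ] DB.Degree W w) → W ≺ₜ 1
      go (inj₁ W≈0) = ≺ₜ-cong (B.sym W≈0) (belowₜ λ _ → DR.0≺ 1 S.refl)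
      go (inj₂ (w , degW)) = ≺ₜ-mono κ<1 (boundₜ tdegW)
        where
        κ = proj₁ (hasTDegree (DB.degree-≉0 degW))
        tdegW = proj₂ (hasTDegree (DB.degree-≉0 degW))
        κ<1 : κ < 1
        κ<1 = ℕₚ.+-cancelʳ-< k κ 1 (tdegree-< (tdegree-cong (B.sym eq) (tdegree-* tdegW tdegG)) μD≺ₜ)

    w₀ = PR.coeff (PS.coeff W 0) 0
    w₁ = PR.coeff (PS.coeff W 1) 0

    const-≈ : ∀ {x} → x ≺ 1 → x S.≈ DR.const (PR.coeff x 0)
    const-≈ b = PR.pointwise λ { zero → R.refl ; (suc j) → vanish b (suc j) (s≤s z≤n) }

    W≈ : W B.≈ DR.const w₀ ∷ DR.const w₁ ∷ []
    W≈ = PS.pointwise λ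
      { zero          → const-≈ (vanishₜ W≺ₜ 0)
      ; (suc zero)    → const-≈ (vanishₜ W≺ₜ 1)
      ; (suc (suc i)) → DB.vanish W≺ (suc (suc i)) (s≤s (s≤s z≤n)) }

    -- Comparison of the coefficients of a^(i+1) tʲ on the two sides of μ D G = W G.
    relation : ∀ i j → μ₀ R.* (∂ (c (suc i) j) R.+ R.- (suc j ⋆ c i (suc j))) R.≈ w₀ R.* c (suc i) j R.+ w₁ R.* c i j
    relation i j = R.trans (R.sym lhs) (R.trans (PR.at (PS.at eq (suc i)) j) rhs)
      where
      lhs : PR.coeff (PS.coeff (ι μ B.* D G) (suc i)) j R.≈ μ₀ R.* (∂ (c (suc i) j) R.+ R.- (suc j ⋆ c i (suc j)))
      lhs = R.trans (PR.at (DB.coeff-const* μ (D G) (suc i)) j) (R.trans (PR.at (S.*-congʳ (const-≈ (DR.bound unit))) j)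
        (R.trans (DR.coeff-const* μ₀ (PS.coeff (D G) (suc i)) j) (R.*-congˡ (R.trans (PR.at (coeff-D G i) j)
          (R.trans (PR.coeff-add (∂ₛ (PS.coeff G (suc i))) _ j) (R.+-cong (coeff-∂ₛ (PS.coeff G (suc i)) j)
            (R.trans (PR.coeff-neg (der (PS.coeff G i)) j) (R.-‿cong (coeff-der (PS.coeff G i) j)))))))))
      rhs : PR.coeff (PS.coeff (W B.* G) (suc i)) j R.≈ w₀ R.* c (suc i) j R.+ w₁ R.* c i j
      rhs = R.trans (PR.at (PS.at (B.*-congʳ W≈) (suc i)) j)
        (R.trans (PR.at (DB.coeff-x∷* (DR.const w₀) (DR.const w₁ ∷ []) G (suc i)) j)
        (R.trans (PR.coeff-add (DR.const w₀ S.* PS.coeff G (suc i)) _ j)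
          (R.+-cong (DR.coeff-const* w₀ (PS.coeff G (suc i)) j)
            (R.trans (PR.at (DB.coeff-const* (DR.const w₁) G i) j) (DR.coeff-const* w₁ (PS.coeff G i) j)))))

    open import Algebra.Properties.Ring R.ring using (-0#≈0#)

    top-zero : ∀ i j → e < i → c i j R.≈ R.0#
    top-zero i j e<i = PR.at (DB.vanish (DB.bound degG) i e<i) j

    -- At the top degree e in a, and at the degree δ in t of the leading coefficient there, every
    -- term of `relation` vanishes except w₁ times that leading coefficient.
    w₁≈0 : w₁ R.≈ R.0#
    w₁≈0 = go (DR.degree? (PS.coeff G e))
      where
      go : PS.coeff G e S.≈ S.0# ⊎ (∃[ δ ] Degree (PS.coeff G e) δ) → w₁ R.≈ R.0#
      go (inj₁ z) = ⊥-elim (DB.lead≉0 degG z)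
      go (inj₂ (δ , lead)) = DR.cancelˡ (DR.lead≉0 lead) (R.trans (R.*-comm _ _) (R.trans
        (R.sym (R.trans (R.+-congʳ (R.trans (R.*-congˡ (top-zero (suc e) δ ℕₚ.≤-refl)) (R.zeroʳ w₀))) (R.+-identityˡ _)))
        (R.trans (R.sym (relation e δ)) (R.trans (R.*-congˡ (R.trans (R.+-cong
          (R.trans (∂-cong (top-zero (suc e) δ ℕₚ.≤-refl)) ∂-0)
          (R.trans (R.-‿cong (R.trans (⋆-cong (suc δ) (vanish (DR.bound lead) (suc δ) ℕₚ.≤-refl)) (⋆-zero (suc δ)))) -0#≈0#))
          (R.+-identityˡ _))) (R.zeroʳ μ₀)))))

    -- With w₁ = 0, `relation` expresses (j + 1) c i (j + 1) by c (i + 1) j, so the degree in t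
    -- grows by at most one when i drops by one. Where j + 1 ≥ p cannot be cancelled, the degree k <
    -- p in t gives the vanishing. Starting from the zero coefficient of a^(e+1), this bounds the
    -- total degree by e.
    step : ∀ i n → PS.coeff G (suc i) ≺ n → PS.coeff G i ≺ suc n
    step i n b = DR.below λ { (suc j) (s≤s n≤j) → go j n≤j (suc j ℕₚ.<? p) }
      where
      go : ∀ j → n ≤ j → Dec (suc j < p) → c i (suc j) R.≈ R.0#
      go j n≤j (no  h) = vanish (vanishₜ (boundₜ tdegG) i) (suc j) (ℕₚ.≤-trans k<p (ℕₚ.≮⇒≥ h))
      go j n≤j (yes h) = char j _ h (R.trans (R.sym (-‿involutive _)) (R.trans (R.-‿cong neg≈0) -0#≈0#))
        where
        open import Algebra.Properties.Ring R.ring using (-‿involutive)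
        c≈0 = vanish b j n≤j
        neg≈0 : R.- (suc j ⋆ c i (suc j)) R.≈ R.0#
        neg≈0 = DR.cancelˡ (DR.lead≉0 unit) (R.trans
          (R.*-congˡ (R.sym (R.trans (R.+-congʳ (R.trans (∂-cong c≈0) ∂-0)) (R.+-identityˡ _))))
          (R.trans (relation i j) (R.trans (R.+-cong (R.trans (R.*-congˡ c≈0) (R.zeroʳ w₀))
            (R.trans (R.*-congʳ w₁≈0) (R.zeroˡ _))) (R.+-identityˡ _))))

    descending : ∀ l i → i ℕ.+ l ≡ suc e → PS.coeff G i ≺ l
    descending zero    i eq = DR.0≺ 0 (DB.vanish (DB.bound degG) i (ℕₚ.≤-reflexive (≡.trans (≡.sym eq) (ℕₚ.+-identityʳ i))))
    descending (suc l) i eq = step i l (descending l (suc i) (≡.trans (≡.sym (ℕₚ.+-suc i l)) eq))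

    total-degree : ∀ i → PS.coeff G i ≺ suc e
    total-degree i = go (i ℕₚ.≤? suc e)
      where
      go : Dec (i ≤ suc e) → PS.coeff G i ≺ suc e
      go (yes h) = DR.≺-mono (ℕₚ.m∸n≤m (suc e) i) (descending (suc e ℕ.∸ i) i (ℕₚ.m+[n∸m]≡n h))
      go (no  h) = DR.0≺ (suc e) (DB.vanish (DB.bound degG) i (ℕₚ.<⇒≤ (ℕₚ.≰⇒> h)))

    slice : R.Carrier → S.Carrier
    slice x = DB.eval G (DR.const x)

    slice-≺ : ∀ x → slice x ≺ suc e
    slice-≺ x = go G total-degree
      where
      go : ∀ G → (∀ i → PS.coeff G i ≺ suc e) → DB.eval G (DR.const x) ≺ suc e
      go []      h = DR.0≺ (suc e) S.refl
      go (w ∷ G) h = DR.≺-+ (h 0) (DR.≺-const* x (go G (λ i → h (suc i))))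

    eval-slice : ∀ P → At.ev P G R.≈ DR.eval (slice (proj₂ P)) (proj₁ P)
    eval-slice P = go G
      where
      module E = Evaluation R (idHom R.commutativeRing) (proj₁ P)
      go : ∀ G → At.ev P G R.≈ E.ev (DB.eval G (DR.const (proj₂ P)))
      go []      = R.refl
      go (w ∷ G) = R.trans (R.+-congˡ (R.*-congˡ (go G))) (R.sym (R.trans (E.ev-+ w _)
        (R.+-congˡ (R.trans (E.ev-* (DR.const (proj₂ P)) (DB.eval G (DR.const (proj₂ P)))) (R.*-congʳ (E.ev-const _))))))

    flat? : ∀ a → Dec (slice (α a) S.≈ S.0#)
    flat? a = S.zero? (slice (α a))

    flat-count : ∑ xs (λ a → 𝟙 (flat? a)) ≤ e
    flat-count = ℕₚ.≤-trans (ℕₚ.≤-reflexive (≡.sym (≡.trans (length-map (λ a → DR.const (α a)) (filter flat? xs)) (length-filter≡∑ flat? xs))))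
      (roots-count S {G} {e} (List.map (λ a → DR.const (α a)) (filter flat? xs)) (DB.degree-≉0 degG) (DB.bound degG)
        (APₚ.map⁺ (AP.map (λ ne q → ne (PR.at q 0)) (APₚ.filter⁺ flat? α-distinct)))
        (Allₚ.map⁺ (Allₚ.all-filter flat? xs)))

    -- A value a for which G vanishes identically in t may contribute all N points, but there are at
    -- most e of these. For any other a, G becomes a nonzero polynomial of degree at most e in t.
    row-count : ∀ a → ∑ xs (λ b → 𝟙 (zero-at? G (τ a b , α a))) ≤ 𝟙 (flat? a) ℕ.* N ℕ.+ e
    row-count a = go (flat? a)
      where
      Q? = λ b → zero-at? G (τ a b , α a)
      go : (f : Dec (slice (α a) S.≈ S.0#)) → ∑ xs (λ b → 𝟙 (Q? b)) ≤ 𝟙 f ℕ.* N ℕ.+ e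
      go (yes _) = ℕₚ.≤-trans (∑-≤-const xs 1 (λ b → 𝟙≤1 (Q? b)))
        (ℕₚ.≤-trans (ℕₚ.≤-reflexive (ℕₚ.*-comm N 1)) (ℕₚ.m≤m+n (1 ℕ.* N) e))
      go (no ne) = ℕₚ.≤-trans (ℕₚ.≤-reflexive (≡.sym (≡.trans (length-map (τ a) (filter Q? xs)) (length-filter≡∑ Q? xs))))
        (roots-count R {slice (α a)} {e} (List.map (τ a) (filter Q? xs)) ne (slice-≺ (α a))
          (APₚ.map⁺ (APₚ.filter⁺ Q? (τ-distinct₂ a)))
          (Allₚ.map⁺ (All.map (λ {b} z → R.trans (R.sym (eval-slice (τ a b , α a))) z) (Allₚ.all-filter Q? xs))))

    few-zeros : Z G ≤ 2 ℕ.* e ℕ.* N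
    few-zeros = ℕₚ.≤-trans (ℕₚ.≤-reflexive (≡.trans (Z≡∑ G) (≡.trans (∑-map toPoint (cartesianProduct xs xs) _)
        (∑-cartesianProduct xs xs _))))
      (ℕₚ.≤-trans (∑-mono xs row-count) (ℕₚ.≤-trans (ℕₚ.≤-reflexive (≡.trans (∑-+ xs _ _)
        (≡.cong₂ ℕ._+_ (∑-*ʳ N xs _) (∑-const xs e))))
        (ℕₚ.≤-trans (ℕₚ.+-monoˡ-≤ (N ℕ.* e) (ℕₚ.*-monoˡ-≤ N flat-count)) (ℕₚ.≤-reflexive
          (solve 2 (λ e N → e :* N :+ N :* e := con 2 :* e :* N) ≡.refl e N)))))
      where open +-*-Solver

  private
    -- The colon ideal of (G) by H. It always contains G; for H = D G, the syzygy provides a nonzero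
    -- element of smaller degree in a.
    Ideal : B.Carrier → B.Carrier → B.Carrier → Set
    Ideal G H V = ∃[ U ] U B.* G B.≈ V B.* H

    ideal-closed : ∀ G H {c f q w r} → Ideal G H f → Ideal G H w → ι c B.* f B.≈ q B.* w B.+ r → Ideal G H r
    ideal-closed G H {c} {f} {q} {w} {r} (Uf , ef) (Uw , ew) eq =
      ι c B.* Uf B.+ B.- (q B.* Uw) , (begin
      (ι c B.* Uf B.+ B.- (q B.* Uw)) B.* G ≈⟨ B.distribʳ _ _ _ ⟩
      (ι c B.* Uf) B.* G B.+ B.- (q B.* Uw) B.* G ≈⟨ B.+-cong (B.*-assoc _ _ _) (B.trans (B.sym (-‿distribˡ-* _ _)) (B.-‿cong (B.*-assoc _ _ _))) ⟩
      ι c B.* (Uf B.* G) B.+ B.- (q B.* (Uw B.* G)) ≈⟨ B.+-cong (B.*-congˡ ef) (B.-‿cong (B.*-congˡ ew)) ⟩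
      ι c B.* (f B.* H) B.+ B.- (q B.* (w B.* H)) ≈⟨ B.+-cong (B.sym (B.*-assoc _ _ _)) (B.-‿cong (B.sym (B.*-assoc _ _ _))) ⟩
      (ι c B.* f) B.* H B.+ B.- ((q B.* w) B.* H) ≈⟨ B.+-congʳ (B.trans (B.*-congʳ (B.trans eq (B.+-comm _ _))) (B.distribʳ _ _ _)) ⟩
      (r B.* H B.+ (q B.* w) B.* H) B.+ B.- ((q B.* w) B.* H) ≈⟨ B.trans (B.+-assoc _ _ _) (B.trans (B.+-congˡ (B.-‿inverseʳ _)) (B.+-identityʳ _)) ⟩
      r B.* H ∎)
      where
      open SetoidReasoning B.setoid
      open import Algebra.Properties.Ring B.ring using (-‿distribˡ-*)

    factor-≉0ˡ : ∀ {X Y Z} → ¬ X B.≈ B.0# → X B.≈ Y B.* Z → ¬ Y B.≈ B.0#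
    factor-≉0ˡ {X} {Y} {Z} X≉0 eq Y≈0 = X≉0 (B.trans eq (B.trans (B.*-congʳ Y≈0) (B.zeroˡ Z)))

    factor-≉0ʳ : ∀ {X Y Z} → ¬ X B.≈ B.0# → X B.≈ Y B.* Z → ¬ Z B.≈ B.0#
    factor-≉0ʳ {X} {Y} {Z} X≉0 eq Z≈0 = X≉0 (B.trans eq (B.trans (B.*-congˡ Z≈0) (B.zeroʳ Y)))

    -- Bidegrees add up, so a factorization yields two smaller instances.
    record Split (e k : ℕ) (Y Z : B.Carrier) : Set where
      field
        {e₁ e₂ k₁ k₂} : ℕ
        degY  : DB.Degree Y e₁
        degZ  : DB.Degree Z e₂
        tdegY : TDegree Y k₁
        tdegZ : TDegree Z k₂
        e-sum : e₁ ℕ.+ e₂ ≡ e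
        k-sum : k₁ ℕ.+ k₂ ≡ k

    split : ∀ {G e k u Y Z} → DB.Degree G e → TDegree G k → Degree u 0 → ι u B.* G B.≈ Y B.* Z → Split e k Y Z
    split {G} {e} {k} {u} {Y} {Z} degG tdegG U eq = record
      { degY = proj₂ (DB.hasDegree Y≉0) ; degZ = proj₂ (DB.hasDegree Z≉0)
      ; tdegY = proj₂ (hasTDegree Y≉0) ; tdegZ = proj₂ (hasTDegree Z≉0)
      ; e-sum = DB.degree-unique (DB.degree-cong (B.sym eq) (DB.degree-* (proj₂ (DB.hasDegree Y≉0)) (proj₂ (DB.hasDegree Z≉0)))) degX
      ; k-sum = tdegree-unique (tdegree-cong (B.sym eq) (tdegree-* (proj₂ (hasTDegree Y≉0)) (proj₂ (hasTDegree Z≉0)))) tdegX }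
      where
      degX : DB.Degree (ι u B.* G) e
      degX = DB.degree-const* (DR.degree-≉0 U) degG
      tdegX : TDegree (ι u B.* G) k
      tdegX = tdegree-* (tdegree-const U) tdegG
      Y≉0 = factor-≉0ˡ (DB.degree-≉0 degX) eq
      Z≉0 = factor-≉0ʳ (DB.degree-≉0 degX) eq

  Bound : ℕ → Set
  Bound n = ∀ {G e k} → e ℕ.+ k < n → DB.Degree G e → TDegree G k → k < p → Z G ≤ zeroBound N e k

  private
    module Step (n : ℕ) (ih : Bound n) {G e k} (small : e ℕ.+ k ≤ n)
                (degG : DB.Degree G e) (tdegG : TDegree G k) (k<p : k < p)
                (ev-common : ∀ {P} → P ∈ points → At.ev P G R.≈ R.0# → At.ev P (D G) R.≈ R.0#) where
      -- Every zero of G is a zero of one of the factors, whose bidegrees add up to (e, k); both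
      -- fall under the induction hypothesis.
      factored : ∀ {u Y Z′} → Degree u 0 → ι u B.* G B.≈ Y B.* Z′ → (s : Split e k Y Z′) →
        Split.e₁ s ℕ.+ Split.k₁ s < n → Split.e₂ s ℕ.+ Split.k₂ s < n → Z G ≤ zeroBound N e k
      factored {u} {Y} {Z′} U eq s small₁ small₂ = ℕₚ.≤-trans (Z-⊎ G Y Z′ (product-zero (ι u) G Y Z′ eq))
        (ℕₚ.≤-trans (ℕₚ.+-mono-≤
          (ih small₁ degY tdegY (ℕₚ.≤-trans (s≤s (ℕₚ.≤-trans (ℕₚ.m≤m+n k₁ k₂) (ℕₚ.≤-reflexive k-sum))) k<p))
          (ih small₂ degZ tdegZ (ℕₚ.≤-trans (s≤s (ℕₚ.≤-trans (ℕₚ.m≤n+m k₂ k₁) (ℕₚ.≤-reflexive k-sum))) k<p)))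
        (ℕₚ.≤-trans (zeroBound-superadditive N e₁ e₂ k₁ k₂) (ℕₚ.≤-reflexive (≡.cong₂ (zeroBound N) e-sum k-sum))))
        where open Split s

      proper : ∀ {e₁ e₂ k₁ k₂} → e₁ ℕ.+ e₂ ≡ e → k₁ ℕ.+ k₂ ≡ k → 0 < e₁ ℕ.+ k₁ → e₂ ℕ.+ k₂ < n
      proper {e₁} {e₂} {k₁} {k₂} p q pos = ℕₚ.≤-trans (ℕₚ.+-monoˡ-≤ (e₂ ℕ.+ k₂) pos) (ℕₚ.≤-trans (ℕₚ.≤-reflexive
        (≡.trans (solve 4 (λ a b c d → (a :+ c) :+ (b :+ d) := (a :+ b) :+ (c :+ d)) ≡.refl e₁ e₂ k₁ k₂) (≡.cong₂ ℕ._+_ p q))) small)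
        where open +-*-Solver

      properʳ : ∀ {e₁ e₂ k₁ k₂} → e₁ ℕ.+ e₂ ≡ e → k₁ ℕ.+ k₂ ≡ k → 0 < e₂ ℕ.+ k₂ → e₁ ℕ.+ k₁ < n
      properʳ {e₁} {e₂} {k₁} {k₂} p q = proper {e₂} {e₁} {k₂} {k₁} (≡.trans (ℕₚ.+-comm e₂ e₁) p) (≡.trans (ℕₚ.+-comm k₂ k₁) q)

      Divisor′ : Set
      Divisor′ = DB.Divisor (Ideal G (D G)) (λ {c} {f} {q} {w} {r} → ideal-closed G (D G) {c} {f} {q} {w} {r}) G e

      -- A divisor of positive degree in a: G factors.
      positive : ∀ {w v c q} → DB.Degree w (suc v) → suc v < e → ¬ c S.≈ S.0# → ι c B.* G B.≈ q B.* w → Z G ≤ zeroBound N e k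
      positive {w} {v} {c} {q} degw v<e c≉0 eq = factored unit-u product s
          (properʳ {e₁} {e₂} {k₁} {k₂} e-sum k-sum (ℕₚ.≤-trans (≡.subst (0 <_) (≡.sym e₂≡) (s≤s z≤n)) (ℕₚ.m≤m+n e₂ k₂)))
          (proper {e₁} {e₂} {k₁} {k₂} e-sum k-sum (ℕₚ.≤-trans e₁-pos (ℕₚ.m≤m+n e₁ k₁)))
        where
        δc = DR.hasDegree c≉0
        open Refactored (gauss (suc (proj₁ δc)) {c} {proj₁ δc} {G} {q} {w} ℕₚ.≤-refl (proj₂ δc) eq)
          renaming (v to v-unit; w to w-unit; c to c-left; d to d-right)
        s = split degG tdegG unit-u product
        open Split s
        ιw≉0 : ¬ ι w-unit B.* w B.≈ B.0#
        ιw≉0 = DB.degree-≉0 (DB.degree-const* (DR.degree-≉0 unit-w) degw)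
        d≉0 : ¬ d-right S.≈ S.0#
        d≉0 z = factor-≉0ˡ ιw≉0 right (DB.const-0 z)
        e₂≡ : e₂ ≡ suc v
        e₂≡ = DB.degree-unique (DB.degree-cong (B.sym right) (DB.degree-const* d≉0 degZ))
                               (DB.degree-const* (DR.degree-≉0 unit-w) degw)
        e₁-pos : 0 < e₁
        e₁-pos = ℕₚ.+-cancelʳ-< e₂ 0 e₁ (≡.subst₂ _<_ (≡.sym e₂≡) (≡.sym e-sum) v<e)

      -- The ideal meets R[t]: either G has a content, or it divides D G.
      constant : ∀ {c U} → ¬ c S.≈ S.0# → 0 < e → ι c B.* D G B.≈ U B.* G → Z G ≤ zeroBound N e k
      constant {c} {U} c≉0 e-pos eq = go (proj₁ δd) (proj₂ δd)
        where
        δc = DR.hasDegree c≉0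
        open Refactored (gauss (suc (proj₁ δc)) {c} {proj₁ δc} {D G} {U} {G} ℕₚ.≤-refl (proj₂ δc) eq)
          renaming (v to v-unit; w to w-unit; c to c-left; d to d-right)
        ιG≉0 : ¬ ι w-unit B.* G B.≈ B.0#
        ιG≉0 = DB.degree-≉0 (DB.degree-const* (DR.degree-≉0 unit-w) degG)
        d≉0 : ¬ d-right S.≈ S.0#
        d≉0 z = factor-≉0ˡ ιG≉0 right (DB.const-0 z)
        δd = DR.hasDegree d≉0
        go : ∀ δ → Degree d-right δ → Z G ≤ zeroBound N e k
        go (suc δ) degd = factored unit-w right s
            (properʳ {e₁} {e₂} {k₁} {k₂} e-sum k-sum (ℕₚ.≤-trans e₂-pos (ℕₚ.m≤m+n e₂ k₂)))
            (proper {e₁} {e₂} {k₁} {k₂} e-sum k-sum (ℕₚ.≤-trans k₁-pos (ℕₚ.m≤n+m k₁ e₁)))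
          where
          s = split degG tdegG unit-w right
          open Split s
          e₁≡0 : e₁ ≡ 0
          e₁≡0 = DB.degree-unique degY (DB.degree-const d≉0)
          e₂-pos : 0 < e₂
          e₂-pos = ≡.subst (0 <_) (≡.trans (≡.sym e-sum) (≡.cong (ℕ._+ e₂) e₁≡0)) e-pos
          k₁-pos : 0 < k₁
          k₁-pos = ≡.subst (0 <_) (tdegree-unique (tdegree-const degd) tdegY) (s≤s z≤n)
        -- Here d has degree 0 in t, so d u is a nonzero element of R, and d u D G = d Y′ Z′ = Y′ w
        -- G exhibits G as a divisor of D G up to that constant.
        go zero degd = ℕₚ.≤-trans (Invariant.few-zeros degG tdegG k<p {d-right S.* u} {Y′ B.* ι w-unit} (DR.degree-* degd unit-u) (begin
            ι (d-right S.* u) B.* D G ≈⟨ B.*-congʳ (DB.const-* d-right u) ⟩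
            (ι d-right B.* ι u) B.* D G ≈⟨ B.*-assoc _ _ _ ⟩
            ι d-right B.* (ι u B.* D G) ≈⟨ B.*-congˡ product ⟩
            ι d-right B.* (Y′ B.* Z′) ≈⟨ solve 3 (λ a b c → (a ⊗ (b ⊗ c)) ⊜ (b ⊗ (a ⊗ c))) B.refl (ι d-right) Y′ Z′ ⟩
            Y′ B.* (ι d-right B.* Z′) ≈⟨ B.*-congˡ right ⟨
            Y′ B.* (ι w-unit B.* G) ≈⟨ B.*-assoc _ _ _ ⟨
            (Y′ B.* ι w-unit) B.* G ∎))
            (ℕₚ.m≤n+m _ _)
          where
          open SetoidReasoning B.setoid
          open SemiringSolver B.commutativeSemiring using (solve) renaming (_:*_ to _⊗_; _:=_ to _⊜_)

      conclude : Divisor′ → Z G ≤ zeroBound N e k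
      conclude (w , suc v , degw , v<e , _ , c , q , c≉0 , eq) = positive degw v<e c≉0 eq
      conclude (w , zero , degw , v<e , (U , UG≈wDG) , _) = constant {PS.coeff w 0} {U} (DB.lead≉0 degw) v<e
        (B.trans (B.*-congʳ (B.sym w≈)) (B.sym UG≈wDG))
        where
        w≈ : w B.≈ ι (PS.coeff w 0)
        w≈ = PS.pointwise λ { zero → S.refl ; (suc i) → DB.vanish (DB.bound degw) (suc i) (s≤s z≤n) }

      bounded : Z G ≤ zeroBound N e k
      bounded = go (suc (2 ℕ.* e) ℕ.* k ℕₚ.<? Z G)
        where
        go : Dec (suc (2 ℕ.* e) ℕ.* k < Z G) → Z G ≤ zeroBound N e k
        go (no  h) = ℕₚ.≤-trans (ℕₚ.≮⇒≥ h) (ℕₚ.m≤m+n _ _)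
        go (yes h) =
          let (U , V , V≉0 , V≺e , UG≈VH) = syzygy points points-distinct degG (boundₜ tdegG) (D-≺ degG) (D-≺ₜ tdegG) ev-common h
              (v , degV) = DB.hasDegree V≉0
          -- Both G, with cofactor D G, and V lie in the ideal; the descent starts from V, whose
          -- degree is below e.
          in conclude (DB.descend (Ideal G (D G)) (λ {c} {f} {q} {w} {r} → ideal-closed G (D G) {c} {f} {q} {w} {r})
               degG (D G , B.*-comm (D G) G) (suc v) V v ℕₚ.≤-refl degV (DB.degree-< degV V≺e) (U , UG≈VH))

  zeros≤ : ∀ n → Bound n
  zeros≤ (suc n) {G} (s≤s small) degG tdegG k<p = Step.bounded n (zeros≤ n) small degG tdegG k<p common
    where
    common : ∀ {P} → P ∈ points → At.ev P G R.≈ R.0# → At.ev P (D G) R.≈ R.0#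
    common P∈ z with ∈-map⁻ toPoint P∈
    ... | (a , b) , _ , ≡.refl = R.trans (AlongLine.ev-D (α-constant a) (τ-line a b) G) (R.trans (∂-cong z) ∂-0)

-- Multiple roots

module Multiplicities (F : Domain) (p : ℕ)
  (char : CharacteristicAtLeast p F)
  where
  open Domain F renaming (Carrier to C)
  open Degrees F
  open FormalDerivative F
  open Polynomial F using (pointwise; ∷-cong; 0∷[])

  derⁿ : ℕ → List C → List C
  derⁿ zero    f = f
  derⁿ (suc n) f = der (derⁿ n f)

  derⁿ-cong : ∀ n {f g} → f P.≈ g → derⁿ n f P.≈ derⁿ n g
  derⁿ-cong zero    p = p
  derⁿ-cong (suc n) p = der-cong (derⁿ-cong n p)

  module Eval x = Evaluation F (idHom commutativeRing) x

  Vanishes : ℕ → List C → C → Set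
  Vanishes m f x = ∀ l → l < m → eval (derⁿ l f) x ≈ 0#

  private
    ℕ1 : ℕ → C
    ℕ1 n = n ⋆ 1#

    der-linear : ∀ x → der (linear x) P.≈ P.1#
    der-linear x = P.trans (P.+-congˡ (P.trans (∷-cong refl (der-const 1#)) 0∷[])) (P.+-identityʳ _)

    -- Leibniz's rule has only two terms here, because the linear factor has derivative 1 and no
    -- higher derivatives.
    leibniz : ∀ x h l → derⁿ (suc l) (linear x P.* h) P.≈ linear x P.* derⁿ (suc l) h P.+ const (ℕ1 (suc l)) P.* derⁿ l h
    leibniz x h zero = begin
      der (linear x P.* h) ≈⟨ der-* (linear x) h ⟩
      der (linear x) P.* h P.+ linear x P.* der h ≈⟨ P.+-comm _ _ ⟩
      linear x P.* der h P.+ der (linear x) P.* h ≈⟨ P.+-congˡ (P.*-congʳ (P.trans (der-linear x) (∷-cong (sym (+-identityʳ 1#)) P.refl))) ⟩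
      linear x P.* der h P.+ const (ℕ1 1) P.* h ∎
      where open SetoidReasoning P.setoid
    leibniz x h (suc l) = begin
      der (derⁿ (suc l) (linear x P.* h)) ≈⟨ der-cong (leibniz x h l) ⟩
      der (linear x P.* derⁿ (suc l) h P.+ const (ℕ1 (suc l)) P.* derⁿ l h) ≈⟨ der-+ _ _ ⟩
      der (linear x P.* derⁿ (suc l) h) P.+ der (const (ℕ1 (suc l)) P.* derⁿ l h) ≈⟨ P.+-cong (der-* (linear x) (derⁿ (suc l) h)) (der-const* (ℕ1 (suc l)) (derⁿ l h)) ⟩
      (der (linear x) P.* h′ P.+ linear x P.* der h′) P.+ const (ℕ1 (suc l)) P.* h′ ≈⟨ P.+-congʳ (P.+-congʳ (P.*-congʳ (der-linear x))) ⟩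
      (P.1# P.* h′ P.+ linear x P.* der h′) P.+ const (ℕ1 (suc l)) P.* h′
        ≈⟨ solve 5 (λ o h x d n → ((o ⊗ h ⊕ x ⊗ d) ⊕ n ⊗ h) ⊜ (x ⊗ d ⊕ (o ⊕ n) ⊗ h)) P.refl P.1# h′ (linear x) (der h′) (const (ℕ1 (suc l))) ⟩
      linear x P.* der h′ P.+ (P.1# P.+ const (ℕ1 (suc l))) P.* h′ ≈⟨ P.+-congˡ (P.*-congʳ sum) ⟩
      linear x P.* der h′ P.+ const (ℕ1 (suc (suc l))) P.* h′ ∎
      where
      open SetoidReasoning P.setoid
      open SemiringSolver P.commutativeSemiring using (solve) renaming (_:+_ to _⊕_; _:*_ to _⊗_; _:=_ to _⊜_)
      h′ = derⁿ (suc l) h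
      sum : P.1# P.+ const (ℕ1 (suc l)) P.≈ const (ℕ1 (suc (suc l)))
      sum = pointwise λ
        { zero    → Polynomial.coeff-add F P.1# (const (ℕ1 (suc l))) 0
        ; (suc i) → trans (Polynomial.coeff-add F P.1# (const (ℕ1 (suc l))) (suc i)) (+-identityˡ 0#) }

    eval-leibniz : ∀ x h l y → eval (derⁿ (suc l) (linear x P.* h)) y ≈
      (y + - x) * eval (derⁿ (suc l) h) y + ℕ1 (suc l) * eval (derⁿ l h) y
    eval-leibniz x h l y = trans (Eval.ev-cong y (leibniz x h l)) (trans (Eval.ev-+ y (linear x P.* derⁿ (suc l) h) _)
      (+-cong (trans (Eval.ev-* y (linear x) (derⁿ (suc l) h)) (*-congʳ (eval-linear x y)))
        (trans (Eval.ev-* y (const (ℕ1 (suc l))) (derⁿ l h)) (*-congʳ (Eval.ev-const y (ℕ1 (suc l)))))))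

    ℕ1-cancel : ∀ l x → suc l < p → ℕ1 (suc l) * x ≈ 0# → x ≈ 0#
    ℕ1-cancel l x l<p z = char l x l<p (trans (⋆-cong (suc l) (sym (*-identityʳ x)))
      (trans (⋆-* (suc l) x 1#) (trans (*-comm x _) z)))

  -- At the root itself the Leibniz formula leaves l + 1 times the l-th derivative of h, and l + 1 <
  -- p cancels. Splitting off one linear factor thus costs one order of vanishing.
  same-point : ∀ {x h m} → m < p → Vanishes (suc m) (linear x P.* h) x → Vanishes m h x
  same-point {x} {h} {m} m<p v l l<m = ℕ1-cancel l _ (ℕₚ.≤-trans (s≤s l<m) m<p)
    (trans (sym (trans (eval-leibniz x h l x) (trans (+-congʳ (trans (*-congʳ (-‿inverseʳ x)) (zeroˡ _))) (+-identityˡ _))))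
      (v (suc l) (s≤s l<m)))

  -- By induction on the order the second Leibniz term is already 0, and the factor y - x of the
  -- first cancels; so no order is lost at the other points.
  other-point : ∀ {x y h m} → ¬ x ≈ y → Vanishes m (linear x P.* h) y → Vanishes m h y
  other-point {x} {y} {h} x≉y v zero    l<m = cancelˡ (x-y≉0 x≉y) (trans (*-congʳ (sym (eval-linear x y)))
    (trans (sym (Eval.ev-* y (linear x) h)) (v 0 l<m)))
  other-point {x} {y} {h} x≉y v (suc l) l<m = cancelˡ (x-y≉0 x≉y)
    (trans (sym (trans (eval-leibniz x h l y) (trans (+-congˡ (trans (*-congˡ
        (other-point {x} {y} {h} x≉y v l (ℕₚ.<-trans (ℕₚ.n<1+n l) l<m))) (zeroʳ _))) (+-identityʳ _))))
      (v (suc l) l<m))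

  private
    vanishes-cong : ∀ {m f g x} → f P.≈ g → Vanishes m f x → Vanishes m g x
    vanishes-cong {x = x} p v l l<m = trans (Eval.ev-cong x (P.sym (derⁿ-cong l p))) (v l l<m)

  -- Here h is f divided by m linear factors with root x, known only through what the count needs.
  -- If the degree bound runs out before m factors are found, then f = 0 and h = 0 serves.
  divideOut : ∀ x m N f → m ≤ p → Vanishes m f x → f ≺ N →
    ∃[ h ] h ≺ N ℕ.∸ m × (h P.≈ P.0# → f P.≈ P.0#) × (∀ {y k} → ¬ x ≈ y → Vanishes k f y → Vanishes k h y)
  divideOut x zero    N       f m≤p v b = f , b , (λ z → z) , λ _ w → w
  divideOut x (suc m) zero    f m≤p v b = P.0# , 0≺ 0 P.refl , (λ _ → ≺-0 b) , λ {y} {k} _ _ → zeroVanishes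
    where
    zeroDer : ∀ l → derⁿ l P.0# P.≈ P.0#
    zeroDer zero    = P.refl
    zeroDer (suc l) = der-cong (zeroDer l)
    zeroVanishes : ∀ {y k} → Vanishes k P.0# y
    zeroVanishes {y} l _ = Eval.ev-cong y (zeroDer l)
  divideOut x (suc m) (suc N) f m≤p v b =
    let (h , h≺ , back , others) = divideOut x m N (quotient f x) (ℕₚ.≤-trans (ℕₚ.n≤1+n m) m≤p)
          (same-point {x} {quotient f x} m≤p (vanishes-cong {suc m} {f} {linear x P.* quotient f x} {x} f≈ v)) (quotient-≺ f x b)
    in h , h≺ , (λ z → P.trans f≈ (P.trans (P.*-congˡ (back z)) (P.zeroʳ (linear x))))
         , λ {y} {k} x≉y w → others x≉y (other-point {x} {y} {quotient f x} x≉y (vanishes-cong {k} {f} {linear x P.* quotient f x} {y} f≈ w))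
    where
    f≈ : f P.≈ linear x P.* quotient f x
    f≈ = factor-root f x (v 0 (s≤s z≤n))

  multiple-roots-bound : ∀ xs m N f → m ≤ p → AllPairs (λ x y → ¬ x ≈ y) xs → All (Vanishes m f) xs →
    f ≺ N → N ≤ length xs ℕ.* m → f P.≈ P.0#
  multiple-roots-bound []       m N f m≤p _        _        b h = ≺-0 (≺-mono h b)
  multiple-roots-bound (x ∷ xs) m N f m≤p (d ∷ ds) (v ∷ vs) b h =
    let (g , g≺ , back , others) = divideOut x m N f m≤p v b
    in back (multiple-roots-bound xs m (N ℕ.∸ m) g m≤p ds (transfer {g} others d vs) g≺
         (ℕₚ.m≤n+o⇒m∸n≤o N m h))
    where
    transfer : ∀ {g} → (∀ {y k} → ¬ x ≈ y → Vanishes k f y → Vanishes k g y) →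
      ∀ {ys} → All (λ y → ¬ x ≈ y) ys → All (Vanishes m f) ys → All (Vanishes m g) ys
    transfer t []       []       = []
    transfer t (d ∷ ds) (v ∷ vs) = t d v ∷ transfer t ds vs

-- The auxiliary polynomial

module AuxiliaryPolynomial (F : Domain) (p : ℕ)
  (char : CharacteristicAtLeast p F)
  where
  R = Poly F
  open InnerDegree R
  open LinearAlgebra F
  open FormalDerivative F using (derivation; der; der-const; der-cong)
  open Flow R derivation using (D; D-cong; D-+; D-const*; coeff-D; coeff-∂ₛ; module AlongLine)
  open Multiplicities F p char
  module F = Domain F
  module DF = Degrees F
  module DR = Degrees R

  Dⁿ : ℕ → B.Carrier → B.Carrier
  Dⁿ zero    G = G
  Dⁿ (suc l) G = D (Dⁿ l G)

  Dⁿ-≺ : ∀ l {G e} → G DB.≺ e → Dⁿ l G DB.≺ l ℕ.+ e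
  Dⁿ-≺ zero    b = b
  Dⁿ-≺ (suc l) {G} {e} b = D-≺ (Dⁿ-≺ l b)
    where
    D-≺ : ∀ {H n} → H DB.≺ n → D H DB.≺ suc n
    D-≺ {H} {n} b = DB.below λ { (suc i) (s≤s n≤i) → S.trans (coeff-D H i) (S.trans
      (S.+-cong
        (PolyF.pointwise λ j → R.trans (coeff-∂ₛ (PS.coeff H (suc i)) j)
          (der-cong (PolyF.at (DB.vanish b (suc i) (ℕₚ.m≤n⇒m≤1+n n≤i)) j)))
        (S.-‿cong (FormalDerivative.der-cong R (DB.vanish b i n≤i))))
      (S.-‿inverseʳ S.0#)) }
      where module PolyF = Polynomial R

  at-point : F.Carrier × F.Carrier → Hom S.commutativeRing F.commutativeRing
  at-point (s , t) = Evaluation.evHom R (Evaluation.evHom F (idHom F.commutativeRing) s) t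

  -- All coefficients with respect to a vanish at (s, t), so the derivatives vanish there for every
  -- a at once, that is, on every dual line through (s, t).
  VanishesAt : ℕ → B.Carrier → F.Carrier × F.Carrier → Set
  VanishesAt m G P = ∀ l → l < m → ∀ i → Hom.⟦ at-point P ⟧ (PS.coeff (Dⁿ l G) i) F.≈ F.0#

  private
    ιR = DF.const
    ιS = λ c → DR.const (ιR c)
    ιB = λ c → DB.const (ιS c)
    algS = algebra S.commutativeRing ιS
    algB = algebra B.commutativeRing ιB

    D-linear : LinearMap algB algB D
    D-linear = record { cong′ = D-cong ; additive = D-+ ; homogeneous = λ c G → D-const* (der-const c) G }

    Dⁿ-linear : ∀ l → LinearMap algB algB (Dⁿ l)
    Dⁿ-linear zero    = record { cong′ = λ p → p ; additive = λ _ _ → B.refl ; homogeneous = λ _ _ → B.refl }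
    Dⁿ-linear (suc l) = _∘ᵐ_ {algB} {algB} {algB} D-linear (Dⁿ-linear l)

    at-point-linear : ∀ P → LinearMap algS scalars Hom.⟦ at-point P ⟧
    at-point-linear P@(s , t) = record
      { cong′ = Hom.cong φ
      ; additive = Hom.+-homo φ
      ; homogeneous = λ c w → F.trans (Hom.*-homo φ (ιS c) w) (F.*-congʳ (F.trans
          (Evaluation.ev-const R (Evaluation.evHom F (idHom F.commutativeRing) s) t (ιR c))
          (Evaluation.ev-const F (idHom F.commutativeRing) s c))) }
      where φ = at-point P

  -- On a dual line G has degree below 2 K in s. With K = r E, zeros of order 2 E at r points
  -- already amount to 2 K, which determines the order 2 E.
  record AuxiliaryFor (E K : ℕ) (points : List (F.Carrier × F.Carrier)) : Set where
    field
      G        : B.Carrier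
      G≉0      : ¬ G B.≈ B.0#
      G≺       : G DB.≺ E
      G≺ₜ      : G ≺ₜ K
      G≺ₛ      : ∀ i j → PR.coeff (PS.coeff G i) j DF.≺ K
      vanishes : All (VanishesAt (2 ℕ.* E) G) points

  -- Each point imposes at most (2 E)(3 E) conditions, since Dˡ G has degree below E + l ≤ 3 E in a.
  auxiliary : ∀ E K points → length points ℕ.* (2 ℕ.* E ℕ.* (3 ℕ.* E)) < E ℕ.* (K ℕ.* K) → AuxiliaryFor E K points
  auxiliary E K points enough = record
    { G = G u
    ; G≉0 = λ z → u≉0 (Parametrization.injective paramB u z)
    ; G≺ = polyParam-≺ S paramS E u
    ; G≺ₜ = belowₜ (polyParam-coeff S paramS {λ w → w DR.≺ K} (DR.0≺ K S.refl) (polyParam-≺ R paramR K) E u)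
    ; G≺ₛ = polyParam-coeff S paramS {λ w → ∀ j → PR.coeff w j DF.≺ K} (λ j → DF.0≺ K R.refl)
        (λ v → polyParam-coeff R paramR {λ x → x DF.≺ K} (DF.0≺ K R.refl) (polyParam-≺ F scalarParam K) K v) E u
    ; vanishes = All.tabulate λ {P} P∈ l l<m i → vanish-coeff P∈ l l<m i (i ℕₚ.<? 3 ℕ.* E)
    }
    where
    paramR = polyParametrization F scalarParam K
    paramS = polyParametrization R {ιR} paramR K
    paramB = polyParametrization S {ιS} paramS E
    M = E ℕ.* (K ℕ.* (K ℕ.* 1))

    G : Vec F.Carrier M → B.Carrier
    G = Parametrization.param paramB

    Condition : Set
    Condition = (F.Carrier × F.Carrier) × ℕ × ℕ

    conditions : List Condition
    conditions = cartesianProduct points (cartesianProduct (upTo (2 ℕ.* E)) (upTo (3 ℕ.* E)))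

    functional : Condition → Vec F.Carrier M → F.Carrier
    functional (P , l , i) u = Hom.⟦ at-point P ⟧ (PS.coeff (Dⁿ l (G u)) i)

    functional-linear : ∀ c → Linear scalars (functional c)
    functional-linear (P , l , i) = _∘ˡ_ {A = algS} (at-point-linear P)
      (_∘ˡ_ {A = algB} {B = algS} (coeffMap S ιS i) (_∘ˡ_ {A = algB} {B = algB} (Dⁿ-linear l) (Parametrization.linear paramB)))

    few : length conditions < M
    few = ≡.subst₂ _<_
      (≡.sym (≡.trans (length-cartesianProduct points _) (≡.cong (length points ℕ.*_)
        (≡.trans (length-cartesianProduct (upTo (2 ℕ.* E)) _) (≡.cong₂ ℕ._*_ (length-upTo (2 ℕ.* E)) (length-upTo (3 ℕ.* E)))))))
      (≡.cong (λ n → E ℕ.* (K ℕ.* n)) (≡.sym (ℕₚ.*-identityʳ K))) enough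

    solution = solveSystem Condition functional functional-linear conditions few
    u = proj₁ solution
    u≉0 = proj₁ (proj₂ solution)

    vanish-coeff : ∀ {P} → P ∈ points → ∀ l → l < 2 ℕ.* E → ∀ i → Dec (i < 3 ℕ.* E) → functional (P , l , i) u F.≈ F.0#
    vanish-coeff {P} P∈ l l<m i (yes i<) = All.lookup {P = λ c → functional c u F.≈ F.0#} (proj₂ (proj₂ solution)) {P , l , i}
      (∈-cartesianProduct⁺ P∈ (∈-cartesianProduct⁺ (∈-upTo⁺ l<m) (∈-upTo⁺ i<)))
    vanish-coeff {P} P∈ l l<m i (no i≮) = F.trans (Hom.cong (at-point P)
      (DB.vanish (Dⁿ-≺ l (polyParam-≺ S paramS E u)) i (ℕₚ.≤-trans (ℕₚ.≤-trans (ℕₚ.+-monoˡ-≤ E (ℕₚ.<⇒≤ l<m))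
        (ℕₚ.≤-reflexive (ℕₚ.+-comm (2 ℕ.* E) E))) (ℕₚ.≮⇒≥ i≮)))) (Hom.0-homo (at-point P))

  module OnLine {α τ : R.Carrier} (∂α : der α R.≈ R.0#) (∂τ : der τ R.≈ R.- α) (α≺ : α DF.≺ 1) (τ≺ : τ DF.≺ 2) where
    open AlongLine {α} {τ} ∂α ∂τ using (module ET; module EB; ev-D)
    module Evₛ s = Evaluation F (idHom F.commutativeRing) s

    derⁿ-ev : ∀ l G → derⁿ l (EB.ev G) R.≈ EB.ev (Dⁿ l G)
    derⁿ-ev zero    G = R.refl
    derⁿ-ev (suc l) G = R.trans (der-cong (derⁿ-ev l G)) (R.sym (ev-D (Dⁿ l G)))

    -- Since τ is linear in s and α is constant, the substitution adds the degree in t to the degree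
    -- in s, and both are below K.
    ev-≺ : ∀ {G K} → G ≺ₜ K → (∀ i j → PR.coeff (PS.coeff G i) j DF.≺ K) → EB.ev G DF.≺ K ℕ.+ K
    ev-≺ {G} {zero}  b c = DF.0≺ 0 (R.trans (EB.ev-cong (≺ₜ-0 b)) R.refl)
    ev-≺ {G} {suc K} b c = inA G (vanishₜ b) c
      where
      inT : ∀ w n → w DR.≺ n → (∀ j → PR.coeff w j DF.≺ suc K) → ET.ev w DF.≺ suc K ℕ.+ n
      inT []      n       b c = DF.0≺ _ R.refl
      inT (x ∷ w) zero    b c = DF.0≺ _ (ET.ev-0 (x ∷ w) (DR.≺-0 b))
      inT (x ∷ w) (suc n) b c = DF.≺-+ (DF.≺-mono (ℕₚ.m≤m+n (suc K) (suc n)) (c 0))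
        (≡.subst (τ R.* ET.ev w DF.≺_) (≡.cong suc (≡.sym (ℕₚ.+-suc K n)))
          (DF.≺-* τ≺ (inT w n (DR.≺-tail b) (λ j → c (suc j)))))
      inA : ∀ G → (∀ i → PS.coeff G i DR.≺ suc K) → (∀ i j → PR.coeff (PS.coeff G i) j DF.≺ suc K) → EB.ev G DF.≺ suc K ℕ.+ suc K
      inA []      b c = DF.0≺ _ R.refl
      inA (w ∷ G) b c = DF.≺-+ (inT w (suc K) (b 0) (c 0)) (DF.≺-* α≺ (inA G (λ i → b (suc i)) (λ i → c (suc i))))

    eval-ev : ∀ {s t} → Evₛ.ev s τ F.≈ t → ∀ G → (∀ i → Hom.⟦ at-point (s , t) ⟧ (PS.coeff G i) F.≈ F.0#) →
              Evₛ.ev s (EB.ev G) F.≈ F.0#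
    eval-ev {s} {t} τ≈t []      h = F.refl
    eval-ev {s} {t} τ≈t (w ∷ G) h = F.trans (Evₛ.ev-+ s (ET.ev w) _) (F.trans
      (F.+-cong (F.trans (inT w) (h 0)) (F.trans (Evₛ.ev-* s α (EB.ev G)) (F.trans (F.*-congˡ (eval-ev τ≈t G (λ i → h (suc i)))) (F.zeroʳ _))))
      (F.+-identityˡ _))
      where
      inT : ∀ w → Evₛ.ev s (ET.ev w) F.≈ Hom.⟦ at-point (s , t) ⟧ w
      inT []      = F.refl
      inT (x ∷ w) = F.trans (Evₛ.ev-+ s x _) (F.+-congˡ (F.trans (Evₛ.ev-* s τ (ET.ev w)) (F.*-cong τ≈t (inT w))))

    vanishes-on-line : ∀ {E K points} (A : AuxiliaryFor E K points) → 2 ℕ.* E ≤ p →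
      ∀ ss → AllPairs (λ s s′ → ¬ s F.≈ s′) ss → All (λ s → ∃[ t ] (s , t) ∈ points × Evₛ.ev s τ F.≈ t) ss →
      K ℕ.+ K ≤ length ss ℕ.* (2 ℕ.* E) → EB.ev (AuxiliaryFor.G A) R.≈ R.0#
    vanishes-on-line {E} {K} A 2E≤p ss distinct on enough =
      multiple-roots-bound ss (2 ℕ.* E) (K ℕ.+ K) (EB.ev G) 2E≤p distinct (All.map root on) (ev-≺ G≺ₜ G≺ₛ) enough
      where
      open AuxiliaryFor A
      root : ∀ {s} → (∃[ t ] (s , t) ∈ _ × Evₛ.ev s τ F.≈ t) → Vanishes (2 ℕ.* E) (EB.ev G) s
      root {s} (t , P∈ , τ≈t) l l<m = F.trans (Evₛ.ev-cong s (derⁿ-ev l G))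
        (eval-ev τ≈t (Dⁿ l G) (All.lookup vanishes P∈ l l<m))

-- The prime field, seen abstractly: its elements are the residues of 0, …, p - 1.
record PrimeFieldStructure (p : ℕ) (F : Domain) : Set where
  open Domain F
  field
    char              : CharacteristicAtLeast p F
    ⟨_⟩               : ℕ → Carrier
    residue-injective : ∀ {a b} → a < p → b < p → ⟨ a ⟩ ≈ ⟨ b ⟩ → a ≡ b
    residue           : Carrier → ℕ
    residue<p         : ∀ x → residue x < p
    residue-≈         : ∀ x → ⟨ residue x ⟩ ≈ x
    inverse           : ∀ x → ¬ x ≈ 0# → ∃[ y ] x * y ≈ 1#

  -- The line (s, t) is the graph of a ↦ s a + t.
  _∋_ : ℕ × ℕ → ℕ × ℕ → Set
  (s , t) ∋ (a , b) = ⟨ s ⟩ * ⟨ a ⟩ + ⟨ t ⟩ ≈ ⟨ b ⟩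

-- The field 𝔽ₚ as the integers modulo p

module PrimeFields where
  open import Defs using (Collinear)
  open import Data.Integer as ℤ using (ℤ; +_; _+_; _*_; -_; _-_; 0ℤ; 1ℤ)
  import Data.Integer.Properties as ℤₚ
  open import Data.Integer.Divisibility.Signed as Div using (_∣_; divides; _∣?_; ∣ᵤ⇒∣; ∣⇒∣ᵤ)
  open import Data.Integer.DivMod using (_%ℕ_; _/ℕ_; n%ℕd<d; a≡a%ℕn+[a/ℕn]*n)
  open import Data.Integer.Tactic.RingSolver using (solve-∀)
  open import Data.Nat using (NonZero; _∸_)
  import Data.Nat.Divisibility as ℕDiv
  open import Data.Nat.Coprimality using (coprime-Bézout; prime⇒coprime)
  open import Data.Nat.GCD using (module Bézout)
  open import Data.Nat.Primality using (Prime; euclidsLemma; prime⇒nonZero; prime⇒nonTrivial)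
  open import Relation.Binary.PropositionalEquality using (refl; cong; subst)

  module PrimeField (p : ℕ) (prime : Prime p) where
    instance
      p≢0 : NonZero p
      p≢0 = prime⇒nonZero prime

    p>1 : 1 < p
    p>1 = ℕ.nonTrivial⇒n>1 p {{prime⇒nonTrivial prime}}

    infix 4 _≈_ _≈?_
    -- Elements of 𝔽ₚ are integers up to congruence rather than reduced residues, so that the ring
    -- laws are inherited from ℤ.
    record _≈_ (x y : ℤ) : Set where
      constructor congruent
      field difference : + p ∣ x - y
    open _≈_

    private
      by : ∀ {x y z} → z ≡ x - y → + p ∣ z → x ≈ y
      by eq d = congruent (subst (+ p ∣_) eq d)

      transLaw : ∀ x y z → (x - y) + (y - z) ≡ x - z
      transLaw = solve-∀
      symLaw : ∀ x y → - (x - y) ≡ y - x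
      symLaw = solve-∀
      +Law : ∀ x y u v → (x - y) + (u - v) ≡ (x + u) - (y + v)
      +Law = solve-∀
      *Law : ∀ x y u v → (x - y) * u + y * (u - v) ≡ (x * u) - (y * v)
      *Law = solve-∀
      -Law : ∀ x y → - (x - y) ≡ (- x) - (- y)
      -Law = solve-∀
      reflLaw : ∀ x → 0ℤ ≡ x - x
      reflLaw = solve-∀

    ≈-refl : ∀ {x} → x ≈ x
    ≈-refl {x} = by (reflLaw x) (divides 0ℤ refl)

    ≈-reflexive : ∀ {x y} → x ≡ y → x ≈ y
    ≈-reflexive refl = ≈-refl

    fieldRing : CommutativeRing 0ℓ 0ℓ
    fieldRing = record
      { Carrier = ℤ ; _≈_ = _≈_ ; _+_ = _+_ ; _*_ = _*_ ; -_ = -_ ; 0# = 0ℤ ; 1# = 1ℤ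
      ; isCommutativeRing = record
        { isRing = record
          { +-isAbelianGroup = record
            { isGroup = record
              { isMonoid = record
                { isSemigroup = record
                  { isMagma = record
                    { isEquivalence = record
                      { refl = ≈-refl
                      ; sym = λ {x} {y} e → by (symLaw x y) (Div.∣m⇒∣-m (difference e))
                      ; trans = λ {x} {y} {z} d e → by (transLaw x y z) (Div.∣m∣n⇒∣m+n (difference d) (difference e)) }
                    ; ∙-cong = λ {x} {y} {u} {v} d e → by (+Law x y u v) (Div.∣m∣n⇒∣m+n (difference d) (difference e)) }
                  ; assoc = λ x y z → ≈-reflexive (ℤₚ.+-assoc x y z) }
                ; identity = (λ x → ≈-reflexive (ℤₚ.+-identityˡ x)) , λ x → ≈-reflexive (ℤₚ.+-identityʳ x) }
              ; inverse = (λ x → ≈-reflexive (ℤₚ.+-inverseˡ x)) , λ x → ≈-reflexive (ℤₚ.+-inverseʳ x)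
              ; ⁻¹-cong = λ {x} {y} e → by (-Law x y) (Div.∣m⇒∣-m (difference e)) }
            ; comm = λ x y → ≈-reflexive (ℤₚ.+-comm x y) }
          ; *-cong = λ {x} {y} {u} {v} d e → by (*Law x y u v)
              (Div.∣m∣n⇒∣m+n (Div.∣m⇒∣m*n u (difference d)) (Div.∣n⇒∣m*n y (difference e)))
          ; *-assoc = λ x y z → ≈-reflexive (ℤₚ.*-assoc x y z)
          ; *-identity = (λ x → ≈-reflexive (ℤₚ.*-identityˡ x)) , λ x → ≈-reflexive (ℤₚ.*-identityʳ x)
          ; distrib = (λ x y z → ≈-reflexive (ℤₚ.*-distribˡ-+ x y z)) , λ x y z → ≈-reflexive (ℤₚ.*-distribʳ-+ x y z) }
        ; *-comm = λ x y → ≈-reflexive (ℤₚ.*-comm x y) } }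

    _≈?_ : ∀ x y → Dec (x ≈ y)
    x ≈? y = Dec.map′ congruent difference (+ p ∣? x - y)

    private
      -0Law : ∀ x → x - 0ℤ ≡ x
      -0Law = solve-∀

    ≈0⇒∣ : ∀ {x} → x ≈ 0ℤ → p ℕDiv.∣ ℤ.∣ x ∣
    ≈0⇒∣ {x} e = subst (λ y → p ℕDiv.∣ ℤ.∣ y ∣) (-0Law x) (∣⇒∣ᵤ (difference e))

    ∣⇒≈0 : ∀ {x} → p ℕDiv.∣ ℤ.∣ x ∣ → x ≈ 0ℤ
    ∣⇒≈0 {x} d = by (≡.sym (-0Law x)) (∣ᵤ⇒∣ d)

    integral : ∀ {x y} → ¬ x ≈ 0ℤ → ¬ y ≈ 0ℤ → ¬ x * y ≈ 0ℤ
    integral {x} {y} x≉0 y≉0 e with euclidsLemma ℤ.∣ x ∣ ℤ.∣ y ∣ prime (subst (p ℕDiv.∣_) (ℤₚ.abs-* x y) (≈0⇒∣ e))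
    ... | inj₁ d = x≉0 (∣⇒≈0 d)
    ... | inj₂ d = y≉0 (∣⇒≈0 d)

    small-≈0 : ∀ {n} → n < p → + n ≈ 0ℤ → n ≡ 0
    small-≈0 {zero}  n<p e = refl
    small-≈0 {suc n} n<p e = ⊥-elim (ℕₚ.<⇒≱ n<p (ℕDiv.∣⇒≤ (≈0⇒∣ e)))

    F : Domain
    F = record
      { commutativeRing = fieldRing
      ; zero? = λ x → x ≈? 0ℤ
      ; nonzero-* = integral
      ; 1≉0 = λ e → ℕₚ.1+n≢0 (small-≈0 p>1 e) }

    module F = Domain F
    module DF = FormalDerivative F
    open DF using (_⋆_)

    ⋆≡* : ∀ n x → n ⋆ x ≡ + n * x
    ⋆≡* zero    x = refl
    ⋆≡* (suc n) x = ≡.trans (cong (λ y → x + y) (⋆≡* n x)) (≡.sym (ℤₚ.suc-* (+ n) x))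

    char : ∀ j x → suc j < p → suc j ⋆ x ≈ 0ℤ → x ≈ 0ℤ
    char j x j<p e = Degrees.cancelˡ F {+ suc j} (λ z → ℕₚ.1+n≢0 (small-≈0 j<p z))
      (F.trans (≈-reflexive (≡.sym (⋆≡* (suc j) x))) e)

    residue-injective : ∀ {a b} → a < p → b < p → + a ≈ + b → a ≡ b
    residue-injective {a} {b} a<p b<p e with ℕₚ.≤-total a b
    ... | inj₁ a≤b = ℕₚ.≤-antisym a≤b (ℕₚ.m∸n≡0⇒m≤n (small-≈0 (ℕₚ.≤-<-trans (ℕₚ.m∸n≤m b a) b<p)
            (F.trans (≈-reflexive (≡.sym (≡.trans (ℤₚ.m-n≡m⊖n b a) (ℤₚ.⊖-≥ a≤b)))) (by (diffLaw (+ b) (+ a)) (difference (F.sym e))))))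
      where
      diffLaw : ∀ x y → x - y ≡ (x - y) - 0ℤ
      diffLaw = solve-∀
    ... | inj₂ b≤a = ≡.sym (ℕₚ.≤-antisym b≤a (ℕₚ.m∸n≡0⇒m≤n (small-≈0 (ℕₚ.≤-<-trans (ℕₚ.m∸n≤m a b) a<p)
            (F.trans (≈-reflexive (≡.sym (≡.trans (ℤₚ.m-n≡m⊖n a b) (ℤₚ.⊖-≥ b≤a)))) (by (diffLaw (+ a) (+ b)) (difference e))))))
      where
      diffLaw : ∀ x y → x - y ≡ (x - y) - 0ℤ
      diffLaw = solve-∀

    residue : ℤ → ℕ
    residue x = x %ℕ p

    residue<p : ∀ x → residue x < p
    residue<p x = n%ℕd<d x p

    residue-≈ : ∀ x → + residue x ≈ x
    residue-≈ x = F.sym (by (≡.trans (mid (x /ℕ p) (+ residue x) (+ p)) (cong (_- + residue x) (≡.sym (a≡a%ℕn+[a/ℕn]*n x p)))) (divides (x /ℕ p) refl))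
      where
      mid : ∀ q r P → q * P ≡ (r + q * P) - r
      mid = solve-∀

    private
      inverse-residue : ∀ {n} → .{{NonZero n}} → n < p → ∃[ y ] + n * y ≈ 1ℤ
      inverse-residue {n} n<p with coprime-Bézout (prime⇒coprime prime n<p)
      ... | Bézout.+- x y eq = - (+ y) , by (law (+ x) (+ y) (+ n) (+ p) eq′) (divides (- (+ x)) refl)
        where
        eq′ : 1ℤ + + y * + n ≡ + x * + p
        eq′ = ≡.trans (cong (λ z → 1ℤ + z) (≡.sym (ℤₚ.pos-* y n))) (≡.trans (cong +_ eq) (ℤₚ.pos-* x p))
        law : ∀ x y n P → 1ℤ + y * n ≡ x * P → - x * P ≡ n * (- y) - 1ℤ
        law x y n P e = ≡.trans (neg x P) (≡.trans (cong -_ (≡.sym e)) (neg2 y n))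
          where
          neg : ∀ x P → - x * P ≡ - (x * P)
          neg = solve-∀
          neg2 : ∀ y n → - (1ℤ + y * n) ≡ n * (- y) - 1ℤ
          neg2 = solve-∀
      ... | Bézout.-+ x y eq = + y , by (law (+ x) (+ y) (+ n) (+ p) eq′) (divides (+ x) refl)
        where
        eq′ : 1ℤ + + x * + p ≡ + y * + n
        eq′ = ≡.trans (cong (λ z → 1ℤ + z) (≡.sym (ℤₚ.pos-* x p))) (≡.trans (cong +_ eq) (ℤₚ.pos-* y n))
        law : ∀ x y n P → 1ℤ + x * P ≡ y * n → x * P ≡ n * y - 1ℤ
        law x y n P e = ≡.trans (pre (x * P)) (≡.trans (cong (_- 1ℤ) e) (post y n))
          where
          pre : ∀ z → z ≡ (1ℤ + z) - 1ℤ
          pre = solve-∀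
          post : ∀ y n → y * n - 1ℤ ≡ n * y - 1ℤ
          post = solve-∀

    inverse : ∀ x → ¬ x ≈ 0ℤ → ∃[ y ] x * y ≈ 1ℤ
    inverse x x≉0 with residue x in eq
    ... | zero  = ⊥-elim (x≉0 (F.trans (F.sym (residue-≈ x)) (≈-reflexive (cong +_ eq))))
    ... | suc n = let (y , e) = inverse-residue {suc n} (subst (_< p) eq (residue<p x)) in
      y , F.trans (F.*-congʳ {y} (F.trans (F.sym (residue-≈ x)) (≈-reflexive (cong +_ eq)))) e

    structure : PrimeFieldStructure p F
    structure = record
      { char = char ; ⟨_⟩ = +_ ; residue-injective = residue-injective
      ; residue = residue ; residue<p = residue<p ; residue-≈ = residue-≈ ; inverse = inverse }

    private
      abs-dist : ∀ m n → ℤ.∣ + m - + n ∣ ≡ ℕ.∣ m - n ∣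
      abs-dist m n = ≡.trans (cong ℤ.∣_∣ (ℤₚ.m-n≡m⊖n m n)) (go (ℕₚ.≤-total m n))
        where
        go : m ≤ n ⊎ n ≤ m → ℤ.∣ m ℤ.⊖ n ∣ ≡ ℕ.∣ m - n ∣
        go (inj₁ m≤n) = ≡.trans (ℤₚ.∣⊖∣-≤ m≤n) (≡.sym (ℕₚ.m≤n⇒∣m-n∣≡n∸m m≤n))
        go (inj₂ n≤m) = ≡.trans (ℤₚ.∣m⊖n∣≡∣n⊖m∣ m n) (≡.trans (ℤₚ.∣⊖∣-≤ n≤m) (≡.sym (ℕₚ.m≤n⇒∣n-m∣≡n∸m n≤m)))

    ∣dist⇒≈ : ∀ m n → p ℕDiv.∣ ℕ.∣ m - n ∣ → + m ≈ + n
    ∣dist⇒≈ m n d = congruent (∣ᵤ⇒∣ (subst (p ℕDiv.∣_) (≡.sym (abs-dist m n)) d))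

    ≈⇒∣dist : ∀ m n → + m ≈ + n → p ℕDiv.∣ ℕ.∣ m - n ∣
    ≈⇒∣dist m n e = subst (p ℕDiv.∣_) (abs-dist m n) (∣⇒∣ᵤ (difference e))

    shifted-difference : ∀ {a} b → a < p → + (b ℕ.+ p ∸ a) ≈ + b - + a
    shifted-difference {a} b a<p = by (≡.trans (law (+ b) (+ a) (+ p)) (cong (_- (+ b - + a)) (≡.sym eq))) (divides 1ℤ refl)
      where
      a≤ : a ≤ b ℕ.+ p
      a≤ = ℕₚ.≤-trans (ℕₚ.<⇒≤ a<p) (ℕₚ.m≤n+m p b)
      eq : + (b ℕ.+ p ∸ a) ≡ (+ b + + p) - + a
      eq = ≡.trans (≡.sym (≡.trans (ℤₚ.m-n≡m⊖n (b ℕ.+ p) a) (ℤₚ.⊖-≥ a≤))) (cong (_- + a) (ℤₚ.pos-+ b p))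
      law : ∀ b a P → 1ℤ * P ≡ ((b + P) - a) - (b - a)
      law = solve-∀

    CollinearF : ℤ → ℤ → ℤ → ℤ → ℤ → ℤ → Set
    CollinearF a a′ b b′ c c′ = (b - a) * (c′ - a′) ≈ (c - a) * (b′ - a′)

    module _ {a a′ : ℕ} (b b′ c c′ : ℕ) (a<p : a < p) (a′<p : a′ < p) where
      private
        X = (b ℕ.+ p ∸ a) ℕ.* (c′ ℕ.+ p ∸ a′)
        Y = (c ℕ.+ p ∸ a) ℕ.* (b′ ℕ.+ p ∸ a′)
        X≈ : + X ≈ (+ b - + a) * (+ c′ - + a′)
        X≈ = F.trans (≈-reflexive (ℤₚ.pos-* (b ℕ.+ p ∸ a) _)) (F.*-cong (shifted-difference b a<p) (shifted-difference c′ a′<p))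
        Y≈ : + Y ≈ (+ c - + a) * (+ b′ - + a′)
        Y≈ = F.trans (≈-reflexive (ℤₚ.pos-* (c ℕ.+ p ∸ a) _)) (F.*-cong (shifted-difference c a<p) (shifted-difference b′ a′<p))

      collinear⇒ : Collinear p a a′ b b′ c c′ → CollinearF (+ a) (+ a′) (+ b) (+ b′) (+ c) (+ c′)
      collinear⇒ h = F.trans (F.sym X≈) (F.trans (∣dist⇒≈ X Y h) Y≈)

      collinear⇐ : CollinearF (+ a) (+ a′) (+ b) (+ b′) (+ c) (+ c′) → Collinear p a a′ b b′ c c′
      collinear⇐ h = ≈⇒∣dist X Y (F.trans X≈ (F.trans h (F.sym Y≈)))

-- Lines through popular points

AllPairs-map-∈ : ∀ {A : Set} {P Q : A → A → Set} {xs : List A} →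
  (∀ {x y} → x ∈ xs → y ∈ xs → P x y → Q x y) → AllPairs P xs → AllPairs Q xs
AllPairs-map-∈ h []       = []
AllPairs-map-∈ h (p ∷ ps) = All.tabulate (λ y∈ → h (here ≡.refl) (there y∈) (All.lookup p y∈)) ∷
                            AllPairs-map-∈ (λ x∈ y∈ → h (there x∈) (there y∈)) ps

module GridLines (F : Domain) (p : ℕ) (𝔽 : PrimeFieldStructure p F)
  (xs : List ℕ) (xs-unique : Unique xs) (xs<p : ∀ {a} → a ∈ xs → a < p) where
  open PrimeFieldStructure 𝔽
  module F = Domain F
  open F using (_≈_; _+_; _*_; -_; 0#)
  open import Algebra.Properties.Ring F.ring using (-‿involutive; -0#≈0#; -‿distribʳ-*)
  open import Algebra.Properties.Group F.+-group using (∙-cancelˡ)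
  R = Poly F
  module R = Domain R
  module PF = Polynomial F
  module DF′ = Degrees F
  open FormalDerivative F using (derivation; der; der-const; coeff-der)

  _∋?_ : ∀ ℓ P → Dec (ℓ ∋ P)
  (s , t) ∋? (a , b) = Dec.map′ (to s t a b) (from s t a b) (F.zero? ((⟨ s ⟩ * ⟨ a ⟩ + ⟨ t ⟩) + - ⟨ b ⟩))
    where
    to : ∀ s t a b → (⟨ s ⟩ * ⟨ a ⟩ + ⟨ t ⟩) + - ⟨ b ⟩ ≈ 0# → ⟨ s ⟩ * ⟨ a ⟩ + ⟨ t ⟩ ≈ ⟨ b ⟩
    to s t a b z = F.trans (F.sym (F.+-identityʳ _)) (F.trans (F.+-congˡ (F.sym (F.-‿inverseˡ ⟨ b ⟩)))
      (F.trans (F.sym (F.+-assoc _ _ _)) (F.trans (F.+-congʳ z) (F.+-identityˡ _))))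
    from : ∀ s t a b → ⟨ s ⟩ * ⟨ a ⟩ + ⟨ t ⟩ ≈ ⟨ b ⟩ → (⟨ s ⟩ * ⟨ a ⟩ + ⟨ t ⟩) + - ⟨ b ⟩ ≈ 0#
    from s t a b e = F.trans (F.+-congʳ e) (F.-‿inverseʳ _)

  α : ℕ → R.Carrier
  α a = DF′.const ⟨ a ⟩

  -- The polynomial b - a s in s; the lines (s, t) through (a, b) are the points of its graph.
  τ : ℕ → ℕ → R.Carrier
  τ a b = ⟨ b ⟩ ∷ - ⟨ a ⟩ ∷ []

  private
    α-constant : ∀ a → der (α a) R.≈ R.0#
    α-constant a = der-const ⟨ a ⟩

    τ-line : ∀ a b → der (τ a b) R.≈ R.- α a
    τ-line a b = PF.pointwise λ
      { zero    → F.trans (coeff-der (τ a b) 0) (F.trans (F.+-identityʳ _) (F.sym (PF.coeff-neg (α a) 0)))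
      ; (suc j) → F.trans (coeff-der (τ a b) (suc j)) (F.trans (FormalDerivative.⋆-zero F (suc (suc j))) (F.sym (F.trans (PF.coeff-neg (α a) (suc j)) -0#≈0#))) }

    τ-injective : ∀ {a b a′ b′} → a < p → b < p → a′ < p → b′ < p → τ a b R.≈ τ a′ b′ → (a , b) ≡ (a′ , b′)
    τ-injective {a} {b} {a′} {b′} a<p b<p a′<p b′<p e = ≡.cong₂ _,_
      (residue-injective a<p a′<p (F.trans (F.sym (-‿involutive ⟨ a ⟩))
        (F.trans (F.-‿cong (PF.at e 1)) (-‿involutive ⟨ a′ ⟩))))
      (residue-injective b<p b′<p (PF.at e 0))

    α-distinct : AllPairs (λ a a′ → ¬ α a R.≈ α a′) xs
    α-distinct = AllPairs-map-∈ (λ x∈ y∈ ne e → ne (residue-injective (xs<p x∈) (xs<p y∈) (PF.at e 0))) xs-unique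

    τ-distinct : AllPairs (λ P Q → ¬ uncurry τ P R.≈ uncurry τ Q) (cartesianProduct xs xs)
    τ-distinct = AllPairs-map-∈
      (λ {P} {Q} P∈ Q∈ ne e → let (a∈ , b∈) = ∈-cartesianProduct⁻ xs xs P∈ ; (a′∈ , b′∈) = ∈-cartesianProduct⁻ xs xs Q∈
        in ne (τ-injective (xs<p a∈) (xs<p b∈) (xs<p a′∈) (xs<p b′∈) e))
      (Uniqueₚ.cartesianProduct⁺ xs-unique xs-unique)

    τ-distinct₂ : ∀ a → AllPairs (λ b b′ → ¬ τ a b R.≈ τ a b′) xs
    τ-distinct₂ a = AllPairs-map-∈ (λ x∈ y∈ ne e → ne (residue-injective (xs<p x∈) (xs<p y∈) (PF.at e 0))) xs-unique

  private
    char-Poly : CharacteristicAtLeast p R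
    char-Poly j f j<p e = PF.pointwise λ i → char j _ j<p (F.trans (F.sym (coeff-⋆ (suc j) i)) (PF.at e i))
      where
      coeff-⋆ : ∀ n i → PF.coeff (FormalDerivative._⋆_ R n f) i ≈ FormalDerivative._⋆_ F n (PF.coeff f i)
      coeff-⋆ zero    i = F.refl
      coeff-⋆ (suc n) i = F.trans (PF.coeff-add f _ i) (F.+-congˡ (coeff-⋆ n i))

  open GridZeros R derivation xs α τ α-constant τ-line α-distinct τ-distinct τ-distinct₂ p char-Poly
    using (Z; Z≡∑; zeros≤; zero-at?; toPoint; module At)
  open AuxiliaryPolynomial F p char using (module AuxiliaryFor; auxiliary; module OnLine)
  open InnerDegree R using (module DB; hasTDegree; tdegree-<)
  module B = Domain (Poly (Poly R))

  private
    n = length xs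

  count : List (ℕ × ℕ) → ℕ × ℕ → ℕ
  count lines P = ∑ lines (λ ℓ → 𝟙 (ℓ ∋? P))

  -- A point on at least r of the lines gives a zero of the auxiliary polynomial built for these
  -- lines with K = r E. Such zeros are counted by `zeroBound` with e < E and k < r E, and r E ≤ p
  -- ensures k < p there.
  popular-bound : ∀ (lines : List (ℕ × ℕ)) → Unique lines → (∀ {s t} → (s , t) ∈ lines → s < p × t < p) →
    ∀ E r → 2 ℕ.* E ≤ p → r ℕ.* E ≤ p →
    length lines ℕ.* (2 ℕ.* E ℕ.* (3 ℕ.* E)) < E ℕ.* (r ℕ.* E ℕ.* (r ℕ.* E)) →
    ∑ (cartesianProduct xs xs) (λ P → 𝟙 (r ℕₚ.≤? count lines P)) ≤ 2 ℕ.* E ℕ.* (r ℕ.* E) ℕ.+ 2 ℕ.* E ℕ.* n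
  popular-bound lines unique small E r 2E≤p rE≤p enough = ℕₚ.≤-trans
      (∑-mono-∈ (cartesianProduct xs xs) (λ {P} P∈ → 𝟙-mono (r ℕₚ.≤? count lines P) (zero-at? G (toPoint P)) (on-popular P P∈)))
      (ℕₚ.≤-trans (ℕₚ.≤-reflexive (≡.sym (≡.trans (Z≡∑ G) (∑-map toPoint (cartesianProduct xs xs) _))))
      (ℕₚ.≤-trans (zeros≤ (suc (e ℕ.+ k)) ℕₚ.≤-refl degG tdegG (ℕₚ.≤-trans k<rE rE≤p)) bound-mono))
    where
    K = r ℕ.* E
    toF : ℕ × ℕ → F.Carrier × F.Carrier
    toF (s , t) = ⟨ s ⟩ , ⟨ t ⟩
    A = auxiliary E K (List.map toF lines)
      (≡.subst (λ l → l ℕ.* (2 ℕ.* E ℕ.* (3 ℕ.* E)) < E ℕ.* (K ℕ.* K)) (≡.sym (length-map toF lines)) enough)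
    open AuxiliaryFor A using (G; G≉0; G≺; G≺ₜ)
    e = proj₁ (DB.hasDegree G≉0)
    degG = proj₂ (DB.hasDegree G≉0)
    k = proj₁ (hasTDegree G≉0)
    tdegG = proj₂ (hasTDegree G≉0)
    e<E : e < E
    e<E = DB.degree-< degG G≺
    k<rE : k < K
    k<rE = tdegree-< tdegG G≺ₜ
    bound-mono : zeroBound n e k ≤ 2 ℕ.* E ℕ.* K ℕ.+ 2 ℕ.* E ℕ.* n
    bound-mono = ℕₚ.+-mono-≤
      (ℕₚ.*-mono-≤ (ℕₚ.≤-trans (ℕₚ.n≤1+n _) (ℕₚ.≤-trans (ℕₚ.≤-reflexive (≡.sym (ℕₚ.*-suc 2 e))) (ℕₚ.*-monoʳ-≤ 2 e<E))) (ℕₚ.<⇒≤ k<rE))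
      (ℕₚ.*-monoˡ-≤ n (ℕₚ.*-monoʳ-≤ 2 (ℕₚ.<⇒≤ e<E)))

    on-popular : ∀ P → P ∈ cartesianProduct xs xs → r ≤ count lines P → At.ev (toPoint P) G R.≈ R.0#
    on-popular P@(a , b) P∈ many = OnLine.vanishes-on-line {α a} {τ a b} (α-constant a) (τ-line a b)
        (DF′.≺-length (α a)) (DF′.≺-length (τ a b)) A 2E≤p ss ss-distinct ss-on
        (ℕₚ.≤-trans (ℕₚ.≤-reflexive twice) (ℕₚ.*-monoˡ-≤ (2 ℕ.* E) (ℕₚ.≤-trans many (ℕₚ.≤-reflexive (≡.sym len)))))
      where
      through = filter (λ ℓ → ℓ ∋? P) lines
      ss = List.map (λ ℓ → ⟨ proj₁ ℓ ⟩) through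
      len : length ss ≡ count lines P
      len = ≡.trans (length-map _ through) (length-filter≡∑ (λ ℓ → ℓ ∋? P) lines)
      twice : K ℕ.+ K ≡ r ℕ.* (2 ℕ.* E)
      twice = solve 2 (λ r E → r :* E :+ r :* E := r :* (con 2 :* E)) ≡.refl r E
        where
        open +-*-Solver
      in-through : ∀ {ℓ} → ℓ ∈ through → ℓ ∈ lines × ℓ ∋ P
      in-through = ∈-filter⁻ (λ ℓ → ℓ ∋? P) {xs = lines}
      -- Through the fixed point P the slope determines the line, so distinct lines yield distinct
      -- places s on the dual line of P.
      ss-distinct : AllPairs (λ s s′ → ¬ s ≈ s′) ss
      ss-distinct = APₚ.map⁺ (AllPairs-map-∈ sep (APₚ.filter⁺ (λ ℓ → ℓ ∋? P) unique))
        where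
        sep : ∀ {ℓ ℓ′} → ℓ ∈ through → ℓ′ ∈ through → ℓ ≢ ℓ′ → ¬ ⟨ proj₁ ℓ ⟩ ≈ ⟨ proj₁ ℓ′ ⟩
        sep {s , t} {s′ , t′} ℓ∈ ℓ′∈ ne e = ne (≡.cong₂ _,_ s≡s′ (residue-injective (proj₂ (small (proj₁ (in-through ℓ∈)))) (proj₂ (small (proj₁ (in-through ℓ′∈)))) t≈t′))
          where
          s≡s′ : s ≡ s′
          s≡s′ = residue-injective (proj₁ (small (proj₁ (in-through ℓ∈)))) (proj₁ (small (proj₁ (in-through ℓ′∈)))) e
          t≈t′ : ⟨ t ⟩ ≈ ⟨ t′ ⟩
          t≈t′ = ∙-cancelˡ (⟨ s ⟩ * ⟨ a ⟩) ⟨ t ⟩ ⟨ t′ ⟩ (F.trans (proj₂ (in-through ℓ∈)) (F.trans (F.sym (proj₂ (in-through ℓ′∈)))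
            (F.reflexive (≡.cong (λ u → ⟨ u ⟩ * ⟨ a ⟩ + ⟨ t′ ⟩) (≡.sym s≡s′)))))
      ss-on : All (λ s → ∃[ t ] (s , t) ∈ List.map toF lines × OnLine.Evₛ.ev {α a} {τ a b} (α-constant a) (τ-line a b) (DF′.≺-length (α a)) (DF′.≺-length (τ a b)) s (τ a b) ≈ t) ss
      ss-on = Allₚ.map⁺ (All.tabulate λ {ℓ} ℓ∈ → ⟨ proj₂ ℓ ⟩ , ∈-map⁺ toF (proj₁ (in-through ℓ∈)) , on ℓ (proj₂ (in-through ℓ∈)))
        where
        on : ∀ ℓ → ℓ ∋ P → ⟨ b ⟩ + ⟨ proj₁ ℓ ⟩ * (- ⟨ a ⟩ + ⟨ proj₁ ℓ ⟩ * 0#) ≈ ⟨ proj₂ ℓ ⟩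
        on (s , t) h = F.trans (F.+-cong (F.sym h) (F.trans (F.*-congˡ (F.trans (F.+-congˡ (F.zeroʳ _)) (F.+-identityʳ _))) (F.sym (-‿distribʳ-* _ _))))
          (F.trans (F.+-congʳ (F.+-comm _ _)) (F.trans (F.+-assoc _ _ _) (F.trans (F.+-congˡ (F.-‿inverseʳ _)) (F.+-identityʳ _))))

-- Collinear triples and lines

∑-unique : ∀ {A : Set} {xs : List A} {f x} → Unique xs → x ∈ xs → (∀ {y} → y ∈ xs → y ≢ x → f y ≡ 0) → ∑ xs f ≡ f x
∑-unique {xs = y ∷ xs} {f} (d ∷ ds) (here ≡.refl) h = ≡.trans (≡.cong (f y ℕ.+_)
  (≡.trans (∑-cong-∈ xs λ z∈ → h (there z∈) (λ z≡y → All.lookup d z∈ (≡.sym z≡y))) (∑-0 xs))) (ℕₚ.+-identityʳ (f y))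
∑-unique {xs = y ∷ xs} {f} (d ∷ ds) (there x∈) h =
  ≡.trans (≡.cong (ℕ._+ ∑ xs f) (h (here ≡.refl) (All.lookup d x∈))) (∑-unique ds x∈ (h ∘ there))

∑-𝟙-≤1 : ∀ {A : Set} {xs : List A} {P : A → Set} (P? : ∀ x → Dec (P x)) → Unique xs →
  (∀ {x y} → x ∈ xs → y ∈ xs → P x → P y → x ≡ y) → ∑ xs (𝟙 ∘ P?) ≤ 1
∑-𝟙-≤1 {xs = []}     P? _        h = z≤n
∑-𝟙-≤1 {xs = x ∷ xs} {P} P? (d ∷ ds) h = go (P? x)
  where
  go : (q : Dec (P x)) → 𝟙 q ℕ.+ ∑ xs (𝟙 ∘ P?) ≤ 1
  go (no _)  = ∑-𝟙-≤1 P? ds (λ y∈ z∈ → h (there y∈) (there z∈))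
  go (yes p) = s≤s (ℕₚ.≤-reflexive (≡.trans (∑-cong-∈ xs λ {y} y∈ → 𝟙-no (P? y) (λ q → All.lookup d y∈ (h (here ≡.refl) (there y∈) p q))) (∑-0 xs)))

module LineSums (F : Domain) (p : ℕ) (𝔽 : PrimeFieldStructure p F)
  (_∋_ : ℕ × ℕ → ℕ × ℕ → Set) (_∋?_ : ∀ ℓ P → Dec (ℓ ∋ P))
  (∋⇒ : ∀ {s t a b} → (s , t) ∋ (a , b) → PrimeFieldStructure._∋_ 𝔽 (s , t) (a , b))
  (∋⇐ : ∀ {s t a b} → PrimeFieldStructure._∋_ 𝔽 (s , t) (a , b) → (s , t) ∋ (a , b))
  (xs : List ℕ) (xs-unique : Unique xs) (xs<p : ∀ {a} → a ∈ xs → a < p)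
  where
  open PrimeFieldStructure 𝔽 hiding (_∋_)
  open Domain F
  open import Algebra.Properties.Ring ring using (-‿distribʳ-*; -‿involutive; -‿+-comm)
  open import Algebra.Properties.Group +-group using (∙-cancelˡ)

  n = length xs

  pts lines : List (ℕ × ℕ)
  pts   = cartesianProduct xs xs
  lines = cartesianProduct (upTo p) (upTo p)

  private
    pts-unique : Unique pts
    pts-unique = Uniqueₚ.cartesianProduct⁺ xs-unique xs-unique

    pts<p : ∀ {a b} → (a , b) ∈ pts → a < p × b < p
    pts<p P∈ = let (a∈ , b∈) = ∈-cartesianProduct⁻ xs xs P∈ in xs<p a∈ , xs<p b∈

  lines-unique : Unique lines
  lines-unique = Uniqueₚ.cartesianProduct⁺ (Uniqueₚ.upTo⁺ p) (Uniqueₚ.upTo⁺ p)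

  lines<p : ∀ {s t} → (s , t) ∈ lines → s < p × t < p
  lines<p ℓ∈ = let (s∈ , t∈) = ∈-cartesianProduct⁻ (upTo p) (upTo p) ℓ∈ in ∈-upTo⁻ s∈ , ∈-upTo⁻ t∈

  private
    ∈-lines : ∀ x y → (residue x , residue y) ∈ lines
    ∈-lines x y = ∈-cartesianProduct⁺ (∈-upTo⁺ (residue<p x)) (∈-upTo⁺ (residue<p y))

    move : ∀ {x y z} → x + y ≈ z → y ≈ z + - x
    move {x} {y} e = trans (trans (sym (+-identityʳ y)) (trans (+-congˡ (sym (-‿inverseʳ x))) (trans (sym (+-assoc _ _ _)) (+-congʳ (+-comm y x))))) (+-congʳ e)

    unmove : ∀ {x y z} → y ≈ z + - x → x + y ≈ z
    unmove {x} {y} {z} e = trans (+-congˡ e) (trans (+-comm x _) (trans (+-assoc _ _ _) (trans (+-congˡ (-‿inverseˡ x)) (+-identityʳ z))))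

    diff≉0 : ∀ {a b} → a < p → b < p → a ≢ b → ¬ ⟨ b ⟩ + - ⟨ a ⟩ ≈ 0#
    diff≉0 a<p b<p ne = Degrees.x-y≉0 F (ne ∘ residue-injective a<p b<p)

    slope : ∀ {s t a b a′ b′} → (s , t) ∋ (a , b) → (s , t) ∋ (a′ , b′) →
            ⟨ s ⟩ * (⟨ a′ ⟩ + - ⟨ a ⟩) ≈ ⟨ b′ ⟩ + - ⟨ b ⟩
    slope {s} {t} {a} {b} {a′} {b′} h h′ = trans (distribˡ _ _ _) (trans (+-congˡ (sym (-‿distribʳ-* ⟨ s ⟩ ⟨ a ⟩))) (trans
      (+-cong (trans (move (trans (+-comm _ _) (∋⇒ h′))) refl) (-‿cong (move (trans (+-comm _ _) (∋⇒ h)))))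
      (trans (+-congˡ (trans (sym (-‿+-comm _ _)) (+-congˡ (-‿involutive ⟨ t ⟩))))
      (trans (+-assoc _ _ _) (+-congˡ (trans (+-comm _ _) (trans (+-assoc _ _ _) (trans (+-congˡ (-‿inverseʳ ⟨ t ⟩)) (+-identityʳ _)))))))))

  same-slope : ∀ {s t t′ a b} → t < p → t′ < p → (s , t) ∋ (a , b) → (s , t′) ∋ (a , b) → t ≡ t′
  same-slope t<p t′<p h h′ = residue-injective t<p t′<p (∙-cancelˡ _ _ _ (trans (∋⇒ h) (sym (∋⇒ h′))))

  same-line : ∀ {ℓ ℓ′ a b a′ b′} → ℓ ∈ lines → ℓ′ ∈ lines → a < p → a′ < p → a ≢ a′ →
    ℓ ∋ (a , b) → ℓ ∋ (a′ , b′) → ℓ′ ∋ (a , b) → ℓ′ ∋ (a′ , b′) → ℓ ≡ ℓ′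
  same-line {s , t} {s′ , t′} {a} {b} {a′} {b′} ℓ∈ ℓ′∈ a<p a′<p ne h₁ h₂ h₃ h₄ with residue-injective {s} {s′} (proj₁ (lines<p ℓ∈)) (proj₁ (lines<p ℓ′∈)) slopes
    where
    Δ≉0 = diff≉0 a<p a′<p ne
    slopes : ⟨ s ⟩ ≈ ⟨ s′ ⟩
    slopes = let (y , e) = inverse _ Δ≉0 in
      trans (sym (trans (*-assoc _ _ _) (trans (*-congˡ e) (*-identityʳ _))))
        (trans (*-congʳ (trans (slope h₁ h₂) (sym (slope h₃ h₄)))) (trans (*-assoc _ _ _) (trans (*-congˡ e) (*-identityʳ _))))
  ... | ≡.refl = ≡.cong (s ,_) (same-slope (proj₂ (lines<p ℓ∈)) (proj₂ (lines<p ℓ′∈)) h₁ h₃)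

  same-point : ∀ {ℓ a b b′} → b < p → b′ < p → ℓ ∋ (a , b) → ℓ ∋ (a , b′) → b ≡ b′
  same-point b<p b′<p h h′ = residue-injective b<p b′<p (trans (sym (∋⇒ h)) (∋⇒ h′))

  line-through : ∀ {a b a′ b′} → a < p → a′ < p → a ≢ a′ → ∃[ ℓ ] ℓ ∈ lines × ℓ ∋ (a , b) × ℓ ∋ (a′ , b′)
  line-through {a} {b} {a′} {b′} a<p a′<p ne = (residue σ , residue θ) , ∈-lines σ θ , ∋⇐ on₁ , ∋⇐ on₂
    where
    Δ = ⟨ a′ ⟩ + - ⟨ a ⟩
    y = proj₁ (inverse Δ (diff≉0 a<p a′<p ne))
    Δy = proj₂ (inverse Δ (diff≉0 a<p a′<p ne))
    σ = (⟨ b′ ⟩ + - ⟨ b ⟩) * y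
    θ = ⟨ b ⟩ + - (σ * ⟨ a ⟩)
    on₁ : ⟨ residue σ ⟩ * ⟨ a ⟩ + ⟨ residue θ ⟩ ≈ ⟨ b ⟩
    on₁ = unmove (trans (residue-≈ θ) (+-congˡ (-‿cong (*-congʳ (sym (residue-≈ σ))))))
    σΔ : σ * Δ ≈ ⟨ b′ ⟩ + - ⟨ b ⟩
    σΔ = trans (*-assoc _ _ _) (trans (*-congˡ (trans (*-comm y Δ) Δy)) (*-identityʳ _))
    on₂ : ⟨ residue σ ⟩ * ⟨ a′ ⟩ + ⟨ residue θ ⟩ ≈ ⟨ b′ ⟩
    on₂ = trans (+-congʳ (trans (*-congˡ (sym (unmove {⟨ a ⟩} refl))) (distribˡ _ _ _)))
      (trans (+-congʳ (+-comm _ _)) (trans (+-assoc _ _ _) (trans (+-cong (trans (*-congʳ (residue-≈ σ)) σΔ) on₁)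
        (trans (+-assoc _ _ _) (trans (+-congˡ (-‿inverseˡ _)) (+-identityʳ _))))))

  i : ℕ × ℕ → ℕ
  i ℓ = ∑ pts (λ P → 𝟙 (ℓ ∋? P))

  lines-through-point : ∀ P → ∑ lines (λ ℓ → 𝟙 (ℓ ∋? P)) ≡ p
  lines-through-point (a , b) = ≡.trans (∑-cartesianProduct (upTo p) (upTo p) _)
    (≡.trans (∑-cong (upTo p) one) (≡.trans (∑-const (upTo p) 1) (≡.trans (ℕₚ.*-identityʳ _) (length-upTo p))))
    where
    one : ∀ s → ∑ (upTo p) (λ t → 𝟙 ((s , t) ∋? (a , b))) ≡ 1
    one s = ≡.trans (∑-unique (Uniqueₚ.upTo⁺ p) (∈-upTo⁺ (residue<p θ))
        (λ {t} t∈ ne → 𝟙-no ((s , t) ∋? (a , b)) λ h → ne (same-slope (∈-upTo⁻ t∈) (residue<p θ) h on)))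
        (𝟙-yes ((s , residue θ) ∋? (a , b)) on)
      where
      θ = ⟨ b ⟩ + - (⟨ s ⟩ * ⟨ a ⟩)
      on : (s , residue θ) ∋ (a , b)
      on = ∋⇐ (unmove (residue-≈ θ))

  ∑i : ∑ lines i ≡ p ℕ.* (n ℕ.* n)
  ∑i = ≡.trans (∑-swap lines pts (λ ℓ P → 𝟙 (ℓ ∋? P))) (≡.trans (∑-cong pts lines-through-point)
    (≡.trans (∑-const pts p) (≡.trans (≡.cong (ℕ._* p) (length-cartesianProduct xs xs)) (ℕₚ.*-comm _ p))))

  i≤n : ∀ ℓ → i ℓ ≤ n
  i≤n ℓ = ℕₚ.≤-trans (ℕₚ.≤-reflexive (∑-cartesianProduct xs xs _)) (ℕₚ.≤-trans
    (∑-≤-const xs 1 (λ a → ∑-𝟙-≤1 (λ b → ℓ ∋? (a , b)) xs-unique λ b∈ b′∈ → same-point (xs<p b∈) (xs<p b′∈)))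
    (ℕₚ.≤-reflexive (ℕₚ.*-identityʳ n)))

  distinct? : ∀ (P Q : ℕ × ℕ) → Dec (proj₁ P ≢ proj₁ Q)
  distinct? P Q = Dec.¬? (proj₁ P ℕₚ.≟ proj₁ Q)

  𝟙-split : ∀ (P Q : ℕ × ℕ) → 𝟙 (distinct? P Q) ℕ.+ 𝟙 (proj₁ P ℕₚ.≟ proj₁ Q) ≡ 1
  𝟙-split P Q with proj₁ P ℕₚ.≟ proj₁ Q
  ... | yes _ = ≡.refl
  ... | no  _ = ≡.refl

  on-both : ℕ × ℕ → ℕ × ℕ → ℕ × ℕ → ℕ
  on-both ℓ P Q = 𝟙 (ℓ ∋? P) ℕ.* 𝟙 (ℓ ∋? Q)

  -- The lines (s, t) are not vertical, so these are the ordered pairs of distinct points on ℓ, in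
  -- number i² - i. The form of a double sum over pairs allows the sum over ℓ to be carried out
  -- first.
  J : ℕ × ℕ → ℕ
  J ℓ = ∑ pts λ P → ∑ pts λ Q → 𝟙 (distinct? P Q) ℕ.* on-both ℓ P Q

  equal-part : ∀ ℓ {P} → P ∈ pts → ∑ pts (λ Q → 𝟙 (proj₁ P ℕₚ.≟ proj₁ Q) ℕ.* on-both ℓ P Q) ≡ 𝟙 (ℓ ∋? P)
  equal-part ℓ {P@(a , b)} P∈ = ≡.trans (∑-unique pts-unique P∈ zero′)
    (≡.trans (≡.cong₂ ℕ._*_ (𝟙-yes (a ℕₚ.≟ a) ≡.refl) (idem (ℓ ∋? P))) (ℕₚ.*-identityˡ _))
    where
    idem : ∀ {X : Set} (x : Dec X) → 𝟙 x ℕ.* 𝟙 x ≡ 𝟙 x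
    idem (yes _) = ≡.refl
    idem (no _)  = ≡.refl
    zero′ : ∀ {Q} → Q ∈ pts → Q ≢ P → 𝟙 (a ℕₚ.≟ proj₁ Q) ℕ.* on-both ℓ P Q ≡ 0
    zero′ {a′ , b′} Q∈ ne with a ℕₚ.≟ a′ | ℓ ∋? P | ℓ ∋? (a′ , b′)
    ... | no _       | _     | _     = ≡.refl
    ... | yes _      | no _  | _     = ≡.refl
    ... | yes _      | yes _ | no _  = ≡.refl
    ... | yes ≡.refl | yes h | yes k = ⊥-elim (ne (≡.cong (a ,_) (same-point (proj₂ (pts<p Q∈)) (proj₂ (pts<p P∈)) k h)))

  row-split : ∀ ℓ {P} → P ∈ pts →
    ∑ pts (λ Q → 𝟙 (distinct? P Q) ℕ.* on-both ℓ P Q) ℕ.+ 𝟙 (ℓ ∋? P) ≡ 𝟙 (ℓ ∋? P) ℕ.* i ℓ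
  row-split ℓ {P} P∈ = ≡.trans (≡.cong (∑ pts (λ Q → 𝟙 (distinct? P Q) ℕ.* on-both ℓ P Q) ℕ.+_) (≡.sym (equal-part ℓ P∈)))
    (≡.trans (≡.sym (∑-+ pts _ _)) (≡.trans (∑-cong pts λ Q → ≡.trans (≡.sym (ℕₚ.*-distribʳ-+ (on-both ℓ P Q) (𝟙 (distinct? P Q)) _))
      (≡.trans (≡.cong (ℕ._* on-both ℓ P Q) (𝟙-split P Q)) (ℕₚ.*-identityˡ _))) (∑-*ˡ (𝟙 (ℓ ∋? P)) pts _)))

  J+i≡i² : ∀ ℓ → J ℓ ℕ.+ i ℓ ≡ i ℓ ℕ.* i ℓ
  J+i≡i² ℓ = ≡.trans (≡.sym (∑-+ pts _ _)) (≡.trans (∑-cong-∈ pts (row-split ℓ)) (∑-*ʳ (i ℓ) pts _))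

  -- Two points with distinct first coordinates lie on exactly one of the lines, so a single term
  -- survives.
  sum-through : ∀ {P Q} (P∈ : P ∈ pts) (Q∈ : Q ∈ pts) (ne : proj₁ P ≢ proj₁ Q) (f : ℕ × ℕ → ℕ) →
    ∑ lines (λ ℓ → on-both ℓ P Q ℕ.* f ℓ) ≡ f (proj₁ (line-through {b = proj₂ P} {b′ = proj₂ Q} (proj₁ (pts<p P∈)) (proj₁ (pts<p Q∈)) ne))
  sum-through {P} {Q} P∈ Q∈ ne f = go (line-through {b = proj₂ P} {b′ = proj₂ Q} (proj₁ (pts<p P∈)) (proj₁ (pts<p Q∈)) ne)
    where
    go : (L : ∃[ ℓ ] ℓ ∈ lines × ℓ ∋ P × ℓ ∋ Q) → ∑ lines (λ ℓ → on-both ℓ P Q ℕ.* f ℓ) ≡ f (proj₁ L)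
    go (ℓ₀ , ℓ₀∈ , h , k) = ≡.trans (∑-unique lines-unique ℓ₀∈ other)
      (≡.trans (≡.cong (ℕ._* f ℓ₀) (≡.cong₂ ℕ._*_ (𝟙-yes (ℓ₀ ∋? P) h) (𝟙-yes (ℓ₀ ∋? Q) k))) (ℕₚ.*-identityˡ _))
      where
      other : ∀ {ℓ} → ℓ ∈ lines → ℓ ≢ ℓ₀ → on-both ℓ P Q ℕ.* f ℓ ≡ 0
      other {ℓ} ℓ∈ ne′ with ℓ ∋? P | ℓ ∋? Q
      ... | no _  | _      = ≡.refl
      ... | yes _ | no _   = ≡.refl
      ... | yes h′ | yes k′ = ⊥-elim (ne′ (same-line ℓ∈ ℓ₀∈ (proj₁ (pts<p P∈)) (proj₁ (pts<p Q∈)) ne h′ k′ h k))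

  few-common-lines : ∀ {ls P Q} → Unique ls → (∀ {ℓ} → ℓ ∈ ls → ℓ ∈ lines) → P ∈ pts → Q ∈ pts → proj₁ P ≢ proj₁ Q →
                     ∑ ls (λ ℓ → on-both ℓ P Q) ≤ 1
  few-common-lines {ls} {P} {Q} u ⊆ P∈ Q∈ ne = ℕₚ.≤-trans
    (ℕₚ.≤-reflexive (∑-cong ls λ ℓ → 𝟙-× (ℓ ∋? P) (ℓ ∋? Q)))
    (∑-𝟙-≤1 (λ ℓ → (ℓ ∋? P) Dec.×-dec (ℓ ∋? Q)) u
      λ ℓ∈ ℓ′∈ (h , k) (h′ , k′) → same-line (⊆ ℓ∈) (⊆ ℓ′∈) (proj₁ (pts<p P∈)) (proj₁ (pts<p Q∈)) ne h k h′ k′)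
    where
    𝟙-× : ∀ {X Y : Set} (x : Dec X) (y : Dec Y) → 𝟙 x ℕ.* 𝟙 y ≡ 𝟙 (x Dec.×-dec y)
    𝟙-× (yes _) (yes _) = ≡.refl
    𝟙-× (yes _) (no _)  = ≡.refl
    𝟙-× (no _)  _       = ≡.refl

  column : ∀ {a} → a ∈ xs → ∑ pts (λ Q → 𝟙 (a ℕₚ.≟ proj₁ Q)) ≡ n
  column {a} a∈ = ≡.trans (∑-cartesianProduct xs xs _) (≡.trans
      (∑-cong xs λ b → ∑-const xs (𝟙 (a ℕₚ.≟ b))) (≡.trans (∑-*ˡ n xs _)
      (≡.trans (≡.cong (n ℕ.*_) one) (ℕₚ.*-identityʳ n))))
    where
    one : ∑ xs (λ b → 𝟙 (a ℕₚ.≟ b)) ≡ 1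
    one = ≡.trans (∑-unique xs-unique a∈ λ {b} _ ne → 𝟙-no (a ℕₚ.≟ b) (ne ∘ ≡.sym)) (𝟙-yes (a ℕₚ.≟ a) ≡.refl)

  equal-pairs : ∑ pts (λ P → ∑ pts λ Q → 𝟙 (proj₁ P ℕₚ.≟ proj₁ Q)) ≡ n ℕ.* n ℕ.* n
  equal-pairs = ≡.trans (∑-cong-∈ pts λ P∈ → column (proj₁ (∈-cartesianProduct⁻ xs xs P∈)))
    (≡.trans (∑-const pts n) (≡.cong (ℕ._* n) (length-cartesianProduct xs xs)))

  distinct-pairs : ∑ pts (λ P → ∑ pts λ Q → 𝟙 (distinct? P Q)) ℕ.+ n ℕ.* n ℕ.* n ≡ (n ℕ.* n) ℕ.* (n ℕ.* n)
  distinct-pairs = ≡.trans (≡.cong (∑ pts (λ P → ∑ pts λ Q → 𝟙 (distinct? P Q)) ℕ.+_) (≡.sym equal-pairs))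
    (≡.trans (≡.sym (∑-+ pts _ _)) (≡.trans (∑-cong pts λ P → ≡.trans (≡.sym (∑-+ pts _ _)) (≡.trans (∑-cong pts (𝟙-split P)) (≡.sym (length≡∑ pts))))
      (≡.trans (∑-const pts (length pts)) (≡.cong₂ ℕ._*_ (length-cartesianProduct xs xs) (length-cartesianProduct xs xs)))))

  distinct-times : ∀ P Q {x y} → (proj₁ P ≢ proj₁ Q → x ≡ y) → 𝟙 (distinct? P Q) ℕ.* x ≡ 𝟙 (distinct? P Q) ℕ.* y
  distinct-times P Q h with proj₁ P ℕₚ.≟ proj₁ Q
  ... | yes _ = ≡.refl
  ... | no ne = ≡.cong (ℕ._+ 0) (h ne)

  private
    regroup : ∀ (f : ℕ × ℕ → ℕ) → ∑ lines (λ ℓ → J ℓ ℕ.* f ℓ) ≡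
      ∑ pts λ P → ∑ pts λ Q → 𝟙 (distinct? P Q) ℕ.* ∑ lines (λ ℓ → on-both ℓ P Q ℕ.* f ℓ)
    regroup f = ≡.trans (∑-cong lines λ ℓ → ≡.trans (≡.sym (∑-*ʳ (f ℓ) pts _)) (∑-cong pts λ P → ≡.sym (∑-*ʳ (f ℓ) pts _)))
      (≡.trans (∑-swap lines pts _) (∑-cong pts λ P → ≡.trans (∑-swap lines pts _) (∑-cong pts λ Q →
        ≡.trans (∑-cong lines λ ℓ → ℕₚ.*-assoc (𝟙 (distinct? P Q)) _ _) (∑-*ˡ (𝟙 (distinct? P Q)) lines _))))

  -- Each pair of points with distinct first coordinates is counted on exactly one line, and n³ of
  -- the n⁴ pairs have equal first coordinates.
  ∑J : ∑ lines J ℕ.+ n ℕ.* n ℕ.* n ≡ (n ℕ.* n) ℕ.* (n ℕ.* n)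
  ∑J = ≡.trans (≡.cong (ℕ._+ n ℕ.* n ℕ.* n) eq) distinct-pairs
    where
    eq : ∑ lines J ≡ ∑ pts (λ P → ∑ pts λ Q → 𝟙 (distinct? P Q))
    eq = ≡.trans (∑-cong lines λ ℓ → ≡.sym (ℕₚ.*-identityʳ (J ℓ))) (≡.trans (regroup (λ _ → 1))
      (∑-cong-∈ pts λ {P} P∈ → ∑-cong-∈ pts λ {Q} Q∈ → ≡.trans (distinct-times P Q {y = 1} λ ne → sum-through P∈ Q∈ ne (λ _ → 1)) (ℕₚ.*-identityʳ _)))

  CollinearPts : ℕ × ℕ → ℕ × ℕ → ℕ × ℕ → Set
  CollinearPts (a , a′) (b , b′) (c , c′) =
    (⟨ b ⟩ + - ⟨ a ⟩) * (⟨ c′ ⟩ + - ⟨ a′ ⟩) ≈ (⟨ c ⟩ + - ⟨ a ⟩) * (⟨ b′ ⟩ + - ⟨ a′ ⟩)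

  module Triples (col? : ∀ P Q Z → Dec (CollinearPts P Q Z)) where
    triples : ℕ
    triples = ∑ pts λ P → ∑ pts λ Q → ∑ pts λ Z → 𝟙 (col? P Q Z)

    -- A triple is proper if its first two points have distinct first coordinates. They then
    -- determine a line ℓ, on which the third point must lie, whence the weight J ℓ times i ℓ.
    proper degenerate : ℕ
    proper     = ∑ lines λ ℓ → J ℓ ℕ.* i ℓ
    degenerate = ∑ pts λ P → ∑ pts λ Q → 𝟙 (proj₁ P ℕₚ.≟ proj₁ Q) ℕ.* ∑ pts λ Z → 𝟙 (col? P Q Z)

    private
      on⇒collinear : ∀ {s t a a′ b b′ c c′} → (s , t) ∋ (a , a′) → (s , t) ∋ (b , b′) → (s , t) ∋ (c , c′) → CollinearPts (a , a′) (b , b′) (c , c′)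
      on⇒collinear {s} {t} {a} {a′} {b} {b′} {c} {c′} h k m = trans (*-congˡ (sym (slope h m)))
        (trans (sym (*-assoc _ _ _)) (trans (*-congʳ (*-comm _ _)) (trans (*-congʳ (slope h k)) (*-comm _ _))))

      collinear⇒on : ∀ {s t a a′ b b′ c c′} → a < p → b < p → a ≢ b → (s , t) ∋ (a , a′) → (s , t) ∋ (b , b′) →
        CollinearPts (a , a′) (b , b′) (c , c′) → (s , t) ∋ (c , c′)
      collinear⇒on {s} {t} {a} {a′} {b} {b′} {c} {c′} a<p b<p ne h k e = ∋⇐ (trans
          (+-congʳ (trans (*-congˡ (sym (unmove {⟨ a ⟩} refl))) (distribˡ _ _ _)))
          (trans (+-congʳ (+-comm _ _)) (trans (+-assoc _ _ _) (trans (+-cong sΔ (∋⇒ h)) (trans (+-assoc _ _ _) (trans (+-congˡ (-‿inverseˡ _)) (+-identityʳ _)))))))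
        where
        Δ = ⟨ b ⟩ + - ⟨ a ⟩
        sΔ : ⟨ s ⟩ * (⟨ c ⟩ + - ⟨ a ⟩) ≈ ⟨ c′ ⟩ + - ⟨ a′ ⟩
        sΔ = let (y , Δy) = inverse Δ (diff≉0 a<p b<p ne) in
          trans (sym (trans (*-congʳ (trans (*-comm y Δ) Δy)) (*-identityˡ _))) (trans (*-assoc _ _ _) (trans (*-congˡ
            (trans (sym (*-assoc _ _ _)) (trans (*-congʳ (trans (*-comm Δ _) (slope h k))) (trans (*-comm _ _) (sym e)))))
            (trans (sym (*-assoc _ _ _)) (trans (*-congʳ (trans (*-comm y Δ) Δy)) (*-identityˡ _)))))

      proper-row : ∀ {P Q} → P ∈ pts → Q ∈ pts → proj₁ P ≢ proj₁ Q →
        ∑ pts (λ Z → 𝟙 (col? P Q Z)) ≡ ∑ lines (λ ℓ → on-both ℓ P Q ℕ.* i ℓ)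
      proper-row {P} {Q} P∈ Q∈ ne = ≡.trans (∑-cong pts λ Z → go Z (line-through {b = proj₂ P} {b′ = proj₂ Q} (proj₁ (pts<p P∈)) (proj₁ (pts<p Q∈)) ne))
          (≡.sym (sum-through P∈ Q∈ ne i))
        where
        go : ∀ Z (L : ∃[ ℓ ] ℓ ∈ lines × ℓ ∋ P × ℓ ∋ Q) → 𝟙 (col? P Q Z) ≡ 𝟙 (proj₁ L ∋? Z)
        go Z (ℓ , _ , h , k) = 𝟙-⇔ (col? P Q Z) (ℓ ∋? Z)
          (collinear⇒on (proj₁ (pts<p P∈)) (proj₁ (pts<p Q∈)) ne h k) (on⇒collinear h k)

    triples-split : triples ≡ proper ℕ.+ degenerate
    triples-split = ≡.trans (∑-cong-∈ pts λ {P} P∈ → ≡.trans (∑-cong-∈ pts λ {Q} Q∈ → row P∈ Q∈) (∑-+ pts _ _))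
      (≡.trans (∑-+ pts _ _) (≡.cong (ℕ._+ degenerate) (≡.sym (regroup i))))
      where
      row : ∀ {P Q} → P ∈ pts → Q ∈ pts → ∑ pts (λ Z → 𝟙 (col? P Q Z)) ≡
        𝟙 (distinct? P Q) ℕ.* ∑ lines (λ ℓ → on-both ℓ P Q ℕ.* i ℓ) ℕ.+ 𝟙 (proj₁ P ℕₚ.≟ proj₁ Q) ℕ.* ∑ pts (λ Z → 𝟙 (col? P Q Z))
      row {P} {Q} P∈ Q∈ = ≡.trans (≡.sym (ℕₚ.*-identityˡ _)) (≡.trans (≡.cong (ℕ._* S) (≡.sym (𝟙-split P Q)))
        (≡.trans (ℕₚ.*-distribʳ-+ S (𝟙 (distinct? P Q)) _) (≡.cong (ℕ._+ 𝟙 (proj₁ P ℕₚ.≟ proj₁ Q) ℕ.* S)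
          (distinct-times P Q (proper-row P∈ Q∈)))))
        where S = ∑ pts (λ Z → 𝟙 (col? P Q Z))

    -- For a = b collinearity reads (c - a)(b' - a') = 0.
    degenerate≤ : degenerate ≤ 2 ℕ.* ((n ℕ.* n) ℕ.* (n ℕ.* n))
    degenerate≤ = ℕₚ.≤-trans (∑-mono-∈ pts λ {P} P∈ → ∑-mono-∈ pts λ {Q} Q∈ → row P∈ Q∈)
      (ℕₚ.≤-trans (ℕₚ.≤-reflexive (≡.trans (∑-cong pts λ P → ∑-+ pts _ _) (≡.trans (∑-+ pts _ _) (≡.cong₂ ℕ._+_ part₁ part₂))))
        (ℕₚ.≤-reflexive (solve 1 (λ n → n :* (n :* n :* n) :+ n :* n :* (n :* n) := con 2 :* (n :* n :* (n :* n))) ≡.refl n)))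
      where
      open +-*-Solver
      _≟₂_ = ≡-dec ℕₚ._≟_ ℕₚ._≟_
      collinear-cases : ∀ {a a′ b′ Z} → (a , a′) ∈ pts → (a , b′) ∈ pts → Z ∈ pts → (a , a′) ≢ (a , b′) →
        CollinearPts (a , a′) (a , b′) Z → a ≡ proj₁ Z
      collinear-cases {a} {a′} {b′} {c , c′} P∈ Q∈ Z∈ ne e with a ℕₚ.≟ c
      ... | yes a≡c = a≡c
      ... | no  a≢c = ⊥-elim (nonzero-* (diff≉0 (proj₁ (pts<p P∈)) (proj₁ (pts<p Z∈)) a≢c)
                                (diff≉0 (proj₂ (pts<p P∈)) (proj₂ (pts<p Q∈)) (λ q → ne (≡.cong (a ,_) q)))
                                (trans (sym e) (trans (*-congʳ (-‿inverseʳ ⟨ a ⟩)) (zeroˡ _))))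
      -- The first term accounts for P ≠ Q on a common vertical line, to which Z is then confined,
      -- the second for P = Q, where Z is arbitrary.
      row : ∀ {P Q} → P ∈ pts → Q ∈ pts → 𝟙 (proj₁ P ℕₚ.≟ proj₁ Q) ℕ.* ∑ pts (λ Z → 𝟙 (col? P Q Z)) ≤
        n ℕ.* 𝟙 (proj₁ P ℕₚ.≟ proj₁ Q) ℕ.+ 𝟙 (P ≟₂ Q) ℕ.* (n ℕ.* n)
      row {P@(a , a′)} {Q@(b , b′)} P∈ Q∈ = go (a ℕₚ.≟ b) (P ≟₂ Q)
        where
        go : (x : Dec (a ≡ b)) (y : Dec (P ≡ Q)) → 𝟙 x ℕ.* ∑ pts (λ Z → 𝟙 (col? P Q Z)) ≤ n ℕ.* 𝟙 x ℕ.+ 𝟙 y ℕ.* (n ℕ.* n)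
        go (no _) _ = z≤n
        go (yes ≡.refl) (yes _) = ℕₚ.≤-trans (ℕₚ.≤-reflexive (ℕₚ.*-identityˡ _)) (ℕₚ.≤-trans
          (∑-≤-const pts 1 (λ Z → 𝟙≤1 (col? P Q Z)))
          (ℕₚ.≤-trans (ℕₚ.≤-reflexive (≡.trans (ℕₚ.*-identityʳ _) (≡.trans (length-cartesianProduct xs xs) (≡.sym (ℕₚ.*-identityˡ _)))))
            (ℕₚ.m≤n+m (1 ℕ.* (n ℕ.* n)) (n ℕ.* 1))))
        go (yes ≡.refl) (no ne) = ℕₚ.≤-trans (ℕₚ.≤-reflexive (ℕₚ.*-identityˡ _)) (ℕₚ.≤-trans
          (∑-mono-∈ pts λ {Z} Z∈ → 𝟙-mono (col? P Q Z) (a ℕₚ.≟ proj₁ Z) (collinear-cases P∈ Q∈ Z∈ ne))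
          (ℕₚ.≤-trans (ℕₚ.≤-reflexive (≡.trans (column (proj₁ (∈-cartesianProduct⁻ xs xs P∈))) (≡.sym (ℕₚ.*-identityʳ n)))) (ℕₚ.m≤m+n (n ℕ.* 1) _)))
      part₁ : ∑ pts (λ P → ∑ pts λ Q → n ℕ.* 𝟙 (proj₁ P ℕₚ.≟ proj₁ Q)) ≡ n ℕ.* (n ℕ.* n ℕ.* n)
      part₁ = ≡.trans (∑-cong pts λ P → ∑-*ˡ n pts _) (≡.trans (∑-*ˡ n pts _) (≡.cong (n ℕ.*_) equal-pairs))
      part₂ : ∑ pts (λ P → ∑ pts λ Q → 𝟙 (P ≟₂ Q) ℕ.* (n ℕ.* n)) ≡ n ℕ.* n ℕ.* (n ℕ.* n)
      part₂ = ≡.trans (∑-cong-∈ pts λ {P} P∈ → ≡.trans (∑-unique pts-unique P∈ λ {Q} _ ne → ≡.cong (ℕ._* (n ℕ.* n)) (𝟙-no (P ≟₂ Q) (ne ∘ ≡.sym)))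
          (≡.trans (≡.cong (ℕ._* (n ℕ.* n)) (𝟙-yes (P ≟₂ P) ≡.refl)) (ℕₚ.*-identityˡ _)))
        (≡.trans (∑-const pts (n ℕ.* n)) (≡.cong (ℕ._* (n ℕ.* n)) (length-cartesianProduct xs xs)))

-- Few rich lines, and the resulting bound for collinear triples

module RichLines where
  open Unfolding using (∑; 𝟙)
  open FiniteSums
  open import Data.List.Properties using (length-take)
  open import Data.Nat using (_+_; _*_)
  open import Data.Nat.Properties
  open import Relation.Binary.PropositionalEquality using (refl; cong; cong₂; sym; trans)

  ∈-take : ∀ {A : Set} k {xs : List A} {x} → x ∈ List.take k xs → x ∈ xs
  ∈-take (suc k) {y ∷ xs} (here e)  = here e
  ∈-take (suc k) {y ∷ xs} (there h) = there (∈-take k h)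

  module Counting (F : Domain) (p : ℕ) (𝔽 : PrimeFieldStructure p F)
    (xs : List ℕ) (xs-unique : Unique xs) (xs<p : ∀ {a} → a ∈ xs → a < p)
    where

    open GridLines F p 𝔽 xs xs-unique xs<p using (_∋?_; count; popular-bound)
    open PrimeFieldStructure 𝔽 using (_∋_)
    open LineSums F p 𝔽 _∋_ _∋?_ (λ h → h) (λ h → h) xs xs-unique xs<p public

    -- Double counting: rich lines pass through many points many times.
    module _ (ls : List (ℕ × ℕ)) (ls-unique : Unique ls) (ls⊆ : ∀ {ℓ} → ℓ ∈ ls → ℓ ∈ lines)
             (I r : ℕ) (rich : ∀ {ℓ} → ℓ ∈ ls → suc I ≤ i ℓ) where

      -- Each rich line through P contains at least I further points of the grid, and two lines
      -- through P have no further point in common.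
      pencil-bound : ∀ {P} → P ∈ pts → I * count ls P ≤ n * n
      pencil-bound {P} P∈ = begin
        I * count ls P ≡⟨ ∑-*ˡ I ls _ ⟨
        ∑ ls (λ ℓ → I * 𝟙 (ℓ ∋? P)) ≤⟨ ∑-mono-∈ ls row ⟩
        ∑ ls (λ ℓ → ∑ pts (λ Q → 𝟙 (distinct? P Q) * on-both ℓ P Q)) ≡⟨ ∑-swap ls pts _ ⟩
        ∑ pts (λ Q → ∑ ls (λ ℓ → 𝟙 (distinct? P Q) * on-both ℓ P Q)) ≤⟨ ∑-mono-∈ pts (λ {Q} Q∈ → ≤-trans (≤-reflexive (∑-*ˡ (𝟙 (distinct? P Q)) ls _)) (col Q∈ (distinct? P Q))) ⟩
        ∑ pts (λ Q → 1) ≡⟨ length≡∑ pts ⟨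
        length pts ≡⟨ length-cartesianProduct xs xs ⟩
        n * n ∎
        where
        open ≤-Reasoning
        row : ∀ {ℓ} → ℓ ∈ ls → I * 𝟙 (ℓ ∋? P) ≤ ∑ pts (λ Q → 𝟙 (distinct? P Q) * on-both ℓ P Q)
        row {ℓ} ℓ∈ = +-cancelʳ-≤ (𝟙 (ℓ ∋? P)) _ _ (begin
          I * 𝟙 (ℓ ∋? P) + 𝟙 (ℓ ∋? P) ≡⟨ solve 2 (λ I x → I :* x :+ x := x :* (con 1 :+ I)) refl I (𝟙 (ℓ ∋? P)) ⟩
          𝟙 (ℓ ∋? P) * suc I ≤⟨ *-monoʳ-≤ (𝟙 (ℓ ∋? P)) (rich ℓ∈) ⟩
          𝟙 (ℓ ∋? P) * i ℓ ≡⟨ row-split ℓ P∈ ⟨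
          ∑ pts (λ Q → 𝟙 (distinct? P Q) * on-both ℓ P Q) + 𝟙 (ℓ ∋? P) ∎)
          where open +-*-Solver
        col : ∀ {Q} → Q ∈ pts → (d : Dec (proj₁ P ≢ proj₁ Q)) → 𝟙 d * ∑ ls (λ ℓ → on-both ℓ P Q) ≤ 1
        col Q∈ (no _)   = z≤n
        col Q∈ (yes ne) = ≤-trans (≤-reflexive (*-identityˡ _)) (few-common-lines ls-unique ls⊆ P∈ Q∈ ne)

      incidences : length ls * suc I ≤ ∑ pts (count ls)
      incidences = begin
        length ls * suc I ≡⟨ ∑-const ls (suc I) ⟨
        ∑ ls (λ _ → suc I) ≤⟨ ∑-mono-∈ ls rich ⟩
        ∑ ls i ≡⟨ ∑-swap ls pts (λ ℓ P → 𝟙 (ℓ ∋? P)) ⟩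
        ∑ pts (count ls) ∎
        where open ≤-Reasoning

      popular : ℕ
      popular = ∑ pts (λ P → 𝟙 (r ≤? count ls P))

      -- In the sum of I times `count` over the grid, a point on fewer than r lines contributes at
      -- most I r, and any other at most n² by `pencil-bound`.
      many-popular : I * (length ls * suc I) ≤ n * n * (I * r) + popular * (n * n)
      many-popular = begin
        I * (length ls * suc I) ≤⟨ *-monoʳ-≤ I incidences ⟩
        I * ∑ pts (count ls) ≡⟨ ∑-*ˡ I pts _ ⟨
        ∑ pts (λ P → I * count ls P) ≤⟨ ∑-mono-∈ pts (λ {P} P∈ → bound P∈ (r ≤? count ls P)) ⟩
        ∑ pts (λ P → I * r + 𝟙 (r ≤? count ls P) * (n * n)) ≡⟨ ∑-+ pts _ _ ⟩
        ∑ pts (λ _ → I * r) + ∑ pts (λ P → 𝟙 (r ≤? count ls P) * (n * n)) ≡⟨ cong₂ _+_ (trans (∑-const pts (I * r)) (cong (_* (I * r)) (length-cartesianProduct xs xs))) (∑-*ʳ (n * n) pts _) ⟩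
        n * n * (I * r) + popular * (n * n) ∎
        where
        open ≤-Reasoning
        bound : ∀ {P} → P ∈ pts → (d : Dec (r ≤ count ls P)) → I * count ls P ≤ I * r + 𝟙 d * (n * n)
        bound P∈ (yes _) = ≤-trans (pencil-bound P∈) (≤-trans (≤-reflexive (sym (*-identityˡ _))) (m≤n+m _ (I * r)))
        bound P∈ (no h)  = ≤-trans (*-monoʳ-≤ I (<⇒≤ (≰⇒> h))) (m≤m+n (I * r) _)

    module _ (m r : ℕ) (m²r≤n : m * m * r ≤ n) (n<2m²r : n < 2 * (m * m * r)) (large : 84 * (m * (m * (m * (m * m)))) < r)
             (2E≤p : 2 * (12 * (m * m * m)) ≤ p) (rE≤p : r * (12 * (m * m * m)) ≤ p) where
      private
        -- Given n < 2 m² r, this E makes the 6 (m r n) E² conditions fewer than the r² E³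
        -- coefficients of the auxiliary polynomial. The choice I = 4 m r lets points on fewer than
        -- r lines account for at most half of the incidences with m r n rich lines.
        E = 12 * (m * m * m)
        I = 4 * (m * r)

      richness? : ∀ ℓ → Dec (suc I ≤ i ℓ)
      richness? ℓ = suc I ≤? i ℓ

      private
        mr>0 : 0 < m * r
        mr>0 = n≢0⇒n>0 λ e → <⇒≢ (≤-<-trans z≤n n<2m²r)
          (sym (trans (cong (2 *_) (trans (*-assoc m m r) (trans (cong (m *_) e) (*-zeroʳ m)))) refl))

        n>0 : 0 < n
        n>0 = <-≤-trans (n≢0⇒n>0 λ e → <⇒≢ (≤-<-trans z≤n n<2m²r) (sym (cong (2 *_) e))) m²r≤n

      -- From m r n rich lines double counting produces at least I r popular points, whereas the
      -- auxiliary polynomial allows at most 2 E (r E) + 2 E n. Both together would force r ≤ 84 m⁵.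
      few-rich : ∑ lines (λ ℓ → 𝟙 (richness? ℓ)) < m * r * n
      few-rich = ≰⇒> contradiction
        where
        open +-*-Solver
        all-rich = filter richness? lines
        -- Exactly m r n rich lines are kept: with more the dimension count for the auxiliary
        -- polynomial could fail, with fewer the lower bound for popular points.
        ls = List.take (m * r * n) all-rich
        ls-unique : Unique ls
        ls-unique = Uniqueₚ.take⁺ (m * r * n) (Uniqueₚ.filter⁺ richness? lines-unique)
        in-ls : ∀ {ℓ} → ℓ ∈ ls → ℓ ∈ lines × suc I ≤ i ℓ
        in-ls h = ∈-filter⁻ richness? {xs = lines} (∈-take (m * r * n) h)
        contradiction : ¬ m * r * n ≤ ∑ lines (λ ℓ → 𝟙 (richness? ℓ))
        contradiction h = <⇒≱ large r≤
          where
          len : length ls ≡ m * r * n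
          len = trans (length-take (m * r * n) all-rich) (m≤n⇒m⊓n≡m (≤-trans h (≤-reflexive (sym (length-filter≡∑ richness? lines)))))
          enough : length ls * (2 * E * (3 * E)) < E * (r * E * (r * E))
          enough = subst₂′ (cong (_* (2 * E * (3 * E))) (sym len)) (begin-strict
            m * r * n * (2 * E * (3 * E)) ≡⟨ solve 4 (λ m r n E → m :* r :* n :* (con 2 :* E :* (con 3 :* E)) := con 6 :* (m :* r) :* (E :* E) :* n) refl m r n E ⟩
            6 * (m * r) * (E * E) * n <⟨ *-monoʳ-< (6 * (m * r) * (E * E)) {{ℕ.>-nonZero pos}} n<2m²r ⟩
            6 * (m * r) * (E * E) * (2 * (m * m * r)) ≡⟨ solve 3 (λ m r E → con 6 :* (m :* r) :* (E :* E) :* (con 2 :* (m :* m :* r)) := (con 12 :* (m :* m :* m)) :* (r :* E :* (r :* E))) refl m r E ⟩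
            E * (r * E * (r * E)) ∎)
            where
            open ≤-Reasoning
            subst₂′ : ∀ {x y z} → y ≡ x → y < z → x < z
            subst₂′ refl h = h
            m>0 : 0 < m
            m>0 = n≢0⇒n>0 λ e → <⇒≢ mr>0 (sym (cong (_* r) e))
            E>0 : 0 < E
            E>0 = *-mono-≤ {1} {12} {1} (s≤s z≤n) (*-mono-≤ {1} {m * m} {1} (*-mono-≤ {1} {m} {1} m>0 m>0) m>0)
            pos : 0 < 6 * (m * r) * (E * E)
            pos = *-mono-≤ {1} {6 * (m * r)} {1} (*-mono-≤ {1} {6} {1} (s≤s z≤n) mr>0) (*-mono-≤ {1} {E} {1} E>0 E>0)
          pop = popular ls ls-unique (λ h → proj₁ (in-ls h)) I r (λ h → proj₂ (in-ls h))
          upper : pop ≤ 2 * E * (r * E) + 2 * E * n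
          upper = popular-bound ls ls-unique (λ h → lines<p (proj₁ (in-ls h))) E r 2E≤p rE≤p enough
          lower : I * r ≤ pop
          lower = *-cancelˡ-≤ (n * n) {{ℕ.>-nonZero (*-mono-≤ {1} {n} {1} n>0 n>0)}} (+-cancelˡ-≤ (n * n * (I * r)) _ _ (begin
            n * n * (I * r) + n * n * (I * r) ≡⟨ solve 3 (λ n I r → n :* n :* (I :* r) :+ n :* n :* (I :* r) := I :* (con 2 :* n :* r :* n)) refl n I r ⟩
            I * (2 * n * r * n) ≤⟨ *-monoʳ-≤ I (*-monoʳ-≤ (2 * n * r) (<⇒≤ n<2m²r)) ⟩
            I * (2 * n * r * (2 * (m * m * r))) ≡⟨ cong (I *_) (solve 3 (λ n m r → con 2 :* n :* r :* (con 2 :* (m :* m :* r)) := m :* r :* n :* (con 4 :* (m :* r))) refl n m r) ⟩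
            I * (m * r * n * I) ≤⟨ *-monoʳ-≤ I (*-monoʳ-≤ (m * r * n) (n≤1+n I)) ⟩
            I * (m * r * n * suc I) ≡⟨ cong (λ l → I * (l * suc I)) len ⟨
            I * (length ls * suc I) ≤⟨ many-popular ls ls-unique (λ h → proj₁ (in-ls h)) I r (λ h → proj₂ (in-ls h)) ⟩
            n * n * (I * r) + pop * (n * n) ≡⟨ cong (n * n * (I * r) +_) (*-comm pop (n * n)) ⟩
            n * n * (I * r) + n * n * pop ∎))
            where open ≤-Reasoning
          -- Here 84 = 72 + 12: division by 4 m r leaves 72 m⁵ from 2 E (r E), and 12 m⁴ ≤ 12 m⁵
          -- from 2 E n.
          r≤ : r ≤ 84 * (m * (m * (m * (m * m))))
          r≤ = *-cancelˡ-≤ (4 * (m * r)) {{ℕ.>-nonZero (*-mono-≤ {1} {4} {1} (s≤s z≤n) mr>0)}} (begin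
            4 * (m * r) * r ≤⟨ lower ⟩
            pop ≤⟨ upper ⟩
            2 * E * (r * E) + 2 * E * n ≤⟨ +-monoʳ-≤ (2 * E * (r * E)) (*-monoʳ-≤ (2 * E) (<⇒≤ n<2m²r)) ⟩
            2 * E * (r * E) + 2 * E * (2 * (m * m * r)) ≡⟨ solve 2 (λ m r → con 2 :* (con 12 :* (m :* m :* m)) :* (r :* (con 12 :* (m :* m :* m))) :+ con 2 :* (con 12 :* (m :* m :* m)) :* (con 2 :* (m :* m :* r))
              := con 48 :* (m :* m :* m :* m :* m :* r) :+ con 288 :* (m :* m :* m :* m :* m :* r) :* m) refl m r ⟩
            48 * (m * m * m * m * m * r) + 288 * (m * m * m * m * m * r) * m ≤⟨ +-monoˡ-≤ _ (≤-trans (≤-reflexive (sym (*-identityʳ _))) (*-monoʳ-≤ (48 * (m * m * m * m * m * r)) m>0)) ⟩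
            48 * (m * m * m * m * m * r) * m + 288 * (m * m * m * m * m * r) * m ≡⟨ solve 2 (λ m r → con 48 :* (m :* m :* m :* m :* m :* r) :* m :+ con 288 :* (m :* m :* m :* m :* m :* r) :* m
              := con 4 :* (m :* r) :* (con 84 :* (m :* (m :* (m :* (m :* m)))))) refl m r ⟩
            4 * (m * r) * (84 * (m * (m * (m * (m * m))))) ∎)
            where
            open ≤-Reasoning
            m>0 : 0 < m
            m>0 = n≢0⇒n>0 λ e → <⇒≢ mr>0 (sym (cong (_* r) e))

      private
        n⁴ = (n * n) * (n * n)

      ∑J≤n⁴ : ∑ lines J ≤ n⁴
      ∑J≤n⁴ = ≤-trans (m≤m+n _ (n * n * n)) (≤-reflexive ∑J)

      module _ (col? : ∀ P Q Z → Dec (CollinearPts P Q Z)) where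
        open Triples col?

        -- Lines with at most I points are weighted by J, whose total is at most n⁴; each of the
        -- fewer than m r n rich lines contributes at most n³.
        proper≤ : proper ≤ I * n⁴ + m * r * n * (n * n * n)
        proper≤ = begin
          proper ≤⟨ ∑-mono lines (λ ℓ → bound ℓ (richness? ℓ)) ⟩
          ∑ lines (λ ℓ → I * J ℓ + 𝟙 (richness? ℓ) * (n * n * n)) ≡⟨ ∑-+ lines _ _ ⟩
          ∑ lines (λ ℓ → I * J ℓ) + ∑ lines (λ ℓ → 𝟙 (richness? ℓ) * (n * n * n)) ≡⟨ cong₂ _+_ (∑-*ˡ I lines J) (∑-*ʳ (n * n * n) lines _) ⟩
          I * ∑ lines J + ∑ lines (λ ℓ → 𝟙 (richness? ℓ)) * (n * n * n) ≤⟨ +-mono-≤ (*-monoʳ-≤ I ∑J≤n⁴) (*-monoˡ-≤ (n * n * n) (<⇒≤ few-rich)) ⟩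
          I * n⁴ + m * r * n * (n * n * n) ∎
          where
          open ≤-Reasoning
          bound : ∀ ℓ (d : Dec (suc I ≤ i ℓ)) → J ℓ * i ℓ ≤ I * J ℓ + 𝟙 d * (n * n * n)
          bound ℓ (no h)  = ≤-trans (≤-reflexive (*-comm (J ℓ) (i ℓ))) (≤-trans (*-monoˡ-≤ (J ℓ) (ℕ.s≤s⁻¹ (≰⇒> h))) (m≤m+n _ _))
          bound ℓ (yes _) = ≤-trans (*-mono-≤ (≤-trans (≤-trans (m≤m+n (J ℓ) (i ℓ)) (≤-reflexive (J+i≡i² ℓ))) (*-mono-≤ (i≤n ℓ) (i≤n ℓ))) (i≤n ℓ))
            (≤-trans (≤-reflexive (sym (*-identityˡ _))) (m≤n+m _ (I * J ℓ)))

        -- The factor m turns m r into m² r ≤ n. The constant is 4 + 1 + 2, for the lines with at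
        -- most I points, the rich lines and the degenerate triples.
        triples≤ : m * triples ≤ 7 * (n * n⁴)
        triples≤ = begin
          m * triples ≡⟨ cong (m *_) triples-split ⟩
          m * (proper + degenerate) ≤⟨ *-monoʳ-≤ m (+-mono-≤ proper≤ degenerate≤) ⟩
          m * ((I * n⁴ + m * r * n * (n * n * n)) + 2 * n⁴) ≡⟨ solve 3 (λ m r n → m :* ((con 4 :* (m :* r) :* (n :* n :* (n :* n)) :+ m :* r :* n :* (n :* n :* n)) :+ con 2 :* (n :* n :* (n :* n)))
            := con 5 :* (m :* m :* r) :* (n :* n :* (n :* n)) :+ con 2 :* m :* (n :* n :* (n :* n))) refl m r n ⟩
          5 * (m * m * r) * n⁴ + 2 * m * n⁴ ≤⟨ +-mono-≤ (*-monoˡ-≤ n⁴ (*-monoʳ-≤ 5 m²r≤n)) (*-monoˡ-≤ n⁴ (*-monoʳ-≤ 2 m≤n)) ⟩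
          5 * n * n⁴ + 2 * n * n⁴ ≡⟨ solve 2 (λ n x → con 5 :* n :* x :+ con 2 :* n :* x := con 7 :* (n :* x)) refl n n⁴ ⟩
          7 * (n * n⁴) ∎
          where
          open ≤-Reasoning
          open +-*-Solver
          m≤n : m ≤ n
          m≤n = ≤-trans (≤-trans (≤-reflexive (sym (*-identityʳ m))) (*-monoʳ-≤ m mr>0)) (≤-trans (≤-reflexive (sym (*-assoc m m r))) m²r≤n)

    module Trivial (col? : ∀ P Q Z → Dec (CollinearPts P Q Z)) where
      open Triples col?

      triples≤3n⁵ : 0 < n → triples ≤ 3 * (n * ((n * n) * (n * n)))
      triples≤3n⁵ n>0 = begin
        triples ≡⟨ triples-split ⟩
        proper + degenerate ≤⟨ +-mono-≤ (≤-trans (∑-mono lines λ ℓ → *-monoʳ-≤ (J ℓ) (i≤n ℓ)) (≤-reflexive (∑-*ʳ n lines J))) degenerate≤ ⟩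
        ∑ lines J * n + 2 * ((n * n) * (n * n)) ≤⟨ +-mono-≤ (*-monoˡ-≤ n (≤-trans (m≤m+n _ (n * n * n)) (≤-reflexive ∑J))) (*-monoʳ-≤ 2 (≤-trans (≤-reflexive (sym (*-identityˡ _))) (*-monoˡ-≤ ((n * n) * (n * n)) n>0))) ⟩
        (n * n) * (n * n) * n + 2 * (n * ((n * n) * (n * n))) ≡⟨ solve 1 (λ n → (n :* n) :* (n :* n) :* n :+ con 2 :* (n :* ((n :* n) :* (n :* n))) := con 3 :* (n :* ((n :* n) :* (n :* n)))) refl n ⟩
        3 * (n * ((n * n) * (n * n))) ∎
        where
        open ≤-Reasoning
        open +-*-Solver

-- The second moment of the number of points on a line

module Variance where
  open Unfolding using (∑)
  open FiniteSums
  open import Data.Nat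
  open import Data.Nat.Properties
  open import Relation.Binary.PropositionalEquality

  ∣-∣² : ∀ x y → ∣ x - y ∣ * ∣ x - y ∣ + 2 * (x * y) ≡ x * x + y * y
  ∣-∣² x y with ≤-total x y
  ... | inj₁ x≤y = subst (λ y → ∣ x - y ∣ * ∣ x - y ∣ + 2 * (x * y) ≡ x * x + y * y) (m+[n∸m]≡n x≤y)
    (trans (cong (λ d → d * d + 2 * (x * (x + (y ∸ x)))) (∣m-m+n∣≡n x (y ∸ x)))
      (solve 2 (λ x d → d :* d :+ con 2 :* (x :* (x :+ d)) := x :* x :+ (x :+ d) :* (x :+ d)) refl x (y ∸ x)))
    where open +-*-Solver
  ... | inj₂ y≤x = subst (λ x → ∣ x - y ∣ * ∣ x - y ∣ + 2 * (x * y) ≡ x * x + y * y) (m+[n∸m]≡n y≤x)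
    (trans (cong (λ d → d * d + 2 * ((y + (x ∸ y)) * y)) (∣m+n-m∣≡n y (x ∸ y)))
      (solve 2 (λ y d → d :* d :+ con 2 :* ((y :+ d) :* y) := (y :+ d) :* (y :+ d) :+ y :* y) refl y (x ∸ y)))
    where
    open +-*-Solver
    ∣m+n-m∣≡n : ∀ m n → ∣ m + n - m ∣ ≡ n
    ∣m+n-m∣≡n m n = trans (∣-∣-comm (m + n) m) (∣m-m+n∣≡n m n)

  module Moments {A : Set} (lines : List A) (i J : A → ℕ) (p n : ℕ)
    (size : length lines ≡ p * p) (∑i : ∑ lines i ≡ p * (n * n)) (∑J : ∑ lines J + n * n * n ≡ (n * n) * (n * n))
    (J+i : ∀ ℓ → J ℓ + i ℓ ≡ i ℓ * i ℓ) (i≤n : ∀ ℓ → i ℓ ≤ n) (n≤p : n ≤ p) where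
    open +-*-Solver

    private
      -- This is p times the deviation of i ℓ from n² / p, its mean over the p² lines.
      d : A → ℕ
      d ℓ = ∣ p * i ℓ - n * n ∣

      Q K V S : ℕ
      Q = ∑ lines λ ℓ → i ℓ * i ℓ
      K = ∑ lines λ ℓ → J ℓ * i ℓ
      V = ∑ lines λ ℓ → d ℓ * d ℓ
      S = ∑ lines λ ℓ → i ℓ * (d ℓ * d ℓ)

      Q-eq : Q + n * n * n ≡ (n * n) * (n * n) + p * (n * n)
      Q-eq = begin
        Q + n * n * n ≡⟨ cong (_+ n * n * n) (trans (∑-cong lines λ ℓ → sym (J+i ℓ)) (∑-+ lines J i)) ⟩
        (∑ lines J + ∑ lines i) + n * n * n ≡⟨ solve 3 (λ a b c → (a :+ b) :+ c := (a :+ c) :+ b) refl (∑ lines J) (∑ lines i) (n * n * n) ⟩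
        (∑ lines J + n * n * n) + ∑ lines i ≡⟨ cong₂ _+_ ∑J ∑i ⟩
        (n * n) * (n * n) + p * (n * n) ∎
        where open ≡-Reasoning

      Q≤ : Q ≤ (n * n) * (n * n) + p * (n * n)
      Q≤ = ≤-trans (m≤m+n Q _) (≤-reflexive Q-eq)

      V-eq : V + 2 * (p * (n * n)) * (p * (n * n)) ≡ p * p * Q + p * p * ((n * n) * (n * n))
      V-eq = begin
        V + 2 * (p * (n * n)) * (p * (n * n)) ≡⟨ cong (λ x → V + 2 * (p * (n * n)) * x) (sym ∑i) ⟩
        V + 2 * (p * (n * n)) * ∑ lines i ≡⟨ cong (V +_) (∑-*ˡ (2 * (p * (n * n))) lines i) ⟨
        V + ∑ lines (λ ℓ → 2 * (p * (n * n)) * i ℓ) ≡⟨ ∑-+ lines _ _ ⟨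
        ∑ lines (λ ℓ → d ℓ * d ℓ + 2 * (p * (n * n)) * i ℓ) ≡⟨ ∑-cong lines (λ ℓ → trans
          (cong (d ℓ * d ℓ +_) (solve 3 (λ p N i → con 2 :* (p :* N) :* i := con 2 :* (p :* i :* N)) refl p (n * n) (i ℓ)))
          (trans (∣-∣² (p * i ℓ) (n * n)) (cong (_+ (n * n) * (n * n)) (solve 2 (λ p i → p :* i :* (p :* i) := p :* p :* (i :* i)) refl p (i ℓ))))) ⟩
        ∑ lines (λ ℓ → p * p * (i ℓ * i ℓ) + (n * n) * (n * n)) ≡⟨ ∑-+ lines _ _ ⟩
        ∑ lines (λ ℓ → p * p * (i ℓ * i ℓ)) + ∑ lines (λ _ → (n * n) * (n * n))  ≡⟨ cong₂ _+_ (∑-*ˡ (p * p) lines _) (trans (∑-const lines _) (cong (_* ((n * n) * (n * n))) size)) ⟩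
        p * p * Q + p * p * ((n * n) * (n * n)) ∎
        where open ≡-Reasoning

      V≤ : V ≤ p * p * p * (n * n)
      V≤ = +-cancelʳ-≤ (2 * (p * (n * n)) * (p * (n * n))) _ _ (begin
        V + 2 * (p * (n * n)) * (p * (n * n)) ≡⟨ V-eq ⟩
        p * p * Q + p * p * ((n * n) * (n * n)) ≤⟨ +-monoˡ-≤ _ (*-monoʳ-≤ (p * p) Q≤) ⟩
        p * p * ((n * n) * (n * n) + p * (n * n)) + p * p * ((n * n) * (n * n)) ≡⟨ solve 2 (λ p N → p :* p :* (N :* N :+ p :* N) :+ p :* p :* (N :* N) := p :* p :* p :* N :+ con 2 :* (p :* N) :* (p :* N)) refl p (n * n) ⟩
        p * p * p * (n * n) + 2 * (p * (n * n)) * (p * (n * n)) ∎)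
        where open ≤-Reasoning

      -- Bounding one factor i by n reduces a third moment to the second.
      S≤ : S ≤ p * p * p * (n * n * n)
      S≤ = begin
        S ≤⟨ ∑-mono lines (λ ℓ → *-monoˡ-≤ (d ℓ * d ℓ) (i≤n ℓ)) ⟩
        ∑ lines (λ ℓ → n * (d ℓ * d ℓ)) ≡⟨ ∑-*ˡ n lines _ ⟩
        n * V ≤⟨ *-monoʳ-≤ n V≤ ⟩
        n * (p * p * p * (n * n)) ≡⟨ solve 2 (λ p n → n :* (p :* p :* p :* (n :* n)) := p :* p :* p :* (n :* n :* n)) refl p n ⟩
        p * p * p * (n * n * n) ∎
        where open ≤-Reasoning

      n⁶ = (n * n) * (n * n) * (n * n)

      -- The expansion of ∑ i (p i - n²)² with i³ = J i + i², arranged so that no subtraction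
      -- occurs.
      third : p * p * K + (p * p * Q + p * n⁶) ≡ S + 2 * (p * (n * n)) * Q
      third = sym (begin
        S + 2 * (p * (n * n)) * Q ≡⟨ cong (S +_) (∑-*ˡ (2 * (p * (n * n))) lines _) ⟨
        S + ∑ lines (λ ℓ → 2 * (p * (n * n)) * (i ℓ * i ℓ)) ≡⟨ ∑-+ lines _ _ ⟨
        ∑ lines (λ ℓ → i ℓ * (d ℓ * d ℓ) + 2 * (p * (n * n)) * (i ℓ * i ℓ)) ≡⟨ ∑-cong lines pointwise ⟩
        ∑ lines (λ ℓ → p * p * (J ℓ * i ℓ) + (p * p * (i ℓ * i ℓ) + (n * n) * (n * n) * i ℓ))  ≡⟨ trans (∑-+ lines _ _) (cong₂ _+_ (∑-*ˡ (p * p) lines _) (trans (∑-+ lines _ _) (cong₂ _+_ (∑-*ˡ (p * p) lines _) (∑-*ˡ ((n * n) * (n * n)) lines i)))) ⟩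
        p * p * K + (p * p * Q + (n * n) * (n * n) * ∑ lines i) ≡⟨ cong (λ x → p * p * K + (p * p * Q + x)) (trans (cong ((n * n) * (n * n) *_) ∑i) (solve 2 (λ p N → N :* N :* (p :* N) := p :* (N :* N :* N)) refl p (n * n))) ⟩
        p * p * K + (p * p * Q + p * n⁶) ∎)
        where
        open ≡-Reasoning
        pointwise : ∀ ℓ → i ℓ * (d ℓ * d ℓ) + 2 * (p * (n * n)) * (i ℓ * i ℓ) ≡ p * p * (J ℓ * i ℓ) + (p * p * (i ℓ * i ℓ) + (n * n) * (n * n) * i ℓ)
        pointwise ℓ = begin
          i ℓ * (d ℓ * d ℓ) + 2 * (p * (n * n)) * (i ℓ * i ℓ) ≡⟨ solve 4 (λ i D p N → i :* D :+ con 2 :* (p :* N) :* (i :* i) := i :* (D :+ con 2 :* (p :* i :* N))) refl (i ℓ) (d ℓ * d ℓ) p (n * n) ⟩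
          i ℓ * (d ℓ * d ℓ + 2 * (p * i ℓ * (n * n))) ≡⟨ cong (i ℓ *_) (∣-∣² (p * i ℓ) (n * n)) ⟩
          i ℓ * (p * i ℓ * (p * i ℓ) + (n * n) * (n * n)) ≡⟨ solve 3 (λ i p N → i :* (p :* i :* (p :* i) :+ N) := p :* p :* ((i :* i) :* i) :+ N :* i) refl (i ℓ) p ((n * n) * (n * n)) ⟩
          p * p * ((i ℓ * i ℓ) * i ℓ) + (n * n) * (n * n) * i ℓ ≡⟨ cong (λ x → p * p * (x * i ℓ) + (n * n) * (n * n) * i ℓ) (sym (J+i ℓ)) ⟩
          p * p * ((J ℓ + i ℓ) * i ℓ) + (n * n) * (n * n) * i ℓ ≡⟨ solve 4 (λ J i p N → p :* p :* ((J :+ i) :* i) :+ N :* i := p :* p :* (J :* i) :+ (p :* p :* (i :* i) :+ N :* i)) refl (J ℓ) (i ℓ) p ((n * n) * (n * n)) ⟩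
          p * p * (J ℓ * i ℓ) + (p * p * (i ℓ * i ℓ) + (n * n) * (n * n) * i ℓ) ∎

      -- In the upper bound 5 = 1 + 2 + 2: from S, from the part 2 p² n⁴ left over from 2 p n² Q,
      -- and from the degenerate triples. The lower bound needs less.
      error = 5 * (p * p * (n * n * n))

      n²≤n³ : n * n ≤ n * n * n
      n²≤n³ = go n
        where
        go : ∀ n → n * n ≤ n * n * n
        go zero    = z≤n
        go (suc n) = m≤m*n (suc n * suc n) (suc n)

    module _ {D T} (T≡ : T ≡ K + D) (D≤ : D ≤ 2 * ((n * n) * (n * n))) (p>0 : 0 < p) where

      upper : p * T ≤ n⁶ + error
      upper = *-cancelˡ-≤ p {{>-nonZero p>0}} (begin
        p * (p * T) ≡⟨ cong (λ T → p * (p * T)) T≡ ⟩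
        p * (p * (K + D)) ≡⟨ solve 3 (λ p K D → p :* (p :* (K :+ D)) := p :* p :* K :+ p :* p :* D) refl p K D ⟩
        p * p * K + p * p * D ≤⟨ +-mono-≤ K≤ (*-monoʳ-≤ (p * p) D≤) ⟩
        (S + (p * n⁶ + 2 * (p * p * ((n * n) * (n * n))))) + p * p * (2 * ((n * n) * (n * n)))
          ≤⟨ +-mono-≤ (+-mono-≤ S≤ (+-monoʳ-≤ (p * n⁶) (*-monoʳ-≤ 2 p²n⁴))) (≤-trans (≤-reflexive (solve 2 (λ p N → p :* (con 2 :* N) := con 2 :* (p :* N)) refl (p * p) ((n * n) * (n * n)))) (*-monoʳ-≤ 2 p²n⁴)) ⟩
        (p * p * p * (n * n * n) + (p * n⁶ + 2 * (p * p * p * (n * n * n)))) + 2 * (p * p * p * (n * n * n))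
          ≡⟨ solve 3 (λ p M n → (p :* p :* p :* M :+ (p :* n :+ con 2 :* (p :* p :* p :* M))) :+ con 2 :* (p :* p :* p :* M) := p :* (n :+ con 5 :* (p :* p :* M))) refl p (n * n * n) n⁶ ⟩
        p * (n⁶ + error) ∎)
        where
        open ≤-Reasoning
        p²n⁴ : p * p * ((n * n) * (n * n)) ≤ p * p * p * (n * n * n)
        p²n⁴ = ≤-trans (≤-reflexive (solve 2 (λ p n → p :* p :* ((n :* n) :* (n :* n)) := n :* (p :* p :* (n :* n :* n))) refl p n))
          (≤-trans (*-monoˡ-≤ (p * p * (n * n * n)) n≤p) (≤-reflexive (solve 2 (λ p M → p :* (p :* p :* M) := p :* p :* p :* M) refl p (n * n * n))))
        K≤ : p * p * K ≤ S + (p * n⁶ + 2 * (p * p * ((n * n) * (n * n))))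
        K≤ = +-cancelʳ-≤ (p * n⁶) _ _ (begin
          p * p * K + p * n⁶ ≤⟨ +-monoʳ-≤ (p * p * K) (m≤n+m (p * n⁶) (p * p * Q)) ⟩
          p * p * K + (p * p * Q + p * n⁶) ≡⟨ third ⟩
          S + 2 * (p * (n * n)) * Q ≤⟨ +-monoʳ-≤ S (*-monoʳ-≤ (2 * (p * (n * n))) Q≤) ⟩
          S + 2 * (p * (n * n)) * ((n * n) * (n * n) + p * (n * n)) ≡⟨ solve 3 (λ S p N → S :+ con 2 :* (p :* N) :* (N :* N :+ p :* N) := (S :+ (p :* (N :* N :* N) :+ con 2 :* (p :* p :* (N :* N)))) :+ p :* (N :* N :* N)) refl S p (n * n) ⟩
          (S + (p * n⁶ + 2 * (p * p * ((n * n) * (n * n))))) + p * n⁶ ∎)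

      lower : n⁶ ≤ p * T + error
      lower = *-cancelˡ-≤ p {{>-nonZero p>0}} (begin
        p * n⁶ ≤⟨ +-cancelʳ-≤ X _ _ main ⟩
        p * p * K + (p * p * p * (n * n) + 2 * (p * (n * n)) * (n * n * n)) ≤⟨ +-mono-≤ (*-monoʳ-≤ (p * p) (≤-trans (m≤m+n K D) (≤-reflexive (sym T≡)))) (+-mono-≤ (*-monoʳ-≤ (p * p * p) n²≤n³) pn⁵) ⟩
        p * p * T + (p * p * p * (n * n * n) + 2 * (p * p * p * (n * n * n))) ≤⟨ m≤m+n _ (2 * (p * p * p * (n * n * n))) ⟩
        p * p * T + (p * p * p * (n * n * n) + 2 * (p * p * p * (n * n * n))) + 2 * (p * p * p * (n * n * n))
          ≡⟨ solve 3 (λ p T M → p :* p :* T :+ (p :* p :* p :* M :+ con 2 :* (p :* p :* p :* M)) :+ con 2 :* (p :* p :* p :* M) := p :* (p :* T :+ con 5 :* (p :* p :* M))) refl p T (n * n * n) ⟩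
        p * (p * T + error) ∎)
        where
        open ≤-Reasoning
        pn⁵ : 2 * (p * (n * n)) * (n * n * n) ≤ 2 * (p * p * p * (n * n * n))
        pn⁵ = ≤-trans (*-monoˡ-≤ (n * n * n) (*-monoʳ-≤ 2 (*-monoʳ-≤ p (*-mono-≤ n≤p n≤p)))) (≤-reflexive (solve 2 (λ p M → con 2 :* (p :* (p :* p)) :* M := con 2 :* (p :* p :* p :* M)) refl p (n * n * n)))
        X = p * n⁶ + 2 * (p * p * ((n * n) * (n * n)))
        main : p * n⁶ + X ≤ (p * p * K + (p * p * p * (n * n) + 2 * (p * (n * n)) * (n * n * n))) + X
        main = begin
          p * n⁶ + X ≡⟨ solve 2 (λ p N → p :* (N :* N :* N) :+ (p :* (N :* N :* N) :+ con 2 :* (p :* p :* (N :* N))) := con 2 :* (p :* N) :* (N :* N :+ p :* N)) refl p (n * n) ⟩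
          2 * (p * (n * n)) * ((n * n) * (n * n) + p * (n * n)) ≡⟨ cong (2 * (p * (n * n)) *_) Q-eq ⟨
          2 * (p * (n * n)) * (Q + n * n * n) ≡⟨ *-distribˡ-+ (2 * (p * (n * n))) Q _ ⟩
          2 * (p * (n * n)) * Q + 2 * (p * (n * n)) * (n * n * n) ≤⟨ +-monoˡ-≤ _ (≤-trans (m≤n+m _ S) (≤-reflexive (sym third))) ⟩
          (p * p * K + (p * p * Q + p * n⁶)) + 2 * (p * (n * n)) * (n * n * n)
            ≤⟨ +-monoˡ-≤ _ (+-monoʳ-≤ (p * p * K) (+-monoˡ-≤ (p * n⁶) (*-monoʳ-≤ (p * p) Q≤))) ⟩
          (p * p * K + (p * p * ((n * n) * (n * n) + p * (n * n)) + p * n⁶)) + 2 * (p * (n * n)) * (n * n * n)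
            ≤⟨ m≤m+n _ (p * p * ((n * n) * (n * n))) ⟩
          (p * p * K + (p * p * ((n * n) * (n * n) + p * (n * n)) + p * n⁶)) + 2 * (p * (n * n)) * (n * n * n) + p * p * ((n * n) * (n * n))
            ≡⟨ solve 5 (λ A p N Y n⁶ → (A :+ (p :* p :* (N :* N :+ p :* N) :+ p :* n⁶)) :+ Y :+ p :* p :* (N :* N)
              := (A :+ (p :* p :* p :* N :+ Y)) :+ (p :* n⁶ :+ con 2 :* (p :* p :* (N :* N)))) refl (p * p * K) p (n * n) (2 * (p * (n * n)) * (n * n * n)) n⁶ ⟩
          (p * p * K + (p * p * p * (n * n) + 2 * (p * (n * n)) * (n * n * n))) + X ∎

      distance : ∣ p * T - n⁶ ∣ ≤ error
      distance with ≤-total (p * T) n⁶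
      ... | inj₁ h = ≤-trans (≤-reflexive (m≤n⇒∣m-n∣≡n∸m h)) (m≤n+o⇒m∸n≤o n⁶ (p * T) lower)
      ... | inj₂ h = ≤-trans (≤-reflexive (m≤n⇒∣n-m∣≡n∸m h)) (m≤n+o⇒m∸n≤o (p * T) n⁶ upper)

-- Choice of the parameters m and r

module Optimization where
  open import Data.Nat
  open import Data.Nat.DivMod using (_/_; _%_; m≡m%n+[m/n]*n; m%n<n)
  open import Data.Nat.Properties
  open import Relation.Binary.PropositionalEquality

  ^-distribʳ-* : ∀ k m n → (m * n) ^ k ≡ m ^ k * n ^ k
  ^-distribʳ-* zero    m n = refl
  ^-distribʳ-* (suc k) m n = trans (cong (m * n *_) (^-distribʳ-* k m n))
    (solve 4 (λ m n a b → m :* n :* (a :* b) := m :* a :* (n :* b)) refl m n (m ^ k) (n ^ k))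
    where open +-*-Solver

  ^-cancelʳ-≤ : ∀ k {m n} → .{{_ : NonZero k}} → m ^ k ≤ n ^ k → m ≤ n
  ^-cancelʳ-≤ k {m} {n} h with m ≤? n
  ... | yes m≤n = m≤n
  ... | no  m≰n = ⊥-elim (<⇒≱ (^-monoˡ-< k (≰⇒> m≰n)) h)

  -- Powers of numerals, kept opaque so that they are never unfolded into unary sums.
  opaque
    K : ℕ → ℕ → ℕ
    K = _^_

    K-distrib : ∀ c k x → (c * x) ^ k ≡ K c k * x ^ k
    K-distrib c k x = ^-distribʳ-* k c x

    -- The 28 is 4 · 7, with 7 from m T ≤ 7 n⁵ and 4 from passing between m and m + 1 in 2 (m + 1) ≤
    -- 4 m; the 1 pays for the main term n⁶.
    constant : ℕ
    constant = K 28 9 + 1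

    constant≡ : constant ≡ K 28 9 + 1
    constant≡ = refl

    5⁹≤constant : K 5 9 ≤ constant
    5⁹≤constant = <⇒≤ (<ᵇ⇒< (K 5 9) constant _)

    6⁹≤28⁹ : K 6 9 ≤ K 28 9
    6⁹≤28⁹ = <⇒≤ (<ᵇ⇒< (K 6 9) (K 28 9) _)

    6⁷≤128³ : K 6 7 ≤ 128 ^ 3
    6⁷≤128³ = <⇒≤ (<ᵇ⇒< (K 6 7) (128 ^ 3) _)

  last-holding : ∀ {P : ℕ → Set} → (∀ k → Dec (P k)) → P 0 → ∀ N → ¬ P N → ∃[ m ] P m × ¬ P (suc m)
  last-holding P? p0 zero    ¬p = ⊥-elim (¬p p0)
  last-holding P? p0 (suc N) ¬p with P? N
  ... | yes p = N , p , ¬p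
  ... | no ¬q = last-holding P? p0 N ¬q

  module Numeric (p n T : ℕ) (n≤p : n ≤ p) (large : p ^ 2 < n ^ 5)
    (asymptotic : ∣ p * T - n ^ 6 ∣ ≤ 5 * (p ^ 2 * n ^ 3))
    (trivial : T ≤ 3 * n ^ 5)
    (rich : ∀ m r → m * m * r ≤ n → n < 2 * (m * m * r) → 84 * (m * (m * (m * (m * m)))) < r →
            2 * (12 * (m * m * m)) ≤ p → r * (12 * (m * m * m)) ≤ p → m * T ≤ 7 * n ^ 5)
    where
    open +-*-Solver

    private
      n>0 : 0 < n
      n>0 = n≢0⇒n>0 λ e → n≮0 (subst (λ n → p ^ 2 < n ^ 5) e large)

      instance
        n≢0 : NonZero n
        n≢0 = >-nonZero n>0
        p≢0 : NonZero p
        p≢0 = >-nonZero (<-≤-trans n>0 n≤p)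

      pow : ∀ a b → n ^ a * n ^ b ≡ n ^ (a + b)
      pow a b = sym (^-distribˡ-+-* n a b)

      powp : ∀ a b → p ^ a * p ^ b ≡ p ^ (a + b)
      powp a b = sym (^-distribˡ-+-* p a b)

    private
      Goal = ∣ p * T - n ^ 6 ∣ ^ 9 ≤ constant * (n ^ 40 * p ^ 11)

    -- The ninth power of the error is of order p¹⁸ n²⁷, and trading p⁷ for n¹³ in it gives p¹¹ n⁴⁰;
    -- this fixes the threshold.
    dense : p ^ 7 ≤ n ^ 13 → Goal
    dense h = begin
      ∣ p * T - n ^ 6 ∣ ^ 9 ≤⟨ ^-monoˡ-≤ 9 asymptotic ⟩
      (5 * (p ^ 2 * n ^ 3)) ^ 9 ≡⟨ trans (K-distrib 5 9 (p ^ 2 * n ^ 3)) (cong (K 5 9 *_) (trans (^-distribʳ-* 9 (p ^ 2) (n ^ 3)) (cong₂ _*_ (^-*-assoc p 2 9) (^-*-assoc n 3 9)))) ⟩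
      K 5 9 * (p ^ 18 * n ^ 27) ≡⟨ cong (λ x → K 5 9 * (x * n ^ 27)) (powp 7 11) ⟨
      K 5 9 * (p ^ 7 * p ^ 11 * n ^ 27) ≤⟨ *-mono-≤ 5⁹≤constant (*-monoˡ-≤ (n ^ 27) (*-monoˡ-≤ (p ^ 11) h)) ⟩
      constant * (n ^ 13 * p ^ 11 * n ^ 27) ≡⟨ cong (constant *_) (trans (solve 3 (λ a b c → a :* b :* c := a :* c :* b) refl (n ^ 13) (p ^ 11) (n ^ 27)) (cong (_* p ^ 11) (pow 13 27))) ⟩
      constant * (n ^ 40 * p ^ 11) ∎
      where open ≤-Reasoning

    module _ (sparse : n ^ 13 < p ^ 7) where
      private
        n²⁶≤p¹⁴ : n ^ 26 ≤ p ^ 14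
        n²⁶≤p¹⁴ = subst₂ _≤_ (^-*-assoc n 13 2) (^-*-assoc p 7 2) (^-monoˡ-≤ 2 (<⇒≤ sparse))

      -- Below the threshold the main term is itself within the permitted error, because n¹⁴ ≤ p⁸ ≤
      -- p¹¹. Only an upper bound for T remains to be supplied.
      from-T : T ^ 9 ≤ K 28 9 * (n ^ 40 * p ^ 2) → Goal
      from-T h = begin
        ∣ p * T - n ^ 6 ∣ ^ 9 ≤⟨ ^-monoˡ-≤ 9 (∣m-n∣≤m⊔n (p * T) (n ^ 6)) ⟩
        (p * T ⊔ n ^ 6) ^ 9 ≤⟨ max-pow (≤-total (p * T) (n ^ 6)) ⟩
        (p * T) ^ 9 + (n ^ 6) ^ 9 ≤⟨ +-mono-≤ first second ⟩
        K 28 9 * (n ^ 40 * p ^ 11) + 1 * (n ^ 40 * p ^ 11) ≡⟨ trans (cong (_* (n ^ 40 * p ^ 11)) constant≡) (*-distribʳ-+ (n ^ 40 * p ^ 11) (K 28 9) 1) ⟨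
        constant * (n ^ 40 * p ^ 11) ∎
        where
        open ≤-Reasoning
        max-pow : _ → (p * T ⊔ n ^ 6) ^ 9 ≤ (p * T) ^ 9 + (n ^ 6) ^ 9
        max-pow (inj₁ l) = ≤-trans (≤-reflexive (cong (_^ 9) (m≤n⇒m⊔n≡n l))) (m≤n+m _ _)
        max-pow (inj₂ l) = ≤-trans (≤-reflexive (cong (_^ 9) (m≥n⇒m⊔n≡m l))) (m≤m+n _ _)
        first : (p * T) ^ 9 ≤ K 28 9 * (n ^ 40 * p ^ 11)
        first = begin
          (p * T) ^ 9 ≡⟨ ^-distribʳ-* 9 p T ⟩
          p ^ 9 * T ^ 9 ≤⟨ *-monoʳ-≤ (p ^ 9) h ⟩
          p ^ 9 * (K 28 9 * (n ^ 40 * p ^ 2)) ≡⟨ solve 4 (λ a k b c → a :* (k :* (b :* c)) := k :* (b :* (a :* c))) refl (p ^ 9) (K 28 9) (n ^ 40) (p ^ 2) ⟩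
          K 28 9 * (n ^ 40 * (p ^ 9 * p ^ 2)) ≡⟨ cong (λ x → K 28 9 * (n ^ 40 * x)) (powp 9 2) ⟩
          K 28 9 * (n ^ 40 * p ^ 11) ∎
        second : (n ^ 6) ^ 9 ≤ 1 * (n ^ 40 * p ^ 11)
        second = begin
          (n ^ 6) ^ 9 ≡⟨ ^-*-assoc n 6 9 ⟩
          n ^ 54 ≡⟨ pow 40 14 ⟨
          n ^ 40 * n ^ 14 ≡⟨ cong (n ^ 40 *_) (pow 13 1) ⟨
          n ^ 40 * (n ^ 13 * n ^ 1) ≤⟨ *-monoʳ-≤ (n ^ 40) (*-mono-≤ (<⇒≤ sparse) (^-monoˡ-≤ 1 n≤p)) ⟩
          n ^ 40 * (p ^ 7 * p ^ 1) ≡⟨ cong (n ^ 40 *_) (powp 7 1) ⟩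
          n ^ 40 * p ^ 8 ≤⟨ *-monoʳ-≤ (n ^ 40) (^-monoʳ-≤ p (<⇒≤ (<ᵇ⇒< 8 11 _))) ⟩
          n ^ 40 * p ^ 11 ≡⟨ *-identityˡ _ ⟨
          1 * (n ^ 40 * p ^ 11) ∎

      private
        -- The 2 leaves room for constants: it leads to (2 m)⁷ ≤ n and thereby to r ≥ 128 m⁵, safely
        -- above 84 m⁵.
        Admissible : ℕ → Set
        Admissible m = (2 * m) ^ 9 * p ^ 2 ≤ n ^ 5

        admissible? : ∀ m → Dec (Admissible m)
        admissible? m = (2 * m) ^ 9 * p ^ 2 ≤? n ^ 5

        not-admissible : ¬ Admissible n
        not-admissible h = <⇒≱ n⁵< h
          where
          open ≤-Reasoning
          n⁵< : n ^ 5 < (2 * n) ^ 9 * p ^ 2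
          n⁵< = begin-strict
            n ^ 5 ≤⟨ ^-monoʳ-≤ n (<⇒≤ (<ᵇ⇒< 5 9 _)) ⟩
            n ^ 9 <⟨ ^-monoˡ-< 9 (m<m+n n {n + 0} (<-≤-trans n>0 (m≤m+n n 0))) ⟩
            (2 * n) ^ 9 ≤⟨ m≤m*n ((2 * n) ^ 9) (p ^ 2) {{m^n≢0 p 2}} ⟩
            (2 * n) ^ 9 * p ^ 2 ∎

      -- Here n⁵ < 2⁹ p², so the trivial bound T ≤ 3 n⁵ already has the required size.
      small-scale : ¬ Admissible 1 → T ^ 9 ≤ K 28 9 * (n ^ 40 * p ^ 2)
      small-scale h = begin
        T ^ 9 ≤⟨ *-cancelʳ-≤ _ _ (n ^ 5) {{m^n≢0 n 5}} scaled ⟩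
        K 6 9 * (n ^ 40 * p ^ 2) ≤⟨ *-monoˡ-≤ (n ^ 40 * p ^ 2) 6⁹≤28⁹ ⟩
        K 28 9 * (n ^ 40 * p ^ 2) ∎
        where
        open ≤-Reasoning
        scaled : T ^ 9 * n ^ 5 ≤ K 6 9 * (n ^ 40 * p ^ 2) * n ^ 5
        scaled = begin
          T ^ 9 * n ^ 5 ≤⟨ *-monoʳ-≤ (T ^ 9) (<⇒≤ (≰⇒> h)) ⟩
          T ^ 9 * (2 ^ 9 * p ^ 2) ≡⟨ trans (sym (*-assoc (T ^ 9) _ _)) (cong (_* p ^ 2) (trans (sym (^-distribʳ-* 9 T 2)) (cong (_^ 9) (*-comm T 2)))) ⟩
          (2 * T) ^ 9 * p ^ 2 ≤⟨ *-monoˡ-≤ (p ^ 2) (^-monoˡ-≤ 9 (*-monoʳ-≤ 2 trivial)) ⟩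
          (2 * (3 * n ^ 5)) ^ 9 * p ^ 2 ≡⟨ cong (_* p ^ 2) (trans (cong (_^ 9) (sym (*-assoc 2 3 (n ^ 5)))) (trans (K-distrib 6 9 (n ^ 5)) (cong (K 6 9 *_) (trans (^-*-assoc n 5 9) (sym (pow 40 5)))))) ⟩
          K 6 9 * (n ^ 40 * n ^ 5) * p ^ 2 ≡⟨ solve 4 (λ k a b c → k :* (a :* b) :* c := k :* (a :* c) :* b) refl (K 6 9) (n ^ 40) (n ^ 5) (p ^ 2) ⟩
          K 6 9 * (n ^ 40 * p ^ 2) * n ^ 5 ∎

      module _ (m : ℕ) {{m≢0 : NonZero m}} (admissible : Admissible m) (maximal : ¬ Admissible (suc m)) where
        private
          instance
            m²≢0 : NonZero (m * m)
            m²≢0 = m*n≢0 m m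

          r = n / (m * m)

          -- The seventh power of admissibility reads (2 m)⁶³ p¹⁴ ≤ n³⁵, and n²⁶ ≤ p¹⁴ leaves (2
          -- m)⁶³ ≤ n⁹.
          [2m]⁷≤n : (2 * m) ^ 7 ≤ n
          [2m]⁷≤n = ^-cancelʳ-≤ 9 (*-cancelʳ-≤ _ _ (n ^ 26) {{m^n≢0 n 26}} (begin
            ((2 * m) ^ 7) ^ 9 * n ^ 26 ≤⟨ *-monoʳ-≤ (((2 * m) ^ 7) ^ 9) n²⁶≤p¹⁴ ⟩
            ((2 * m) ^ 7) ^ 9 * p ^ 14 ≡⟨ cong₂ _*_ (trans (^-*-assoc (2 * m) 7 9) (sym (^-*-assoc (2 * m) 9 7))) (sym (^-*-assoc p 2 7)) ⟩
            ((2 * m) ^ 9) ^ 7 * (p ^ 2) ^ 7 ≡⟨ ^-distribʳ-* 7 ((2 * m) ^ 9) (p ^ 2) ⟨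
            ((2 * m) ^ 9 * p ^ 2) ^ 7 ≤⟨ ^-monoˡ-≤ 7 admissible ⟩
            (n ^ 5) ^ 7 ≡⟨ trans (^-*-assoc n 5 7) (sym (pow 9 26)) ⟩
            n ^ 9 * n ^ 26 ∎))
            where open ≤-Reasoning

          m⁵ = m * (m * (m * (m * m)))

          m⁵≢0 : NonZero m⁵
          m⁵≢0 = m*n≢0 m _ {{m≢0}} {{m*n≢0 m _ {{m≢0}} {{m*n≢0 m _ {{m≢0}} {{m²≢0}}}}}}

          m⁷≢0 : NonZero (m * m * m⁵)
          m⁷≢0 = m*n≢0 (m * m) m⁵ {{m²≢0}} {{m⁵≢0}}

          m⁴≢0 : NonZero (m * m * m * m)
          m⁴≢0 = m*n≢0 _ m {{m*n≢0 (m * m) m}}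

          128m⁷≤n : 128 * (m * m * m⁵) ≤ n
          128m⁷≤n = ≤-trans (≤-reflexive (solve 1 (λ m → con 128 :* (m :* m :* (m :* (m :* (m :* (m :* m))))) := (con 2 :* m) :^ 7) refl m)) [2m]⁷≤n

          n-split : n ≡ n % (m * m) + r * (m * m)
          n-split = m≡m%n+[m/n]*n n (m * m)

          m²r≤n : m * m * r ≤ n
          m²r≤n = ≤-trans (≤-trans (≤-reflexive (*-comm (m * m) r)) (m≤n+m _ _)) (≤-reflexive (sym n-split))

          n<m²[1+r] : n < m * m * suc r
          n<m²[1+r] = subst₂ _<_ (sym n-split) (trans (cong (m * m +_) (*-comm r (m * m))) (sym (*-suc (m * m) r))) (+-monoˡ-< (r * (m * m)) (m%n<n n (m * m)))

          128m⁵≤r : 128 * m⁵ ≤ r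
          128m⁵≤r = s≤s⁻¹ (*-cancelˡ-< (m * m) _ _ (≤-<-trans (≤-trans (≤-reflexive (solve 2 (λ M x → M :* (con 128 :* x) := con 128 :* (M :* x)) refl (m * m) m⁵)) 128m⁷≤n) n<m²[1+r]))

          84m⁵<r : 84 * m⁵ < r
          84m⁵<r = <-≤-trans (*-monoˡ-< m⁵ {{m⁵≢0}} (<ᵇ⇒< 84 128 _)) 128m⁵≤r

          r>0 : 0 < r
          r>0 = ≤-<-trans z≤n 84m⁵<r

          n<2m²r : n < 2 * (m * m * r)
          n<2m²r = <-≤-trans n<m²[1+r] (≤-trans (*-monoʳ-≤ (m * m) (≤-trans (+-monoˡ-≤ r r>0) (≤-reflexive (cong (r +_) (sym (+-identityʳ r))))))
            (≤-reflexive (solve 2 (λ M r → M :* (con 2 :* r) := con 2 :* (M :* r)) refl (m * m) r)))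

          24m³≤p : 2 * (12 * (m * m * m)) ≤ p
          24m³≤p = begin
            2 * (12 * (m * m * m)) ≡⟨ *-assoc 2 12 (m * m * m) ⟨
            24 * (m * m * m) ≤⟨ *-mono-≤ (<⇒≤ (<ᵇ⇒< 24 128 _)) (m≤m*n (m * m * m) (m * m * m * m) {{m⁴≢0}}) ⟩
            128 * (m * m * m * (m * m * m * m)) ≡⟨ cong (128 *_) (solve 1 (λ m → m :* m :* m :* (m :* m :* m :* m) := m :* m :* (m :* (m :* (m :* (m :* m))))) refl m) ⟩
            128 * (m * m * m⁵) ≤⟨ 128m⁷≤n ⟩
            n ≤⟨ n≤p ⟩
            p ∎
            where open ≤-Reasoning

          128≤n : 128 ≤ n
          128≤n = ≤-trans (m≤m*n 128 (m * m * m⁵) {{m⁷≢0}}) 128m⁷≤n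

          -- Needed for r E ≤ p, since r E = 12 m (m² r) ≤ 12 m n. By (2 m)⁷ ≤ n the seventh power
          -- is at most 6⁷ n⁸, and 6⁷ ≤ 128³ ≤ n³ brings it below n¹¹, hence below p⁷.
          12mn≤p : 12 * (m * n) ≤ p
          12mn≤p = ^-cancelʳ-≤ 7 (begin
            (12 * (m * n)) ^ 7 ≡⟨ cong (_^ 7) (solve 2 (λ m n → con 12 :* (m :* n) := con 6 :* (con 2 :* m :* n)) refl m n) ⟩
            (6 * (2 * m * n)) ^ 7 ≡⟨ trans (K-distrib 6 7 (2 * m * n)) (cong (K 6 7 *_) (^-distribʳ-* 7 (2 * m) n)) ⟩
            K 6 7 * ((2 * m) ^ 7 * n ^ 7) ≤⟨ *-mono-≤ (≤-trans 6⁷≤128³ (^-monoˡ-≤ 3 128≤n)) (*-monoˡ-≤ (n ^ 7) [2m]⁷≤n) ⟩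
            n ^ 3 * (n * n ^ 7) ≡⟨ pow 3 8 ⟩
            n ^ 11 ≤⟨ ^-monoʳ-≤ n (<⇒≤ (<ᵇ⇒< 11 13 _)) ⟩
            n ^ 13 ≤⟨ <⇒≤ sparse ⟩
            p ^ 7 ∎)
            where open ≤-Reasoning

          rE≤p : r * (12 * (m * m * m)) ≤ p
          rE≤p = ≤-trans (≤-trans (≤-reflexive (solve 2 (λ m r → r :* (con 12 :* (m :* m :* m)) := con 12 :* (m :* (m :* m :* r))) refl m r))
            (*-monoʳ-≤ 12 (*-monoʳ-≤ m m²r≤n))) 12mn≤p

          mT≤ : m * T ≤ 7 * n ^ 5
          mT≤ = rich m r m²r≤n n<2m²r 84m⁵<r 24m³≤p rE≤p

        -- Maximality of m replaces n⁵ by (4 m)⁹ p², and then m T ≤ 7 n⁵ applies; cancelling n⁵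
        -- again gives the claim.
        large-scale : T ^ 9 ≤ K 28 9 * (n ^ 40 * p ^ 2)
        large-scale = *-cancelʳ-≤ _ _ (n ^ 5) {{m^n≢0 n 5}} (begin
          T ^ 9 * n ^ 5 ≤⟨ *-monoʳ-≤ (T ^ 9) (<⇒≤ (≰⇒> maximal)) ⟩
          T ^ 9 * ((2 * suc m) ^ 9 * p ^ 2) ≤⟨ *-monoʳ-≤ (T ^ 9) (*-monoˡ-≤ (p ^ 2) (^-monoˡ-≤ 9 next)) ⟩
          T ^ 9 * ((4 * m) ^ 9 * p ^ 2) ≡⟨ trans (sym (*-assoc (T ^ 9) _ _)) (cong (_* p ^ 2) (trans (sym (^-distribʳ-* 9 T (4 * m))) (cong (_^ 9) (solve 2 (λ T m → T :* (con 4 :* m) := con 4 :* (m :* T)) refl T m)))) ⟩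
          (4 * (m * T)) ^ 9 * p ^ 2 ≤⟨ *-monoˡ-≤ (p ^ 2) (^-monoˡ-≤ 9 (*-monoʳ-≤ 4 mT≤)) ⟩
          (4 * (7 * n ^ 5)) ^ 9 * p ^ 2 ≡⟨ cong (_* p ^ 2) (trans (cong (_^ 9) (sym (*-assoc 4 7 (n ^ 5)))) (trans (K-distrib 28 9 (n ^ 5)) (cong (K 28 9 *_) (trans (^-*-assoc n 5 9) (sym (pow 40 5)))))) ⟩
          K 28 9 * (n ^ 40 * n ^ 5) * p ^ 2 ≡⟨ solve 4 (λ k a b c → k :* (a :* b) :* c := k :* (a :* c) :* b) refl (K 28 9) (n ^ 40) (n ^ 5) (p ^ 2) ⟩
          K 28 9 * (n ^ 40 * p ^ 2) * n ^ 5 ∎)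
          where
          open ≤-Reasoning
          next : 2 * suc m ≤ 4 * m
          next = ≤-trans (*-monoʳ-≤ 2 (≤-trans (+-monoˡ-≤ m (>-nonZero⁻¹ m)) (≤-reflexive (cong (m +_) (sym (+-identityʳ m)))))) (≤-reflexive (sym (*-assoc 2 2 m)))

      sparse-case : Goal
      sparse-case = from-T (go (last-holding admissible? z≤n n not-admissible))
        where
        go : ∃[ m ] Admissible m × ¬ Admissible (suc m) → T ^ 9 ≤ K 28 9 * (n ^ 40 * p ^ 2)
        go (zero   , _ , h) = small-scale h
        go (suc m , a , h) = large-scale (suc m) a h

    bound : Goal
    bound with p ^ 7 ≤? n ^ 13
    ... | yes h = dense h
    ... | no  h = sparse-case (≰⇒> h)

-- Transfer of the bound to `T` and to subsets of `Fin p`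

module Assembly where
  open Unfolding using (∑; 𝟙; T≡∑)
  open FiniteSums
  open RichLines
  open Variance
  open Optimization
  open PrimeFields
  open import Defs
  open import Data.Bool using (true; false)
  open import Data.Fin as Fin using (Fin; toℕ)
  open import Data.Fin.Properties using (toℕ<n; toℕ-injective)
  open import Data.Fin.Subset using (Subset; ∣_∣; inside) renaming (_∈_ to _∈ˢ_)
  open import Data.Fin.Subset.Properties using (∣p∣≤n; drop-there) renaming (_∈?_ to _∈ˢ?_)
  open import Data.Integer using (+_)
  open import Data.List using ([_]; concatMap; allFin; tabulate)
  open import Data.List.Properties using (map-tabulate)
  open import Data.List.Membership.Propositional.Properties using (∈-++⁻)
  open import Data.Nat
  open import Data.Nat.Properties
  open import Data.Nat.Primality using (Prime)
  open import Data.Vec using (here; there)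
  open import Relation.Binary.PropositionalEquality using (refl; cong; cong₂; subst; subst₂; sym; trans)

  module TripleBound (F : Domain) (p : ℕ) (𝔽 : PrimeFieldStructure p F)
    (xs : List ℕ) (xs-unique : Unique xs) (xs<p : ∀ {a} → a ∈ xs → a < p)
    (n≤p : length xs ≤ p) (large : p ^ 2 < length xs ^ 5)
    where
    open PrimeFieldStructure 𝔽 using (⟨_⟩)
    private
      module D = Domain F
      n = length xs
      module C = Counting F p 𝔽 xs xs-unique xs<p

    Col : ℕ × ℕ → ℕ × ℕ → ℕ × ℕ → Set
    Col (a , a′) (b , b′) (c , c′) =
      (⟨ b ⟩ D.+ D.- ⟨ a ⟩) D.* (⟨ c′ ⟩ D.+ D.- ⟨ a′ ⟩) D.≈ (⟨ c ⟩ D.+ D.- ⟨ a ⟩) D.* (⟨ b′ ⟩ D.+ D.- ⟨ a′ ⟩)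

    triple-bound : ∀ {T} (col? : ∀ P Q Z → Dec (Col P Q Z)) →
      T ≡ (let pts = cartesianProduct xs xs in ∑ pts λ P → ∑ pts λ Q → ∑ pts λ Z → 𝟙 (col? P Q Z)) →
      ∣ p * T - n ^ 6 ∣ ^ 9 ≤ constant * (n ^ 40 * p ^ 11)
    triple-bound {T} col? refl = Numeric.bound p n T n≤p large asymptotic trivial λ m r h₁ h₂ h₃ h₄ h₅ →
        ≤-trans (C.triples≤ m r h₁ h₂ h₃ h₄ h₅ col?) (≤-reflexive (cong (7 *_) n⁵))
      where
      open +-*-Solver
      module Tr = C.Triples col?
      n>0 : 0 < n
      n>0 = n≢0⇒n>0 λ e → n≮0 (subst (λ n → p ^ 2 < n ^ 5) e large)
      n⁵ : n * ((n * n) * (n * n)) ≡ n ^ 5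
      n⁵ = solve 1 (λ n → n :* ((n :* n) :* (n :* n)) := n :^ 5) refl n
      trivial : T ≤ 3 * n ^ 5
      trivial = ≤-trans (C.Trivial.triples≤3n⁵ col? n>0) (≤-reflexive (cong (3 *_) n⁵))
      asymptotic : ∣ p * T - n ^ 6 ∣ ≤ 5 * (p ^ 2 * n ^ 3)
      asymptotic = subst₂ _≤_
        (cong (∣ p * T -_∣) (solve 1 (λ n → (n :* n) :* (n :* n) :* (n :* n) := n :^ 6) refl n))
        (cong (5 *_) (solve 2 (λ p n → p :* p :* (n :* n :* n) := p :^ 2 :* n :^ 3) refl p n))
        (Moments.distance C.lines C.i C.J p n
          (trans (length-cartesianProduct (upTo p) (upTo p)) (cong₂ _*_ (length-upTo p) (length-upTo p)))
          C.∑i C.∑J C.J+i≡i² C.i≤n n≤p Tr.triples-split Tr.degenerate≤ (<-≤-trans n>0 n≤p))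

  module Elements {p} (A : Subset p) where
    mutual
      private
        -- The case distinction inside elems is local to it as well; unification finds it.
        keeps : ∃[ keep ] elems A ≡ concatMap keep (allFin p) × (∀ x → x ∈ˢ A → keep x ≡ [ toℕ x ]) × (∀ x → ¬ x ∈ˢ A → keep x ≡ [])
        keeps = _ , refl , keep-∈ , keep-∉

        keep-∈ : ∀ x → x ∈ˢ A → _ ≡ [ toℕ x ]
        keep-∈ x h with x ∈ˢ? A
        ... | yes _ = refl
        ... | no ¬h = ⊥-elim (¬h h)

        keep-∉ : ∀ x → ¬ x ∈ˢ A → _ ≡ []
        keep-∉ x ¬h with x ∈ˢ? A
        ... | yes h = ⊥-elim (¬h h)
        ... | no _  = refl

    private
      keep = proj₁ keeps

      keep⊆ : ∀ x {z} → z ∈ keep x → z ≡ toℕ x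
      keep⊆ x {z} h = go (x ∈ˢ? A)
        where
        go : Dec (x ∈ˢ A) → z ≡ toℕ x
        go (yes x∈) with here e ← subst (z ∈_) (proj₁ (proj₂ (proj₂ keeps)) x x∈) h = e
        go (no x∉) with () ← subst (z ∈_) (proj₂ (proj₂ (proj₂ keeps)) x x∉) h

      length-keep : ∀ x → length (keep x) ≡ 𝟙 (x ∈ˢ? A)
      length-keep x = go (x ∈ˢ? A)
        where
        go : (d : Dec (x ∈ˢ A)) → length (keep x) ≡ 𝟙 d
        go (yes x∈) = cong length (proj₁ (proj₂ (proj₂ keeps)) x x∈)
        go (no x∉)  = cong length (proj₂ (proj₂ (proj₂ keeps)) x x∉)

      unique-keep : ∀ x → Unique (keep x)
      unique-keep x = go (x ∈ˢ? A)
        where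
        go : Dec (x ∈ˢ A) → Unique (keep x)
        go (yes x∈) = subst Unique (sym (proj₁ (proj₂ (proj₂ keeps)) x x∈)) ([] ∷ [])
        go (no x∉)  = subst Unique (sym (proj₂ (proj₂ (proj₂ keeps)) x x∉)) []

      concat⊆ : ∀ ys {z} → z ∈ concatMap keep ys → ∃[ x ] x ∈ ys × z ≡ toℕ x
      concat⊆ (y ∷ ys) h with ∈-++⁻ (keep y) h
      ... | inj₁ h′ = y , here refl , keep⊆ y h′
      ... | inj₂ h′ = let (x , x∈ , e) = concat⊆ ys h′ in x , there x∈ , e

      concat-unique : ∀ {ys} → Unique ys → Unique (concatMap keep ys)
      concat-unique [] = []
      concat-unique {y ∷ ys} (d ∷ ds) = Uniqueₚ.++⁺ (unique-keep y) (concat-unique ds)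
        λ (h , h′) → let (x , x∈ , e) = concat⊆ ys h′ in
          All.lookup d x∈ (toℕ-injective (trans (sym (keep⊆ y h)) e))

      length-concat : ∀ ys → length (concatMap keep ys) ≡ ∑ ys (λ x → 𝟙 (x ∈ˢ? A))
      length-concat []       = refl
      length-concat (y ∷ ys) = trans (length-++ (keep y)) (cong₂ _+_ (length-keep y) (length-concat ys))

    elems<p : ∀ {a} → a ∈ elems A → a < p
    elems<p h = let (x , _ , e) = concat⊆ (allFin p) h in subst (_< p) (sym e) (toℕ<n x)

    elems-unique : Unique (elems A)
    elems-unique = concat-unique (Uniqueₚ.allFin⁺ p)

    length-elems′ : length (elems A) ≡ ∑ (allFin p) (λ x → 𝟙 (x ∈ˢ? A))
    length-elems′ = length-concat (allFin p)

  count-members : ∀ {n} (A : Subset n) → ∑ (allFin n) (λ x → 𝟙 (x ∈ˢ? A)) ≡ ∣ A ∣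
  count-members []      = refl
  count-members {suc n} (b ∷ A) = trans (cong₂ _+_ (first b) rest) (combine b)
    where
    first : ∀ b → 𝟙 (Fin.zero ∈ˢ? (b ∷ A)) ≡ 𝟙 (b Data.Bool.≟ inside)
    first true  = refl
    first false = refl
    rest : ∑ (tabulate Fin.suc) (λ x → 𝟙 (x ∈ˢ? (b ∷ A))) ≡ ∣ A ∣
    rest = trans (cong (λ ys → ∑ ys (λ x → 𝟙 (x ∈ˢ? (b ∷ A)))) (sym (map-tabulate (λ x → x) Fin.suc)))
      (trans (∑-map Fin.suc (allFin n) _) (trans (∑-cong (allFin n) λ x → 𝟙-⇔ (Fin.suc x ∈ˢ? (b ∷ A)) (x ∈ˢ? A) drop-there there) (count-members A)))
    combine : ∀ b → 𝟙 (b Data.Bool.≟ inside) + ∣ A ∣ ≡ ∣ b ∷ A ∣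
    combine true  = refl
    combine false = refl

  module Concrete (p : ℕ) (prime : Prime p) (A : Subset p) (large : p ^ 2 < ∣ A ∣ ^ 5) where
    open PrimeField p prime
    open Elements A

    length-elems : length (elems A) ≡ ∣ A ∣
    length-elems = trans length-elems′ (count-members A)

    col? : ∀ P Q Z → Dec (CollinearF (+ proj₁ P) (+ proj₂ P) (+ proj₁ Q) (+ proj₂ Q) (+ proj₁ Z) (+ proj₂ Z))
    col? (a , a′) (b , b′) (c , c′) = _ ≈? _

    T≡triples : T p A ≡ (let pts = cartesianProduct (elems A) (elems A) in ∑ pts λ P → ∑ pts λ Q → ∑ pts λ Z → 𝟙 (col? P Q Z))
    T≡triples = trans (T≡∑ p A) (sym (trans (∑-cartesianProduct E E _) (∑-cong-∈ E λ {a} a∈ → ∑-cong-∈ E λ {a′} a′∈ →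
        trans (∑-cartesianProduct E E _) (∑-cong E λ b → ∑-cong E λ b′ →
        trans (∑-cartesianProduct E E _) (∑-cong E λ c → ∑-cong E λ c′ →
          𝟙-⇔ (col? (a , a′) (b , b′) (c , c′)) (collinear? p a a′ b b′ c c′)
            (collinear⇐ b b′ c c′ (elems<p a∈) (elems<p a′∈)) (collinear⇒ b b′ c c′ (elems<p a∈) (elems<p a′∈)))))))
      where E = elems A

    bound : ∣ p * T p A - ∣ A ∣ ^ 6 ∣ ^ 9 ≤ constant * (∣ A ∣ ^ 40 * p ^ 11)
    bound = subst (λ n → ∣ p * T p A - n ^ 6 ∣ ^ 9 ≤ constant * (n ^ 40 * p ^ 11)) length-elems
      (TripleBound.triple-bound F p structure (elems A) elems-unique elems<p
        (subst (_≤ p) (sym length-elems) (∣p∣≤n A)) (subst (λ n → p ^ 2 < n ^ 5) (sym length-elems) large) col? T≡triples)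

open import Defs
open import Data.Nat using (ℕ; _*_; _^_; _≤_; _<_; ∣_-_∣)
open import Data.Nat.Primality using (Prime)
open import Data.Nat.Properties using (≤-trans; ≤-reflexive; *-assoc; *-identityʳ)
open import Data.Fin.Subset using (Subset; ∣_∣)
open import Data.Product using (∃-syntax; _,_)
open import Relation.Binary.PropositionalEquality using (sym; trans; cong)

-- Fractions and roots are cleared: multiplication by p and the ninth power turn the bound
-- |A|^(40/9) p^(2/9) into |A|⁴⁰ p¹¹, and |A| > p^(2/5) into p² < |A|⁵.
theorem36 : ∃[ C ] ∃[ K ] ((p : ℕ) → Prime p → (A : Subset p) →
    p ^ 2 < ∣ A ∣ ^ 5 →
    ∣ p * T p A - ∣ A ∣ ^ 6 ∣ ^ 9
    ≤ K * logTerm p ∣ A ∣ ^ C * ∣ A ∣ ^ 40 * p ^ 11)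
theorem36 = 0 , Optimization.constant , λ p prime A large → ≤-trans (Assembly.Concrete.bound p prime A large)
  (≤-reflexive (trans (sym (*-assoc Optimization.constant (∣ A ∣ ^ 40) (p ^ 11)))
    (cong (λ k → k * ∣ A ∣ ^ 40 * p ^ 11) (sym (*-identityʳ Optimization.constant)))))
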